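{- Let $n\geq 7$. Suppose $G_0\in\mathfrak{C}_{n,1}$ and $v_0\in V(G_0)$ satisfy $f_{G_0}(v_0)=\min\{f_G(v): G\in\mathfrak{C}_{n,1},\ v\in V(G)\}$. Then $G_0\cong L_{n,n-1}$ and $v_0$ is the pendant vertex of $L_{n,n-1}$.
   Context: All graphs are simple, finite, undirected and connected. A connected subgraph of $G$ is a connected subgraph in the usual sense (nonempty vertex subset with a subset of edges among them); distinct subgraphs are counted separately. $f_G(v)$ is the number of connected subgraphs of $G$ containing $v$. $\mathfrak{C}_{n,k}$ is the family of connected graphs on $n$ vertices with exactly $k$ cut vertices. $L_{n,n-1}$ is the graph obtained from the cycle $C_{n-1}$ by attaching one new pendant vertex adjacent to a vertex of the cycle. -}

module Defs where

open import Data.Bool using (Bool; true; false; _∧_; _∨_; not)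
open import Data.Nat using (ℕ; zero; suc; _≡ᵇ_; _∸_)
open import Data.Fin using (Fin; toℕ)
open import Data.Vec using (Vec; []; _∷_; lookup)
open import Data.List using (List; []; _∷_; concatMap; allFin; map)
open import Data.Bool.ListAction using (all; any)
open import Data.Product using (_×_; _,_)
open import Relation.Binary.PropositionalEquality using (_≡_)

Graph : ℕ → Set
Graph n = Fin n → Fin n → Bool

IsSimple : ∀ {n} → Graph n → Set
IsSimple {n} G = (∀ i j → G i j ≡ G j i) × (∀ i → G i i ≡ false)

_==F_ : ∀ {n} → Fin n → Fin n → Bool
i ==F j = toℕ i ≡ᵇ toℕ j

allF : ∀ n → (Fin n → Bool) → Bool
allF n p = all p (allFin n)

anyF : ∀ n → (Fin n → Bool) → Bool
anyF n p = any p (allFin n)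

reach : ∀ {n} → Graph n → Fin n → ℕ → Fin n → Bool
reach H s zero i = s ==F i
reach {n} H s (suc k) i = reach H s k i ∨ anyF n (λ j → reach H s k j ∧ H j i)

-- the graph (S , H) (H an edge relation among vertices of S) is connected:
-- any two vertices of S are joined by a walk in H (walks of length ≤ n suffice)
connectedB : ∀ {n} → (Fin n → Bool) → Graph n → Bool
connectedB {n} S H =
  allF n (λ s → not (S s) ∨ allF n (λ i → not (S i) ∨ reach H s n i))

-- G is connected (nonemptiness is given separately by n ≥ 7 where used)
IsConnected : ∀ {n} → Graph n → Set
IsConnected G = connectedB (λ _ → true) G ≡ true

delete : ∀ {n} → Graph n → Fin n → Graph n
delete G w i j = G i j ∧ not (i ==F w) ∧ not (j ==F w)

isCutB : ∀ {n} → Graph n → Fin n → Bool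
isCutB G w = not (connectedB (λ i → not (i ==F w)) (delete G w))

countB : ∀ {A : Set} → (A → Bool) → List A → ℕ
countB p [] = 0
countB p (x ∷ xs) with p x
... | true = suc (countB p xs)
... | false = countB p xs

numCut : ∀ {n} → Graph n → ℕ
numCut {n} G = countB (isCutB G) (allFin n)

InC : (n k : ℕ) → Graph n → Set
InC n k G = IsSimple G × IsConnected G × numCut G ≡ k

allVecsOver : ∀ {A : Set} → List A → (m : ℕ) → List (Vec A m)
allVecsOver xs zero = [] ∷ []
allVecsOver xs (suc m) = concatMap (λ v → map (λ x → x ∷ v) xs) (allVecsOver xs m)

allBools : List Bool
allBools = true ∷ false ∷ []

-- candidate subgraphs: a vertex set S (Vec Bool n) and an edge matrix (n×n Bool)
candidates : ∀ n → List (Vec Bool n × Vec (Vec Bool n) n)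
candidates n = concatMap (λ S → map (λ M → S , M) (allVecsOver (allVecsOver allBools n) n))
                         (allVecsOver allBools n)

-- (S , M) encodes a connected subgraph of G containing v:
-- v ∈ S, M symmetric, M ⊆ E(G), edges of M have both ends in S, (S , M) connected.
-- Each connected subgraph of G corresponds to exactly one such pair.
isConnSubgraphAt : ∀ {n} → Graph n → Fin n → Vec Bool n × Vec (Vec Bool n) n → Bool
isConnSubgraphAt {n} G v (S , M) =
  lookup S v ∧
  allF n (λ i → allF n (λ j →
     (H i j ≡B H j i) ∧ (not (H i j) ∨ (G i j ∧ lookup S i ∧ lookup S j)))) ∧
  connectedB (lookup S) H
  where
  H : Graph n
  H i j = lookup (lookup M i) j
  _≡B_ : Bool → Bool → Bool
  true ≡B b = b
  false ≡B b = not b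

f : ∀ {n} → Graph n → Fin n → ℕ
f {n} G v = countB (isConnSubgraphAt G v) (candidates n)

-- L_{n,n-1}: cycle on vertices 0,…,n-2 (consecutive vertices and {0,n-2} adjacent),
-- plus the pendant vertex n-1 adjacent to 0.
L : (n : ℕ) → Graph n
L n i j = (cyc a b ∨ cyc b a) ∨ pend a b ∨ pend b a
  where
  N = n ∸ 1
  a = toℕ i
  b = toℕ j
  lt : ℕ → Bool
  lt x = not (N ≤ᵇ' x)
    where
    _≤ᵇ'_ : ℕ → ℕ → Bool
    zero ≤ᵇ' y = true
    suc x ≤ᵇ' zero = false
    suc x ≤ᵇ' suc y = x ≤ᵇ' y
  cyc : ℕ → ℕ → Bool
  cyc x y = lt x ∧ lt y ∧ ((suc x ≡ᵇ y) ∨ ((x ≡ᵇ 0) ∧ (y ≡ᵇ (N ∸ 1))))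
  pend : ℕ → ℕ → Bool
  pend x y = (x ≡ᵇ N) ∧ (y ≡ᵇ 0)

{-# OPTIONS --safe #-}
module Submission where

-- Let W be a connected vertex set in which no vertex other than r is a cut vertex. Then W has an ordering
-- r = x₀, x₁, …, xₐ in which every xₖ with k ≥ 1 has a neighbour among x₀, …, xₖ₋₁ and one among r, xₖ₊₁, …, xₐ
-- (an st-ordering whose two poles coincide). Hence {x₀, …, xᵢ} ∪ {xⱼ₊₁, …, xₐ} is connected for all i and j,
-- which gives C(a+1, 2) + 1 connected vertex sets containing r, as many as in a cycle.
--
-- Let c be the cut vertex of G. A connected subgraph containing v splits at c into a subgraph of the part X
-- of G that contains v and, if it contains c, a subgraph of the remaining part Y. Multiplying the counts from
-- the orderings of X and Y gives more than C(n, 2) + 2 subgraphs unless v is a pendant vertex at c. In that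
-- case Y = G − v has C(n−1, 2) + 1 vertex sets of the above form. If c is a cut vertex of Y, multiply once
-- more. Otherwise, if some xᵢ, xᵢ₊₁ with 1 ≤ i < a are not adjacent, further connected sets and the spanning
-- subgraphs without the edges between x₁, …, xᵢ and xᵢ₊₁, …, xₐ exceed the bound. What remains is a Hamiltonian
-- cycle of Y, whose spanning paths, together with the cycle itself, attain the bound; a chord exceeds it.

open import Defs
open import Data.Bool using (Bool; true; false; _∧_; _∨_; not)
import Data.Bool.Properties as Bool
open import Data.Bool.ListAction using (all; any)
open import Data.Empty using (⊥; ⊥-elim)
open import Data.Fin using (Fin; zero; suc; toℕ; fromℕ<)
import Data.Fin.Properties as Fin
open import Data.List using (List; []; _∷_; _++_; length; map; filter; concatMap; cartesianProductWith; allFin; upTo)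
open import Data.List.Membership.Propositional using (_∈_)
import Data.List.Membership.Propositional.Properties as Mem
open import Data.List.Relation.Unary.All as All using (All; []; _∷_)
import Data.List.Relation.Unary.All.Properties as All
open import Data.List.Relation.Unary.AllPairs as AllPairs using (AllPairs; []; _∷_)
open import Data.List.Relation.Unary.Any using (here; there)
open import Data.List.Relation.Unary.Unique.Propositional using (Unique)
import Data.List.Relation.Unary.AllPairs.Properties as AllPairs
import Data.List.Relation.Unary.Unique.Propositional.Properties as Unique
import Data.List.Relation.Unary.Unique.Setoid.Properties as Uniqueₛ
open import Data.List.Properties using (length-map; length-++; length-upTo)
open import Data.Nat using (ℕ; zero; suc; pred; _+_; _*_; _∸_; _≤_; _<_; _≤ᵇ_; _≡ᵇ_; z≤n; s≤s; s≤s⁻¹)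
open import Data.Nat.Properties
open import Data.Nat.Tactic.RingSolver using (solve-∀)
open import Data.Product using (Σ; ∃; ∃₂; _×_; _,_; proj₁; proj₂)
open import Data.Sum using (_⊎_; inj₁; inj₂; [_,_]′; map₁)
open import Data.Unit using (⊤; tt)
open import Data.Vec using (Vec; []; _∷_; lookup; tabulate)
import Data.Vec.Properties as Vec
open import Function using (_∘_; id; case_of_)
open import Function.Bundles using (_↔_; Inverse; mk↔ₛ′)
open import Relation.Binary.Construct.Closure.ReflexiveTransitive using (Star; ε; _◅_; _◅◅_)
import Relation.Binary.Construct.Closure.ReflexiveTransitive as Star
open import Relation.Binary.Definitions using (tri<; tri≈; tri>)
open import Relation.Binary.Bundles using (Setoid)
open import Relation.Binary.PropositionalEquality hiding ([_])
open import Relation.Nullary using (¬_; Dec; yes; no; does)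
open import Relation.Nullary.Decidable using (_×-dec_; _⊎-dec_; ¬?; decidable-stable)

-- For a general `G` only lower bounds are needed: lists of pairwise distinct connected subgraphs,
-- multiplied by gluing at a vertex. The single upper bound is that for the pendant vertex of `L`,
-- namely 2 + C(n, 2), obtained from a complete list. Every configuration other than a pendant
-- vertex at a cycle is shown to reach 3 + C(n, 2).
--
-- The poles coincide so that both ends of the omitted interval can be chosen independently: the low
-- positions hang from `r` by low neighbours, the high ones by high neighbours. The obstacle is the
-- existence of such an ordering. It is built from the front; the next vertex must touch what is
-- already placed, yet its removal must not disconnect the remaining vertices from `r`.
--
-- The margins are thin at n = 7. If `c` has position 3 in a part of six vertices that starts at
-- `v`, and the other part has one further vertex, the vertex sets alone give 16 + 7 = 23 = 2 + C(7,
-- 2), a tie. Hence the one extra subgraph that is drawn from an ordering with `3 ≤ a`.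

private variable
  n : ℕ
  A B C : Set

-- Boolean reflection and finite search

∧⁻ : ∀ {a b} → a ∧ b ≡ true → a ≡ true × b ≡ true
∧⁻ {a} {b} eq with a | b
... | true | true = refl , refl

∧⁺ : ∀ {a b} → a ≡ true → b ≡ true → a ∧ b ≡ true
∧⁺ refl refl = refl

∨⁻ : ∀ {a b} → a ∨ b ≡ true → a ≡ true ⊎ b ≡ true
∨⁻ {a} eq with a
... | true  = inj₁ refl
... | false = inj₂ eq

∨⁺ˡ : ∀ {a b} → a ≡ true → a ∨ b ≡ true
∨⁺ˡ refl = refl

∨⁺ʳ : ∀ {a b} → b ≡ true → a ∨ b ≡ true
∨⁺ʳ {a} refl = Bool.∨-zeroʳ a

⇔⇒≡ : ∀ {a b} → (a ≡ true → b ≡ true) → (b ≡ true → a ≡ true) → a ≡ b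
⇔⇒≡ {a} {b} to from with a | b
... | true  | b     = sym (to refl)
... | false | true  = from refl
... | false | false = refl

not⁺ : ∀ {a} → a ≡ false → not a ≡ true
not⁺ refl = refl

not⁻ : ∀ {a} → not a ≡ true → a ≡ false
not⁻ {false} _ = refl

true≢false : ∀ {a} → a ≡ true → a ≡ false → A
true≢false refl ()

bool : ∀ a → a ≡ true ⊎ a ≡ false
bool true  = inj₁ refl
bool false = inj₂ refl

¬true⇒false : ∀ {a} → ¬ (a ≡ true) → a ≡ false
¬true⇒false = Bool.¬-not

does⁺ : (d : Dec A) → A → does d ≡ true
does⁺ (yes _) _ = refl
does⁺ (no ¬a) a = ⊥-elim (¬a a)

does⁻ : (d : Dec A) → does d ≡ true → A
does⁻ (yes a) _ = a

module _ {i j : Fin n} where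
  ==F⇒≡ : (i ==F j) ≡ true → i ≡ j
  ==F⇒≡ eq = Fin.toℕ-injective (≡ᵇ⇒≡ (toℕ i) (toℕ j) (Bool.T-≡ .Function.Equivalence.from eq))

  ≡⇒==F : i ≡ j → (i ==F j) ≡ true
  ≡⇒==F eq = Bool.T-≡ .Function.Equivalence.to (≡⇒≡ᵇ (toℕ i) (toℕ j) (cong toℕ eq))

  ≢⇒==F : i ≢ j → (i ==F j) ≡ false
  ≢⇒==F i≢j = ¬true⇒false (i≢j ∘ ==F⇒≡)

  ==F⇒≢ : (i ==F j) ≡ false → i ≢ j
  ==F⇒≢ eq i≡j = true≢false (≡⇒==F i≡j) eq

module _ {p : A → Bool} where
  all⁺ : ∀ xs → (∀ {x} → x ∈ xs → p x ≡ true) → all p xs ≡ true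
  all⁺ []       h = refl
  all⁺ (x ∷ xs) h = ∧⁺ (h (here refl)) (all⁺ xs (h ∘ there))

  all⁻ : ∀ xs → all p xs ≡ true → ∀ {x} → x ∈ xs → p x ≡ true
  all⁻ (_ ∷ _) eq (here refl) = proj₁ (∧⁻ eq)
  all⁻ (_ ∷ xs) eq (there x∈)  = all⁻ xs (proj₂ (∧⁻ eq)) x∈

  any⁺ : ∀ {xs x} → x ∈ xs → p x ≡ true → any p xs ≡ true
  any⁺ (here refl) px = ∨⁺ˡ px
  any⁺ (there x∈)  px = ∨⁺ʳ (any⁺ x∈ px)

  any⁻ : ∀ xs → any p xs ≡ true → ∃ λ x → p x ≡ true
  any⁻ (x ∷ xs) eq with ∨⁻ {p x} eq
  ... | inj₁ px = x , px
  ... | inj₂ eq′ = any⁻ xs eq′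

module _ {p : Fin n → Bool} where
  allF⁺ : (∀ i → p i ≡ true) → allF n p ≡ true
  allF⁺ h = all⁺ (allFin n) (λ {x} _ → h x)

  allF⁻ : allF n p ≡ true → ∀ i → p i ≡ true
  allF⁻ eq i = all⁻ (allFin n) eq (Mem.∈-allFin i)

  anyF⁺ : ∀ i → p i ≡ true → anyF n p ≡ true
  anyF⁺ i = any⁺ (Mem.∈-allFin i)

  anyF⁻ : anyF n p ≡ true → ∃ λ i → p i ≡ true
  anyF⁻ = any⁻ (allFin n)

  search : (∃ λ i → p i ≡ true) ⊎ (∀ i → p i ≡ false)
  search with Fin.any? (λ i → p i Bool.≟ true)
  ... | yes (i , pi) = inj₁ (i , pi)
  ... | no none      = inj₂ λ i → ¬true⇒false (λ pi → none (i , pi))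

-- Counting the candidates

Unique-length : {xs ys : List A} → Unique xs → (∀ {x} → x ∈ xs → x ∈ ys) → length xs ≤ length ys
Unique-length {xs = []}          _         _  = z≤n
Unique-length {xs = x ∷ xs} {ys} (x∉ ∷ u) ⊆ys with Mem.∈-∃++ (⊆ys (here refl))
... | l , r , refl = begin
  suc (length xs)        ≤⟨ s≤s (Unique-length u ⊆rest) ⟩
  suc (length (l ++ r))  ≡⟨ cong suc (length-++ l) ⟩
  suc (length l + length r) ≡⟨ +-suc (length l) (length r) ⟨
  length l + suc (length r) ≡⟨ length-++ l ⟨
  length (l ++ x ∷ r) ∎
  where
  open ≤-Reasoning
  ⊆rest : ∀ {y} → y ∈ xs → y ∈ l ++ r
  ⊆rest y∈ with Mem.∈-++⁻ l (⊆ys (there y∈))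
  ... | inj₁ y∈l          = Mem.∈-++⁺ˡ y∈l
  ... | inj₂ (here refl)  = ⊥-elim (All.lookup x∉ y∈ refl)
  ... | inj₂ (there y∈r)  = Mem.∈-++⁺ʳ l y∈r

module _ (p : A → Bool) where
  private
    P? = λ x → p x Bool.≟ true

  countB≡length-filter : ∀ xs → countB p xs ≡ length (filter P? xs)
  countB≡length-filter [] = refl
  countB≡length-filter (x ∷ xs) with p x
  ... | true  = cong suc (countB≡length-filter xs)
  ... | false = countB≡length-filter xs

  length≤countB : ∀ {xs ys} → Unique ys → (∀ {y} → y ∈ ys → p y ≡ true × y ∈ xs) →
                  length ys ≤ countB p xs
  length≤countB {xs} u h rewrite countB≡length-filter xs =
    Unique-length u (λ y∈ → Mem.∈-filter⁺ P? (proj₂ (h y∈)) (proj₁ (h y∈)))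

  countB≤length : ∀ {xs ys} → Unique xs → (∀ {x} → p x ≡ true → x ∈ ys) → countB p xs ≤ length ys
  countB≤length {xs} u h rewrite countB≡length-filter xs =
    Unique-length (Unique.filter⁺ P? u) (λ x∈ → h (proj₂ (Mem.∈-filter⁻ P? {xs = xs} x∈)))

concatMap-map : (f : A → B → C) (xs : List A) (ys : List B) →
  concatMap (λ x → map (f x) ys) xs ≡ cartesianProductWith f xs ys
concatMap-map f []       ys = refl
concatMap-map f (x ∷ xs) ys = cong (map (f x) ys ++_) (concatMap-map f xs ys)

module _ {xs : List A} where
  allVecsOver≡ : ∀ m → allVecsOver xs (suc m) ≡ cartesianProductWith (λ v x → x ∷ v) (allVecsOver xs m) xs
  allVecsOver≡ m = concatMap-map (λ v x → x ∷ v) (allVecsOver xs m) xs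

  allVecsOver-complete : (∀ x → x ∈ xs) → ∀ {m} (v : Vec A m) → v ∈ allVecsOver xs m
  allVecsOver-complete h []      = here refl
  allVecsOver-complete h {suc m} (x ∷ v) rewrite allVecsOver≡ m =
    Mem.∈-cartesianProductWith⁺ (λ v x → x ∷ v) (allVecsOver-complete h v) (h x)

  allVecsOver-unique : Unique xs → ∀ m → Unique (allVecsOver xs m)
  allVecsOver-unique u zero = [] ∷ []
  allVecsOver-unique u (suc m) rewrite allVecsOver≡ m =
    Unique.cartesianProductWith⁺ (λ v x → x ∷ v) (λ where refl → refl , refl) (allVecsOver-unique u m) u

allBools-complete : ∀ b → b ∈ allBools
allBools-complete true  = here refl
allBools-complete false = there (here refl)

allBools-unique : Unique allBools
allBools-unique = ((λ ()) ∷ []) ∷ [] ∷ []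

module _ (n : ℕ) where
  private
    rows = allVecsOver allBools n
    candidates≡ : candidates n ≡ cartesianProductWith _,_ rows (allVecsOver rows n)
    candidates≡ = concatMap-map _,_ rows (allVecsOver rows n)

  candidates-complete : ∀ c → c ∈ candidates n
  candidates-complete (S , M) rewrite candidates≡ = Mem.∈-cartesianProductWith⁺ _,_
    (allVecsOver-complete allBools-complete S)
    (allVecsOver-complete (allVecsOver-complete allBools-complete) M)

  candidates-unique : Unique (candidates n)
  candidates-unique rewrite candidates≡ = Unique.cartesianProductWith⁺ _,_ (λ where refl → refl , refl)
    (allVecsOver-unique allBools-unique n)
    (allVecsOver-unique (allVecsOver-unique allBools-unique n) n)

length-cartesianProductWith : ∀ {a b c} {A : Set a} {B : Set b} {C : Set c} (f : A → B → C) xs ys →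
  length (cartesianProductWith f xs ys) ≡ length xs * length ys
length-cartesianProductWith f []       ys = refl
length-cartesianProductWith f (x ∷ xs) ys = trans (length-++ (map (f x) ys))
  (cong₂ _+_ (length-map (f x) ys) (length-cartesianProductWith f xs ys))

==F-refl : (i : Fin n) → (i ==F i) ≡ true
==F-refl i = ≡⇒==F {i = i} refl

-- Cardinalities of vertex sets

VS : ℕ → Set
VS n = Fin n → Bool

bit : Bool → ℕ
bit true  = 1
bit false = 0

size : VS n → ℕ
size {zero}  S = 0
size {suc n} S = bit (S zero) + size (S ∘ suc)

size-⊎ : (S S₁ S₂ : VS n) → (∀ i → S i ≡ S₁ i ∨ S₂ i) → (∀ i → S₁ i ≡ true → S₂ i ≡ false) →
         size S ≡ size S₁ + size S₂
size-⊎ {zero} _ _ _ _ _ = refl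
size-⊎ {suc n} S S₁ S₂ h d with S zero | S₁ zero | S₂ zero | h zero | d zero
... | true  | true  | true  | _ | d₀ = case d₀ refl of λ ()
... | true  | true  | false | _ | _ = cong suc (size-⊎ (S ∘ suc) (S₁ ∘ suc) (S₂ ∘ suc) (h ∘ suc) (d ∘ suc))
... | true  | false | true  | _ | _ = trans (cong suc (size-⊎ (S ∘ suc) (S₁ ∘ suc) (S₂ ∘ suc) (h ∘ suc) (d ∘ suc))) (sym (+-suc _ _))
... | false | false | false | _ | _ = size-⊎ (S ∘ suc) (S₁ ∘ suc) (S₂ ∘ suc) (h ∘ suc) (d ∘ suc)

size-∅ : (S : VS n) → (∀ i → S i ≡ false) → size S ≡ 0
size-∅ {zero}  S h = refl
size-∅ {suc n} S h rewrite h zero = size-∅ (S ∘ suc) (h ∘ suc)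

size-full : (S : VS n) → (∀ i → S i ≡ true) → size S ≡ n
size-full {zero}  S h = refl
size-full {suc n} S h rewrite h zero = cong suc (size-full (S ∘ suc) (h ∘ suc))

size-singleton : (c : Fin n) → size (_==F c) ≡ 1
size-singleton {suc n} zero = cong suc (size-∅ {n} (λ _ → false) (λ _ → refl))
size-singleton (suc c) = size-singleton c

module _ (S S′ : VS n) (S⊆S′ : ∀ i → S i ≡ true → S′ i ≡ true) where
  private
    S′∖S : VS n
    S′∖S i = S′ i ∧ not (S i)

    size-split : size S′ ≡ size S + size S′∖S
    size-split = size-⊎ S′ S S′∖S
      (λ i → ⇔⇒≡ (λ p → case bool (S i) of λ where
                     (inj₁ q) → ∨⁺ˡ q
                     (inj₂ q) → ∨⁺ʳ {S i} (∧⁺ p (not⁺ q)))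
                  (λ p → case ∨⁻ {S i} p of λ where
                     (inj₁ q) → S⊆S′ i q
                     (inj₂ q) → proj₁ (∧⁻ q)))
      (λ i p → ¬true⇒false (λ q → true≢false p (not⁻ (proj₂ (∧⁻ {S′ i} q)))))

  size-mono : size S ≤ size S′
  size-mono rewrite size-split = m≤m+n (size S) _

size-∈ : (S : VS n) (i : Fin n) → S i ≡ true → 1 ≤ size S
size-∈ S i p = ≤-trans (≤-reflexive (sym (size-singleton i)))
  (size-mono (_==F i) S (λ j q → subst (λ k → S k ≡ true) (sym (==F⇒≡ q)) p))

size-mono-< : (S S′ : VS n) → (∀ i → S i ≡ true → S′ i ≡ true) → ∀ i → S i ≡ false → S′ i ≡ true → size S < size S′
size-mono-< S S′ S⊆S′ i p q = begin
  suc (size S)             ≡⟨ cong (_+ size S) (size-singleton i) ⟨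
  size (_==F i) + size S   ≡⟨ size-⊎ S+i (_==F i) S (λ _ → refl) (λ j r → subst (λ k → S k ≡ false) (sym (==F⇒≡ r)) p) ⟨
  size S+i                 ≤⟨ size-mono S+i S′ (λ j r → case ∨⁻ {j ==F i} r of λ where
                                 (inj₁ s) → subst (λ k → S′ k ≡ true) (sym (==F⇒≡ s)) q
                                 (inj₂ s) → S⊆S′ j s) ⟩
  size S′                  ∎
  where
  open ≤-Reasoning
  S+i : VS _
  S+i j = (j ==F i) ∨ S j

size≤n : (S : VS n) → size S ≤ n
size≤n S = ≤-trans (size-mono S (λ _ → true) (λ _ _ → refl)) (≤-reflexive (size-full (λ _ → true) (λ _ → refl)))

Adj : Graph n → Fin n → Fin n → Set
Adj H i j = H i j ≡ true

-- Reachability and connectivity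

module _ {n} (H : Graph n) (s : Fin n) where
  Closed : VS n → Set
  Closed T = ∀ i j → T i ≡ true → H i j ≡ true → T j ≡ true

  private
    R = reach H s

    R-step : ∀ k i j → R k i ≡ true → H i j ≡ true → R (suc k) j ≡ true
    R-step k i j p q = ∨⁺ʳ {R k j} (anyF⁺ i (∧⁺ p q))

    R-closed : ∀ k → Closed (R k) → ∀ i → R (suc k) i ≡ true → R k i ≡ true
    R-closed k cl i p with ∨⁻ {R k i} p
    ... | inj₁ q = q
    ... | inj₂ q with anyF⁻ q
    ... | j , r = cl j i (proj₁ (∧⁻ r)) (proj₂ (∧⁻ {R k j} r))

    -- A round that does not close the reached set adds a vertex to it. A set still open after n
    -- rounds would have more than n vertices.
    grow : ∀ k → Closed (R k) ⊎ k < size (R k)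
    grow zero = inj₂ (size-∈ (R 0) s (==F-refl s))
    grow (suc k) with grow k
    ... | inj₁ cl = inj₁ λ i j p q → ∨⁺ˡ (cl i j (R-closed k cl i p) q)
    ... | inj₂ k< with search {p = λ i → R (suc k) i ∧ not (R k i)}
    ... | inj₁ (i , p) = inj₂ (≤-trans (s≤s k<) (size-mono-< (R k) (R (suc k)) (λ j q → ∨⁺ˡ q) i
                                (not⁻ (proj₂ (∧⁻ {R (suc k) i} p))) (proj₁ (∧⁻ p))))
    ... | inj₂ none = inj₁ λ i j p q → ∨⁺ˡ (back j (R-step k i j (back i p) q))
      where
      back : ∀ i → R (suc k) i ≡ true → R k i ≡ true
      back i p with bool (R k i)
      ... | inj₁ q = q
      ... | inj₂ q = true≢false (∧⁺ p (not⁺ q)) (none i)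

    R-mono : ∀ k → R k s ≡ true
    R-mono zero    = ==F-refl s
    R-mono (suc k) = ∨⁺ˡ (R-mono k)

  reach-closed : Closed (reach H s n)
  reach-closed with grow n
  ... | inj₁ cl = cl
  ... | inj₂ n< = ⊥-elim (<-irrefl refl (≤-trans n< (size≤n (R n))))

  Star⇒reach : ∀ {i} → Star (Adj H) s i → reach H s n i ≡ true
  Star⇒reach = go (R-mono n)
    where
    go : ∀ {i j} → reach H s n i ≡ true → Star (Adj H) i j → reach H s n j ≡ true
    go p ε       = p
    go p (e ◅ w) = go (reach-closed _ _ p e) w

  reach⇒Star : ∀ {i} → reach H s n i ≡ true → Star (Adj H) s i
  reach⇒Star = go n
    where
    go : ∀ k {i} → R k i ≡ true → Star (Adj H) s i
    go zero p rewrite ==F⇒≡ {i = s} p = ε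
    go (suc k) {i} p with ∨⁻ {R k i} p
    ... | inj₁ q = go k q
    ... | inj₂ q with anyF⁻ q
    ... | j , r = go k (proj₁ (∧⁻ r)) ◅◅ (proj₂ (∧⁻ {R k j} r) ◅ ε)

module _ {S : VS n} {H : Graph n} where
  connectedB⁻ : connectedB S H ≡ true → ∀ {s i} → S s ≡ true → S i ≡ true → Star (Adj H) s i
  connectedB⁻ c {s} {i} p q with ∨⁻ {not (S s)} (allF⁻ c s)
  ... | inj₁ ¬p = true≢false p (not⁻ ¬p)
  ... | inj₂ c′ with ∨⁻ {not (S i)} (allF⁻ c′ i)
  ... | inj₁ ¬q = true≢false q (not⁻ ¬q)
  ... | inj₂ r  = reach⇒Star H s r

  connectedB⁺ : (∀ {s i} → S s ≡ true → S i ≡ true → Star (Adj H) s i) → connectedB S H ≡ true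
  connectedB⁺ w = allF⁺ λ s → lift (S s) λ p → allF⁺ λ i → lift (S i) λ q → Star⇒reach H s (w p q)
    where
    lift : ∀ a {b} → (a ≡ true → b ≡ true) → not a ∨ b ≡ true
    lift true  h = h refl
    lift false h = refl

  connectedB-rooted : (∀ {i j} → Adj H i j → Adj H j i) → ∀ r → (∀ i → S i ≡ true → Star (Adj H) r i) →
                      connectedB S H ≡ true
  connectedB-rooted s r w = connectedB⁺ λ {i} {j} p q → Star.reverse s (w i p) ◅◅ w j q

-- Vertex deletion and connectivity of induced subgraphs

infixl 25 _∖_
_∖_ : VS n → Fin n → VS n
(S ∖ b) i = S i ∧ not (i ==F b)

∖⁻ : ∀ {S : VS n} {b i} → (S ∖ b) i ≡ true → S i ≡ true × i ≢ b
∖⁻ {S = S} {i = i} p = proj₁ (∧⁻ p) , ==F⇒≢ (not⁻ (proj₂ (∧⁻ {S i} p)))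

∖⁺ : ∀ {S : VS n} {b i} → S i ≡ true → i ≢ b → (S ∖ b) i ≡ true
∖⁺ p q = ∧⁺ p (not⁺ (≢⇒==F q))

size-∖ : (S : VS n) (b : Fin n) → S b ≡ true → size S ≡ suc (size (S ∖ b))
size-∖ S b p = trans
  (size-⊎ S (_==F b) (S ∖ b)
    (λ i → ⇔⇒≡ (λ q → case bool (i ==F b) of λ where
                    (inj₁ e) → ∨⁺ˡ e
                    (inj₂ e) → ∨⁺ʳ {i ==F b} (∧⁺ q (not⁺ e)))
                (λ q → case ∨⁻ {i ==F b} q of λ where
                    (inj₁ e) → subst (λ k → S k ≡ true) (sym (==F⇒≡ e)) p
                    (inj₂ e) → proj₁ (∧⁻ e)))
    (λ i e → ¬true⇒false (λ q → proj₂ (∖⁻ {S = S} q) (==F⇒≡ e))))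
  (cong (_+ size (S ∖ b)) (size-singleton b))

induced : Graph n → VS n → Graph n
induced G S i j = G i j ∧ S i ∧ S j

induced⁻ : (G : Graph n) (S : VS n) → ∀ {i j} → induced G S i j ≡ true → G i j ≡ true × S i ≡ true × S j ≡ true
induced⁻ G S {i} {j} e = proj₁ (∧⁻ e) , ∧⁻ (proj₂ (∧⁻ {G i j} e))

Star-preserves : {A : Set} {R : A → A → Set} (P : A → Set) → (∀ {i j} → P i → R i j → P j) →
                 ∀ {i j} → P i → Star R i j → P j
Star-preserves P step p ε       = p
Star-preserves P step p (e ◅ w) = Star-preserves P step (step p e) w

module Connectivity {n : ℕ} (G : Graph n) (G-sym : ∀ i j → G i j ≡ G j i) where

  flip-edge : ∀ {i j} → G i j ≡ true → G j i ≡ true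
  flip-edge {i} {j} e = trans (G-sym j i) e

  Leaves : VS n → VS n → Set
  Leaves S T = ∃₂ λ x y → T x ≡ true × S y ≡ true × T y ≡ false × G x y ≡ true

  Isolated : VS n → VS n → Set
  Isolated S T = ∀ x y → T x ≡ true → S y ≡ true → G x y ≡ true → T y ≡ true

  Leaves? : ∀ S T → Leaves S T ⊎ Isolated S T
  Leaves? S T with Fin.any? (λ x → Fin.any? λ y → (T x Bool.≟ true) ×-dec (S y Bool.≟ true) ×-dec
                                     (T y Bool.≟ false) ×-dec (G x y Bool.≟ true))
  ... | yes l = inj₁ l
  ... | no ¬l = inj₂ λ x y Tx Sy e → case bool (T y) of λ where
    (inj₁ Ty) → Ty
    (inj₂ ¬Ty) → ⊥-elim (¬l (x , y , Tx , Sy , ¬Ty , e))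

  -- Connectivity of the induced subgraph on S, tested on the vertex sets avoiding a root r ∈ S.
  Connected : VS n → Fin n → Set
  Connected S r = ∀ T {t} → T t ≡ true → (∀ {x} → T x ≡ true → S x ≡ true) → T r ≡ false → Leaves S T

  -- A leaving edge is found by finite search, so it is enough to refute a `T` that no edge leaves.
  Connected⁺ : ∀ {S r} → (∀ T {t} → T t ≡ true → (∀ {x} → T x ≡ true → S x ≡ true) → T r ≡ false → Isolated S T → ⊥) →
               Connected S r
  Connected⁺ {S} h T Tt T⊆S ¬Tr with Leaves? S T
  ... | inj₁ l = l
  ... | inj₂ i = ⊥-elim (h T Tt T⊆S ¬Tr i)

  NoCutBut : VS n → Fin n → Set
  NoCutBut S r = ∀ {b} → S b ≡ true → b ≢ r → Connected (S ∖ b) r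

  Star⇒Connected : ∀ {S r} → (∀ {i} → S i ≡ true → Star (Adj (induced G S)) r i) → Connected S r
  Star⇒Connected {S} {r} w = Connected⁺ λ T Tt T⊆S ¬Tr iso →
    true≢false Tt (Star-preserves (λ i → T i ≡ false)
      (λ {i} {j} ¬Ti e → ¬true⇒false λ Tj →
        true≢false (iso j i Tj (proj₁ (proj₂ (induced⁻ G S e))) (flip-edge (proj₁ (induced⁻ G S e)))) ¬Ti)
      ¬Tr (w (T⊆S Tt)))

  component : VS n → Fin n → VS n
  component S r i = S i ∧ reach (induced G S) r n i

  module _ {S : VS n} {r : Fin n} where
    component⊆ : ∀ {i} → component S r i ≡ true → S i ≡ true
    component⊆ = proj₁ ∘ ∧⁻

    component-root : S r ≡ true → component S r r ≡ true
    component-root Sr = ∧⁺ Sr (Star⇒reach (induced G S) r ε)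

    component-closed : ∀ {i j} → component S r i ≡ true → S j ≡ true → G i j ≡ true → component S r j ≡ true
    component-closed {i} {j} p Sj e =
      ∧⁺ Sj (reach-closed (induced G S) r i j (proj₂ (∧⁻ {S i} p)) (∧⁺ e (∧⁺ (component⊆ p) Sj)))

    component-Star : ∀ {i} → component S r i ≡ true → Star (Adj (induced G S)) r i
    component-Star {i} p = reach⇒Star (induced G S) r (proj₂ (∧⁻ {S i} p))

    component-connected : Connected (component S r) r
    component-connected = Connected⁺ λ T {t} Tt T⊆ ¬Tr iso →
      case bool (S r) of λ where
        (inj₁ Sr) → true≢false Tt (proj₂ (Star-preserves (λ i → component S r i ≡ true × T i ≡ false)
          (λ {i} {j} (Ci , ¬Ti) e →
            let Gij , Si , Sj = induced⁻ G S e
            in component-closed Ci Sj Gij , ¬true⇒false λ Tj → true≢false (iso j i Tj Ci (flip-edge Gij)) ¬Ti)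
          (component-root Sr , ¬Tr) (component-Star (T⊆ Tt))))
        (inj₂ ¬Sr) → case component-Star (T⊆ Tt) of λ where
          ε → true≢false Tt ¬Tr
          (e ◅ _) → true≢false (proj₁ (proj₂ (induced⁻ G S e))) ¬Sr

  Disconnection : VS n → Fin n → Set
  Disconnection S r = Σ (VS n) λ D → (∃ λ d → D d ≡ true) × (∀ {x} → D x ≡ true → S x ≡ true) ×
                      D r ≡ false × Isolated S D

  -- The witness of disconnection is the part of `S` outside the component of `r`; an edge between
  -- the two would enlarge the component.
  Connected? : ∀ S r → S r ≡ true → Connected S r ⊎ Disconnection S r
  Connected? S r Sr with search {p = λ i → S i ∧ not (component S r i)}
  ... | inj₁ (d , p) = inj₂ (_ , (d , p) , (λ q → proj₁ (∧⁻ q)) ,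
          ¬true⇒false (λ q → true≢false (component-root {S} Sr) (not⁻ (proj₂ (∧⁻ {S r} q)))) ,
          λ x y Dx Sy e → ∧⁺ Sy (not⁺ (¬true⇒false λ Cy → true≢false
            (component-closed {S} {r} Cy (proj₁ (∧⁻ Dx)) (flip-edge e)) (not⁻ (proj₂ (∧⁻ {S x} Dx))))))
  ... | inj₂ none = inj₁ (Star⇒Connected λ {i} Si → case bool (component S r i) of λ where
          (inj₁ Ci) → component-Star {S} Ci
          (inj₂ ¬Ci) → true≢false (∧⁺ Si (not⁺ ¬Ci)) (none i))

  -- If `T` contains `r`, its complement in `S` avoids `r` and contains `r′`. An edge that leaves
  -- the complement, read backwards, leaves `T`.
  change-root : ∀ {S r r′} → S r′ ≡ true → Connected S r → Connected S r′
  change-root {S} {r} {r′} Sr′ conn T Tt T⊆S ¬Tr′ with bool (T r)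
  ... | inj₂ ¬Tr = conn T Tt T⊆S ¬Tr
  ... | inj₁ Tr with conn (λ i → S i ∧ not (T i)) (∧⁺ Sr′ (not⁺ ¬Tr′)) (proj₁ ∘ ∧⁻)
                     (¬true⇒false λ p → true≢false Tr (not⁻ (proj₂ (∧⁻ {S r} p))))
  ... | x , y , p , Sy , q , e = y , x ,
        (case bool (T y) of λ where
          (inj₁ Ty) → Ty
          (inj₂ ¬Ty) → true≢false (∧⁺ Sy (not⁺ ¬Ty)) q) ,
        proj₁ (∧⁻ p) , not⁻ (proj₂ (∧⁻ {S x} p)) , flip-edge e

  -- `S` meets the rest of `S′` only at `r`, and `T` avoids `r`; so the edge that leaves `T` in `S′`
  -- still ends in `S`.
  restrict : ∀ {S S′ r} → (∀ {x} → S x ≡ true → S′ x ≡ true) →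
             (∀ {x y} → S x ≡ true → x ≢ r → S′ y ≡ true → G x y ≡ true → S y ≡ true) →
             Connected S′ r → Connected S r
  restrict S⊆S′ attach conn T Tt T⊆S ¬Tr with conn T Tt (S⊆S′ ∘ T⊆S) ¬Tr
  ... | x , y , Tx , S′y , ¬Ty , e =
    x , y , Tx , attach (T⊆S Tx) (λ { refl → true≢false Tx ¬Tr }) S′y e , ¬Ty , e

  -- The low neighbours may also lie in A, the set of vertices placed before those of R.
  record Ordering (A R : VS n) (r : Fin n) (a : ℕ) : Set where
    field
      pos   : Fin n → ℕ
      vtx   : ℕ → Fin n
      pos-r : pos r ≡ 0
      pos≤  : ∀ {w} → R w ≡ true → pos w ≤ a
      vtx∈  : ∀ {k} → k ≤ a → R (vtx k) ≡ true
      vtx-pos : ∀ {w} → R w ≡ true → vtx (pos w) ≡ w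
      pos-vtx : ∀ {k} → k ≤ a → pos (vtx k) ≡ k
      low   : ∀ {w k} → R w ≡ true → pos w ≡ suc k →
              ∃ λ u → G u w ≡ true × (A u ≡ true ⊎ R u ≡ true × pos u ≤ k)
      high  : ∀ {w k} → R w ≡ true → pos w ≡ suc k →
              ∃ λ u → G u w ≡ true × R u ≡ true × (pos u ≡ 0 ⊎ suc k < pos u)

  -- Existence of orderings

  module _ {A R : VS n} {r u : Fin n} {a : ℕ} (Rr : R r ≡ true) (conn : Connected R r)
           (Ru : R u ≡ true) (u≢r : u ≢ r) (neighbour : ∃ λ x → G x u ≡ true × (A x ≡ true ⊎ x ≡ r))
           (rest : Ordering (λ z → A z ∨ (z ==F u)) (R ∖ u) r a) where
    private
      x = proj₁ neighbour
      R′ = R ∖ u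
      R′⊆R : ∀ {z} → R′ z ≡ true → R z ≡ true
      R′⊆R p = proj₁ (∖⁻ {S = R} p)
      open Ordering rest
      up : ℕ → ℕ
      up zero    = 0
      up (suc k) = suc (suc k)
      up≤ : ∀ {k} → k ≤ a → up k ≤ suc a
      up≤ {zero}  _ = z≤n
      up≤ {suc k} p = s≤s p
      up≤suc : ∀ {k m} → k ≤ m → up k ≤ suc m
      up≤suc {zero}  _ = z≤n
      up≤suc {suc k} p = s≤s p
      pos′ : Fin n → ℕ
      pos′ w with w Fin.≟ u
      ... | yes _ = 1
      ... | no _  = up (pos w)
      vtx′ : ℕ → Fin n
      vtx′ 0 = r
      vtx′ 1 = u
      vtx′ (suc (suc k)) = vtx (suc k)
      pos′-u : pos′ u ≡ 1
      pos′-u with u Fin.≟ u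
      ... | yes _ = refl
      ... | no ¬p = ⊥-elim (¬p refl)
      pos′-≢ : ∀ {w} → w ≢ u → pos′ w ≡ up (pos w)
      pos′-≢ {w} w≢u with w Fin.≟ u
      ... | yes p = ⊥-elim (w≢u p)
      ... | no _  = refl
      pos′-R′ : ∀ {w} → R′ w ≡ true → pos′ w ≡ up (pos w)
      pos′-R′ p = pos′-≢ (proj₂ (∖⁻ {S = R} p))
      pos′-r : pos′ r ≡ 0
      pos′-r = trans (pos′-≢ (u≢r ∘ sym)) (cong up pos-r)
      pos≤′ : ∀ {w} → R w ≡ true → pos′ w ≤ suc a
      pos≤′ {w} Rw with w Fin.≟ u
      ... | yes _  = s≤s z≤n
      ... | no w≢u = up≤ (pos≤ (∖⁺ {S = R} Rw w≢u))
      vtx∈′ : ∀ {k} → k ≤ suc a → R (vtx′ k) ≡ true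
      vtx∈′ {0} _ = Rr
      vtx∈′ {1} _ = Ru
      vtx∈′ {suc (suc k)} (s≤s p) = R′⊆R (vtx∈ p)
      vtx0 : vtx 0 ≡ r
      vtx0 = trans (cong vtx (sym pos-r)) (vtx-pos (∖⁺ {S = R} Rr (u≢r ∘ sym)))
      vtx′-up : ∀ k → vtx′ (up k) ≡ vtx k
      vtx′-up zero    = sym vtx0
      vtx′-up (suc k) = refl
      vtx-pos′ : ∀ {w} → R w ≡ true → vtx′ (pos′ w) ≡ w
      vtx-pos′ {w} Rw with w Fin.≟ u
      ... | yes refl = refl
      ... | no w≢u = trans (vtx′-up (pos w)) (vtx-pos (∖⁺ {S = R} Rw w≢u))
      pos-vtx′ : ∀ {k} → k ≤ suc a → pos′ (vtx′ k) ≡ k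
      pos-vtx′ {0} _ = pos′-r
      pos-vtx′ {1} _ = pos′-u
      pos-vtx′ {suc (suc k)} (s≤s p) = trans (pos′-R′ (vtx∈ p)) (cong up (pos-vtx p))
      low′ : ∀ {w k} → R w ≡ true → pos′ w ≡ suc k →
             ∃ λ v → G v w ≡ true × (A v ≡ true ⊎ R v ≡ true × pos′ v ≤ k)
      low′ {w} {k} Rw eq with w Fin.≟ u
      low′ {w} {k} Rw eq | yes refl = x , proj₁ (proj₂ neighbour) , (case proj₂ (proj₂ neighbour) of λ where
        (inj₁ Ax′) → inj₁ Ax′
        (inj₂ refl) → inj₂ (Rr , ≤-trans (≤-reflexive pos′-r) z≤n))
      low′ {w} {k} Rw eq | no w≢u with pos w in eqw
      low′ {w} {.(suc j)} Rw refl | no w≢u | suc j with low (∖⁺ {S = R} Rw w≢u) eqw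
      ... | v , e′ , inj₂ (R′v , v≤) =
        v , e′ , inj₂ (R′⊆R R′v , ≤-trans (≤-reflexive (pos′-R′ R′v)) (up≤suc v≤))
      ... | v , e′ , inj₁ A′v with ∨⁻ {A v} A′v
      ... | inj₁ Av = v , e′ , inj₁ Av
      ... | inj₂ v≡u with ==F⇒≡ {i = v} {u} v≡u
      ... | refl = v , e′ , inj₂ (Ru , ≤-trans (≤-reflexive pos′-u) (s≤s z≤n))
      high′ : ∀ {w k} → R w ≡ true → pos′ w ≡ suc k →
              ∃ λ v → G v w ≡ true × R v ≡ true × (pos′ v ≡ 0 ⊎ suc k < pos′ v)
      high′ {w} {k} Rw eq with w Fin.≟ u
      -- `R` is connected, so the set consisting of `u` alone has a leaving edge. Its end is `r` or
      -- is placed after `u`.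
      high′ {w} {k} Rw refl | yes refl with conn (_==F w) {w} (==F-refl w)
                 (λ p → subst (λ z → R z ≡ true) (sym (==F⇒≡ p)) Rw) (≢⇒==F (u≢r ∘ sym))
      ... | y , v , p , Rv , q , e′ with ==F⇒≡ {i = y} {w} p
      ... | refl = v , flip-edge e′ , Rv , position (trans (pos′-≢ (==F⇒≢ q)) refl)
        where
        position : pos′ v ≡ up (pos v) → pos′ v ≡ 0 ⊎ 1 < pos′ v
        position eq with pos v
        ... | zero  = inj₁ eq
        ... | suc j = inj₂ (subst (1 <_) (sym eq) (s≤s (s≤s z≤n)))
      high′ {w} {k} Rw eq | no w≢u with pos w in eqw
      high′ {w} {.(suc j)} Rw refl | no w≢u | suc j with high (∖⁺ {S = R} Rw w≢u) eqw
      ... | v , e′ , R′v , inj₁ v≡0 = v , e′ , R′⊆R R′v , inj₁ (trans (pos′-R′ R′v) (cong up v≡0))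
      ... | v , e′ , R′v , inj₂ j<v = v , e′ , R′⊆R R′v ,
              inj₂ (subst (suc (suc j) <_) (sym (pos′-R′ R′v)) (up-< j<v))
        where
        up-< : ∀ {k} → suc j < k → suc (suc j) < up k
        up-< {suc k} p = s≤s p

    -- `r` keeps position 0 and `u` takes position 1, so all other positions rise by one. In `rest`
    -- the vertex `u` belongs to the set placed before; here such a low neighbour becomes one at
    -- position 1.
    prepend : Ordering A R r (suc a)
    prepend = record
      { pos = pos′ ; vtx = vtx′ ; pos-r = pos′-r ; pos≤ = pos≤′ ; vtx∈ = vtx∈′ ; vtx-pos = vtx-pos′
      ; pos-vtx = pos-vtx′ ; low = low′ ; high = high′ }

  module Greedy (W : VS n) (r : Fin n) (noCut : NoCutBut W r) where

    module Pick (A R : VS n) (A∪R : ∀ {x} → W x ≡ true → A x ≡ true ⊎ R x ≡ true)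
                (R⊆W : ∀ {x} → R x ≡ true → W x ≡ true)
                (Rr : R r ≡ true) (conn : Connected R r) where

      Removable : Set
      Removable = ∃ λ u → R u ≡ true × u ≢ r × (∃ λ x → G x u ≡ true × (A x ≡ true ⊎ x ≡ r)) × Connected (R ∖ u) r

      -- C is a part of R attached to the rest of R only at b. A vertex of C with a neighbour outside
      -- C ∪ {b} is removable, unless it cuts off a smaller part of the same kind.
      pick : ∀ k b C → size C ≤ k → R b ≡ true → C b ≡ false → C r ≡ false → (∃ λ t → C t ≡ true) →
             (∀ {x} → C x ≡ true → R x ≡ true) →
             (∀ {x y} → C x ≡ true → R y ≡ true → G x y ≡ true → C y ≡ true ⊎ y ≡ b) → Removable
      pick zero b C C≤0 _ _ _ (t , Ct) _ _ = case ≤-trans (size-∈ C t Ct) C≤0 of λ ()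
      pick (suc k) b C C≤ Rb ¬Cb ¬Cr (t , Ct) C⊆R attach = try exit
        where
        -- For `b = r`, connectivity of `R` yields an edge from `C` to `r`. Otherwise `b` is no cut
        -- vertex of `W`, so an edge leaves `C` in `W` without `b`; it cannot end in `R`, to which
        -- `C` is attached only at `b`, hence it ends in `A`.
        exit : ∃₂ λ u x → C u ≡ true × G x u ≡ true × (A x ≡ true ⊎ x ≡ r)
        exit with b Fin.≟ r
        ... | yes refl with conn C Ct C⊆R ¬Cr
        ... | x , y , Cx , Ry , ¬Cy , e = case attach Cx Ry e of λ where
          (inj₁ Cy) → true≢false Cy ¬Cy
          (inj₂ y≡b) → x , y , Cx , flip-edge e , inj₂ y≡b
        exit | no b≢r with noCut (R⊆W Rb) b≢r C Ct
                             (λ Cx → ∖⁺ {S = W} (R⊆W (C⊆R Cx)) (λ { refl → true≢false Cx ¬Cb })) ¬Cr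
        ... | x , y , Cx , W∖b-y , ¬Cy , e = case A∪R (proj₁ (∖⁻ {S = W} W∖b-y)) of λ where
          (inj₁ Ay) → x , y , Cx , flip-edge e , inj₁ Ay
          (inj₂ Ry) → case attach Cx Ry e of λ where
            (inj₁ Cy) → true≢false Cy ¬Cy
            (inj₂ y≡b) → ⊥-elim (proj₂ (∖⁻ {S = W} W∖b-y) y≡b)

        try : (∃₂ λ u x → C u ≡ true × G x u ≡ true × (A x ≡ true ⊎ x ≡ r)) → Removable
        try (u , x , Cu , e , Ax) = answer (Connected? (R ∖ u) r (∖⁺ {S = R} Rr r≢u))
          where
          r≢u : r ≢ u
          r≢u refl = true≢false Cu ¬Cr

          answer : Connected (R ∖ u) r ⊎ Disconnection (R ∖ u) r → Removable
          answer (inj₁ conn′) = u , C⊆R Cu , r≢u ∘ sym , (x , e , Ax) , conn′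
          answer (inj₂ (D , (d , Dd) , D⊆ , ¬Dr , iso)) with bool (D b)
          -- This case is impossible: no edge leaves the union of `D` and `C` in `R`. From `D` an
          -- edge leads into `D` or to `u`, which is in `C`; from `C` it leads into `C` or to `b`,
          -- which is in `D`.
          ... | inj₁ Db with conn (λ z → D z ∨ C z) (∨⁺ˡ Db)
                  (λ {z} p → case ∨⁻ {D z} p of λ where
                     (inj₁ Dz) → proj₁ (∖⁻ {S = R} (D⊆ Dz))
                     (inj₂ Cz) → C⊆R Cz)
                  (subst₂ (λ p q → p ∨ q ≡ false) (sym ¬Dr) (sym ¬Cr) refl)
          ... | y , z , p , Rz , q , e′ = true≢false DCz q
            where
            DCz : D z ∨ C z ≡ true
            DCz with ∨⁻ {D y} p | z Fin.≟ u
            ... | _       | yes refl = ∨⁺ʳ {D z} Cu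
            ... | inj₁ Dy | no z≢u = ∨⁺ˡ (iso y z Dy (∖⁺ {S = R} Rz z≢u) e′)
            ... | inj₂ Cy | no _ with attach Cy Rz e′
            ... | inj₁ Cz   = ∨⁺ʳ {D z} Cz
            ... | inj₂ refl = ∨⁺ˡ Db
          answer (inj₂ (D , (d , Dd) , D⊆ , ¬Dr , iso)) | inj₂ ¬Db with search {p = λ z → D z ∧ C z}
          -- The intersection of `D` and `C` omits `u`, so it is smaller than `C`. Its only
          -- attachment is `u`, because an edge to `b` would put `b` into `D`.
          ... | inj₁ (t′ , DCt′) =
            pick k u (λ z → D z ∧ C z)
              (s≤s⁻¹ (≤-trans (size-mono-< (λ z → D z ∧ C z) C (λ z p → proj₂ (∧⁻ {D z} p)) u DCu Cu) C≤))
              (C⊆R Cu) DCu (¬true⇒false λ p → true≢false (proj₁ (∧⁻ p)) ¬Dr) (t′ , DCt′)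
              (λ {z} p → C⊆R (proj₂ (∧⁻ {D z} p)))
              attach′
            where
            DCu : D u ∧ C u ≡ false
            DCu = ¬true⇒false λ p → proj₂ (∖⁻ {S = R} (D⊆ (proj₁ (∧⁻ p)))) refl
            attach′ : ∀ {y z} → D y ∧ C y ≡ true → R z ≡ true → G y z ≡ true → D z ∧ C z ≡ true ⊎ z ≡ u
            attach′ {y} {z} p Rz e′ with z Fin.≟ u
            ... | yes z≡u = inj₂ z≡u
            ... | no z≢u with iso y z (proj₁ (∧⁻ p)) (∖⁺ {S = R} Rz z≢u) e′ | attach (proj₂ (∧⁻ {D y} p)) Rz e′
            ... | Dz | inj₁ Cz   = inj₁ (∧⁺ Dz Cz)
            ... | Dz | inj₂ refl = true≢false Dz ¬Db
          -- A `D` disjoint from `C` would have to be adjacent to `u`. But the neighbours of `u` in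
          -- `R` lie in `C` or equal `b`, and `b` is not in `D`.
          ... | inj₂ none with conn D Dd (λ Dz → proj₁ (∖⁻ {S = R} (D⊆ Dz))) ¬Dr
          ... | y , z , Dy , Rz , ¬Dz , e′ with z Fin.≟ u
          ... | no z≢u = true≢false (iso y z Dy (∖⁺ {S = R} Rz z≢u) e′) ¬Dz
          ... | yes refl with attach Cu (proj₁ (∖⁻ {S = R} (D⊆ Dy))) (flip-edge e′)
          ... | inj₁ Cy   = true≢false (∧⁺ Dy Cy) (none y)
          ... | inj₂ refl = true≢false Dy ¬Db

    order : ∀ a A R → (∀ {x} → W x ≡ true → A x ≡ true ⊎ R x ≡ true) → (∀ {x} → R x ≡ true → W x ≡ true) →
            R r ≡ true → Connected R r → size R ≡ suc a → Ordering A R r a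
    order zero A R A∪R R⊆W Rr conn size≡ = record
      { pos = λ _ → 0 ; vtx = λ _ → r ; pos-r = refl ; pos≤ = λ _ → z≤n ; vtx∈ = λ _ → Rr
      ; vtx-pos = λ {w} Rw → case w Fin.≟ r of λ where
          (yes w≡r) → sym w≡r
          (no w≢r) → case trans (sym (cong pred (trans (sym (size-∖ R r Rr)) size≡))) refl of λ eq →
            case ≤-trans (size-∈ (R ∖ r) w (∖⁺ {S = R} Rw w≢r)) (≤-reflexive (sym eq)) of λ ()
      ; pos-vtx = λ { z≤n → refl } ; low = λ _ () ; high = λ _ () }
    order (suc a) A R A∪R R⊆W Rr conn size≡ with search {p = R ∖ r}
    ... | inj₂ none = case trans (sym size≡) (trans (size-∖ R r Rr) (cong suc (size-∅ (R ∖ r) none))) of λ ()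
    -- The search starts with `b = r` and with all other vertices of `R` as `C`.
    ... | inj₁ (t , R∖r-t) with Pick.pick A R A∪R R⊆W Rr conn (size (R ∖ r)) r (R ∖ r) ≤-refl Rr
              (¬true⇒false λ p → proj₂ (∖⁻ {S = R} p) refl) (¬true⇒false λ p → proj₂ (∖⁻ {S = R} p) refl)
              (t , R∖r-t) (λ p → proj₁ (∖⁻ {S = R} p))
              (λ {x} {y} _ Ry _ → case y Fin.≟ r of λ where
                (yes y≡r) → inj₂ y≡r
                (no y≢r) → inj₁ (∖⁺ {S = R} Ry y≢r))
    ... | u , Ru , u≢r , neighbour , conn′ = prepend Rr conn Ru u≢r neighbour
      (order a (λ z → A z ∨ (z ==F u)) (R ∖ u)
        (λ {z} Wz → case A∪R Wz of λ where
          (inj₁ Az) → inj₁ (∨⁺ˡ Az)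
          (inj₂ Rz) → case z Fin.≟ u of λ where
            (yes z≡u) → inj₁ (∨⁺ʳ {A z} (≡⇒==F z≡u))
            (no z≢u) → inj₂ (∖⁺ {S = R} Rz z≢u))
        (λ p → R⊆W (proj₁ (∖⁻ {S = R} p))) (∖⁺ {S = R} Rr (u≢r ∘ sym)) conn′
        (cong pred (trans (sym (size-∖ R u Ru)) size≡)))

-- Connected subgraphs, their Boolean codes, and families of them

module _ {n : ℕ} (G : Graph n) (v : Fin n) (S : Vec Bool n) (M : Vec (Vec Bool n) n) where
  private
    H : Graph n
    H i j = lookup (lookup M i) j

    LocallyValid : Set
    LocallyValid = ∀ i j → (H i j ≡ true → H j i ≡ true) × (H i j ≡ true → G i j ≡ true × lookup S i ≡ true × lookup S j ≡ true)

  -- The type of local⁺ and local⁻ mentions a function local to isConnSubgraphAt, which has no name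
  -- here; Agda infers it from the first use.
  mutual
    local⁺ : LocallyValid → ∀ i j → _
    local⁻ : ∀ i j → _ → (H i j ≡ true → H j i ≡ true) × (H i j ≡ true → G i j ≡ true × lookup S i ≡ true × lookup S j ≡ true)

    isConnSubgraphAt⁺ : lookup S v ≡ true → (∀ {i j} → H i j ≡ true → H j i ≡ true) →
      (∀ {i j} → H i j ≡ true → G i j ≡ true × lookup S i ≡ true × lookup S j ≡ true) →
      (∀ {i} → lookup S i ≡ true → Star (Adj H) v i) →
      isConnSubgraphAt G v (S , M) ≡ true
    isConnSubgraphAt⁺ v∈S H-sym H⊆ walks =
      ∧⁺ v∈S (∧⁺ (allF⁺ λ i → allF⁺ λ j → local⁺ (λ _ _ → H-sym , H⊆) i j)
                 (connectedB-rooted H-sym v (λ i → walks)))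

    isConnSubgraphAt⁻ : isConnSubgraphAt G v (S , M) ≡ true →
      lookup S v ≡ true × (∀ {i j} → H i j ≡ true → H j i ≡ true) ×
      (∀ {i j} → H i j ≡ true → G i j ≡ true × lookup S i ≡ true × lookup S j ≡ true) ×
      (∀ {i} → lookup S i ≡ true → Star (Adj H) v i)
    isConnSubgraphAt⁻ eq with ∧⁻ {lookup S v} eq
    ... | v∈S , eq′ with ∧⁻ eq′
    ... | valid , conn =
      v∈S , (λ {i} {j} → proj₁ (local⁻ i j (allF⁻ (allF⁻ valid i) j))) ,
      (λ {i} {j} → proj₂ (local⁻ i j (allF⁻ (allF⁻ valid i) j))) ,
      (λ i∈S → connectedB⁻ conn v∈S i∈S)

    local⁺ h i j with lookup (lookup M i) j | lookup (lookup M j) i | h i j | h j i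
    ... | true  | true  | _ , h₂ | _       = let Gij , i∈ , j∈ = h₂ refl in ∧⁺ Gij (∧⁺ i∈ j∈)
    ... | true  | false | h₁ , _ | _       = case h₁ refl of λ ()
    ... | false | true  | _      | h₁ , _  = case h₁ refl of λ ()
    ... | false | false | _      | _       = refl

    local⁻ i j with lookup (lookup M i) j | lookup (lookup M j) i
    ... | true  | true  = λ p → (λ _ → refl) , (λ _ → let Gij , q = ∧⁻ p in Gij , ∧⁻ q)
    ... | false | _     = λ p → (λ ()) , (λ ())

module Subgraphs {n : ℕ} (G : Graph n) where

  -- Decidable predicates instead of Boolean vectors: unions and conditions on positions can then be
  -- written down directly, and `code` translates the result into a candidate.
  record ConnSub (X : VS n) (r : Fin n) : Set₁ where
    field
      mem   : Fin n → Set
      mem?  : ∀ i → Dec (mem i)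
      edge  : Fin n → Fin n → Set
      edge? : ∀ i j → Dec (edge i j)
      mem⊆  : ∀ {i} → mem i → X i ≡ true
      edge⊆ : ∀ {i j} → edge i j → G i j ≡ true × mem i × mem j
      edge-sym : ∀ {i j} → edge i j → edge j i
      root  : mem r
      walk  : ∀ {i} → mem i → Star edge r i
  open ConnSub public

  infix 4 _≐_
  record _≐_ {X r X′ r′} (x : ConnSub X r) (y : ConnSub X′ r′) : Set where
    constructor mk≐
    field
      mem→  : ∀ {i} → mem x i → mem y i
      mem←  : ∀ {i} → mem y i → mem x i
      edge→ : ∀ {i j} → edge x i j → edge y i j
      edge← : ∀ {i j} → edge y i j → edge x i j
  open _≐_ public

  ≐-refl : ∀ {X r} {x : ConnSub X r} → x ≐ x
  ≐-refl = mk≐ id id id id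

  ≐-sym : ∀ {X r X′ r′} {x : ConnSub X r} {y : ConnSub X′ r′} → x ≐ y → y ≐ x
  ≐-sym (mk≐ a b c d) = mk≐ b a d c

  ≐-trans : ∀ {X r X′ r′ X″ r″} {x : ConnSub X r} {y : ConnSub X′ r′} {z : ConnSub X″ r″} → x ≐ y → y ≐ z → x ≐ z
  ≐-trans (mk≐ a b c d) (mk≐ a′ b′ c′ d′) = mk≐ (a′ ∘ a) (b ∘ b′) (c′ ∘ c) (d ∘ d′)

  Distinct : ∀ {X r} → List (ConnSub X r) → Set₁
  Distinct = AllPairs (λ x y → ¬ x ≐ y)

  record Family (X : VS n) (r : Fin n) (N : ℕ) : Set₁ where
    constructor family
    field
      members  : List (ConnSub X r)
      distinct : Distinct members
      many     : N ≤ length members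

  module _ {X r} (x : ConnSub X r) where
    code : Vec Bool n × Vec (Vec Bool n) n
    code = tabulate (λ i → does (mem? x i)) , tabulate (λ i → tabulate λ j → does (edge? x i j))

    lookup-mem : ∀ i → lookup (proj₁ code) i ≡ does (mem? x i)
    lookup-mem i = Vec.lookup∘tabulate _ i

    lookup-edge : ∀ i j → lookup (lookup (proj₂ code) i) j ≡ does (edge? x i j)
    lookup-edge i j = trans (cong (λ v → lookup v j) (Vec.lookup∘tabulate _ i)) (Vec.lookup∘tabulate _ j)

    code-mem⁺ : ∀ {i} → mem x i → lookup (proj₁ code) i ≡ true
    code-mem⁺ {i} m = trans (lookup-mem i) (does⁺ (mem? x i) m)

    code-mem⁻ : ∀ {i} → lookup (proj₁ code) i ≡ true → mem x i
    code-mem⁻ {i} m = does⁻ (mem? x i) (trans (sym (lookup-mem i)) m)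

    code-edge⁺ : ∀ {i j} → edge x i j → lookup (lookup (proj₂ code) i) j ≡ true
    code-edge⁺ {i} {j} e = trans (lookup-edge i j) (does⁺ (edge? x i j) e)

    code-edge⁻ : ∀ {i j} → lookup (lookup (proj₂ code) i) j ≡ true → edge x i j
    code-edge⁻ {i} {j} e = does⁻ (edge? x i j) (trans (sym (lookup-edge i j)) e)

    code-valid : isConnSubgraphAt G r code ≡ true
    code-valid = isConnSubgraphAt⁺ G r (proj₁ code) (proj₂ code) (code-mem⁺ (root x))
      (λ {i} {j} → code-edge⁺ ∘ edge-sym x ∘ code-edge⁻)
      (λ e → let Gij , mi , mj = edge⊆ x (code-edge⁻ e) in Gij , code-mem⁺ mi , code-mem⁺ mj)
      (λ m → Star.map code-edge⁺ (walk x (code-mem⁻ m)))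

  code-injective : ∀ {X r} (x y : ConnSub X r) → code x ≡ code y → x ≐ y
  code-injective x y eq = mk≐ (into x y eq) (into y x (sym eq)) (inte x y eq) (inte y x (sym eq))
    where
    into : ∀ x y → code x ≡ code y → ∀ {i} → mem x i → mem y i
    into x y eq {i} m = code-mem⁻ y (trans (cong (λ c → lookup (proj₁ c) i) (sym eq)) (code-mem⁺ x m))
    inte : ∀ x y → code x ≡ code y → ∀ {i j} → edge x i j → edge y i j
    inte x y eq {i} {j} e =
      code-edge⁻ y (trans (cong (λ c → lookup (lookup (proj₂ c) i) j) (sym eq)) (code-edge⁺ x e))

  Family⇒≤f : ∀ {X v N} → Family X v N → N ≤ f G v
  Family⇒≤f {v = v} (family xs d N≤) = begin
    _                 ≤⟨ N≤ ⟩
    length xs         ≡⟨ length-map code xs ⟨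
    length (map code xs) ≤⟨ length≤countB (isConnSubgraphAt G v)
         (AllPairs.map⁺ (AllPairs.map (λ {x} {y} ¬eq → ¬eq ∘ code-injective x y) d))
         (λ c∈ → case Mem.∈-map⁻ code c∈ of λ { (x , _ , refl) → code-valid x , candidates-complete n _ }) ⟩
    f G v ∎
    where
    open ≤-Reasoning

  Family-weaken : ∀ {X v M N} → M ≤ N → Family X v N → Family X v M
  Family-weaken M≤N (family xs d N≤) = family xs d (≤-trans M≤N N≤)

  Through : VS n → Fin n → Fin n → Set₁
  Through X v c = Σ (ConnSub X v) λ x → mem x c

  DistinctThrough : ∀ {X v c} → List (Through X v c) → Set₁
  DistinctThrough = AllPairs (λ x y → ¬ proj₁ x ≐ proj₁ y)

  -- Two lists are kept because gluing at `c` treats them differently: every member survives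
  -- unchanged, but only those that contain `c` can be extended beyond it.
  record FamilyThrough (X : VS n) (v c : Fin n) (N D : ℕ) : Set₁ where
    constructor through
    field
      members   : List (ConnSub X v)
      distinct  : Distinct members
      many      : N ≤ length members
      members′  : List (Through X v c)
      distinct′ : DistinctThrough members′
      many′     : D ≤ length members′

  Family⇒FamilyThrough : ∀ {X r N} → Family X r N → FamilyThrough X r r N N
  Family⇒FamilyThrough (family xs d N≤) = through xs d N≤ (map (λ x → x , root x) xs)
    (AllPairs.map⁺ d) (≤-trans N≤ (≤-reflexive (sym (length-map _ xs))))

-- Gluing two parts at a vertex

module Combine {n : ℕ} (G : Graph n) (irr : ∀ i → G i i ≡ false) where
  open Subgraphs G

  embed : ∀ {X W v} → (∀ {i} → X i ≡ true → W i ≡ true) → ConnSub X v → ConnSub W v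
  embed X⊆W x = record
    { mem = mem x ; mem? = mem? x ; edge = edge x ; edge? = edge? x ; mem⊆ = X⊆W ∘ mem⊆ x
    ; edge⊆ = edge⊆ x ; edge-sym = edge-sym x ; root = root x ; walk = walk x }

  module _ {Y : VS n} {c : Fin n} where
    Nontrivial : ConnSub Y c → Set
    Nontrivial y = ∃ λ i → i ≢ c × mem y i

    nontrivial? : ∀ y → Dec (Nontrivial y)
    nontrivial? y = Fin.any? λ i → ¬? (i Fin.≟ c) ×-dec mem? y i

    trivial-≐ : ∀ {y z} → ¬ Nontrivial y → ¬ Nontrivial z → y ≐ z
    trivial-≐ {y} {z} ty tz = mk≐ (into y z ty) (into z y tz) (⊥-elim ∘ none y ty) (⊥-elim ∘ none z tz)
      where
      only : ∀ y → ¬ Nontrivial y → ∀ {i} → mem y i → i ≡ c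
      only y ty {i} m with i Fin.≟ c
      ... | yes i≡c = i≡c
      ... | no i≢c = ⊥-elim (ty (i , i≢c , m))
      into : ∀ y z → ¬ Nontrivial y → ∀ {i} → mem y i → mem z i
      into y z ty m with only y ty m
      ... | refl = root z
      none : ∀ y → ¬ Nontrivial y → ∀ {i j} → edge y i j → ⊥
      none y ty e with edge⊆ y e
      ... | Gij , mi , mj with only y ty mi | only y ty mj
      ... | refl | refl = true≢false Gij (irr c)

    -- All trivial subgraphs coincide, so a list without repetitions has at most one. Once it is
    -- met, everything after it is nontrivial and `keep` drops nothing. The last component passes
    -- the inequalities of a head on to the shortened tail.
    nontrivials : ∀ ys → Distinct ys →
      Σ (List (Σ (ConnSub Y c) Nontrivial)) λ zs → AllPairs (λ a b → ¬ proj₁ a ≐ proj₁ b) zs ×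
        length ys ≤ suc (length zs) × (∀ {P : ConnSub Y c → Set} → All P ys → All (P ∘ proj₁) zs)
    nontrivials [] [] = [] , [] , z≤n , λ _ → []
    nontrivials (y ∷ ys) (y∉ ∷ d) with nontrivial? y
    ... | yes nt = let zs , d′ , l , sub = nontrivials ys d in
      (y , nt) ∷ zs , sub y∉ ∷ d′ , s≤s l , λ { (p ∷ ps) → p ∷ sub ps }
    ... | no t = let zs , d′ , l , sub = keep ys d (All.map (λ {z} y≉z → nontriv z y≉z) y∉) in
      zs , d′ , s≤s l , λ { (p ∷ ps) → sub ps }
      where
      nontriv : ∀ z → ¬ y ≐ z → Nontrivial z
      nontriv z y≉z with nontrivial? z
      ... | yes nt = nt
      ... | no tz = ⊥-elim (y≉z (trivial-≐ t tz))
      keep : ∀ ys → Distinct ys → All Nontrivial ys →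
        Σ (List (Σ (ConnSub Y c) Nontrivial)) λ zs → AllPairs (λ a b → ¬ proj₁ a ≐ proj₁ b) zs ×
          length ys ≤ length zs × (∀ {P : ConnSub Y c → Set} → All P ys → All (P ∘ proj₁) zs)
      keep [] [] [] = [] , [] , z≤n , λ _ → []
      keep (y ∷ ys) (y∉ ∷ d) (nt ∷ nts) = let zs , d′ , l , sub = keep ys d nts in
        (y , nt) ∷ zs , sub y∉ ∷ d′ , s≤s l , λ { (p ∷ ps) → p ∷ sub ps }

  module _ {X Y W : VS n} {v c : Fin n} (X⊆W : ∀ {i} → X i ≡ true → W i ≡ true)
           (Y⊆W : ∀ {i} → Y i ≡ true → W i ≡ true) (X∩Y : ∀ {i} → X i ≡ true → Y i ≡ true → i ≡ c) where

    join : Through X v c → ConnSub Y c → ConnSub W v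
    join (x , mc) y = record
      { mem = λ i → mem x i ⊎ mem y i
      ; mem? = λ i → mem? x i ⊎-dec mem? y i
      ; edge = λ i j → edge x i j ⊎ edge y i j
      ; edge? = λ i j → edge? x i j ⊎-dec edge? y i j
      ; mem⊆ = [ X⊆W ∘ mem⊆ x , Y⊆W ∘ mem⊆ y ]′
      ; edge⊆ = λ where
          (inj₁ e) → let g , a , b = edge⊆ x e in g , inj₁ a , inj₁ b
          (inj₂ e) → let g , a , b = edge⊆ y e in g , inj₂ a , inj₂ b
      ; edge-sym = λ where
          (inj₁ e) → inj₁ (edge-sym x e)
          (inj₂ e) → inj₂ (edge-sym y e)
      ; root = inj₁ (root x)
      ; walk = λ where
          (inj₁ m) → Star.map inj₁ (walk x m)
          (inj₂ m) → Star.map inj₁ (walk x mc) ◅◅ Star.map inj₂ (walk y m)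
      }

    -- Both ends would equal `c`, and `G` has no loops.
    noCommonEdge : ∀ (x : ConnSub X v) (y : ConnSub Y c) {i j} → mem x i → mem x j → mem y i → mem y j → G i j ≡ true → ⊥
    noCommonEdge x y xi xj yi yj Gij with X∩Y (mem⊆ x xi) (mem⊆ y yi) | X∩Y (mem⊆ x xj) (mem⊆ y yj)
    ... | refl | refl = true≢false Gij (irr c)

    -- The factors are recovered by restricting to `X` and to `Y`: the parts share only `c`, which
    -- belongs to both factors, and they share no edge.
    join-injective : ∀ {x x′ y y′} → join x y ≐ join x′ y′ → proj₁ x ≐ proj₁ x′ × y ≐ y′
    join-injective {x} {x′} {y} {y′} eq =
      mk≐ (memX x x′ y y′ (mem→ eq)) (memX x′ x y′ y (mem← eq)) (edgeX x x′ y y′ (edge→ eq)) (edgeX x′ x y′ y (edge← eq)) ,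
      mk≐ (memY x x′ y y′ (mem→ eq)) (memY x′ x y′ y (mem← eq)) (edgeY x x′ y y′ (edge→ eq)) (edgeY x′ x y′ y (edge← eq))
      where
      memX : ∀ x x′ y y′ → (∀ {i} → mem (join x y) i → mem (join x′ y′) i) → ∀ {i} → mem (proj₁ x) i → mem (proj₁ x′) i
      memX x x′ y y′ h m with h (inj₁ m)
      ... | inj₁ m′ = m′
      ... | inj₂ m′ with X∩Y (mem⊆ (proj₁ x) m) (mem⊆ y′ m′)
      ... | refl = proj₂ x′
      memY : ∀ x x′ y y′ → (∀ {i} → mem (join x y) i → mem (join x′ y′) i) → ∀ {i} → mem y i → mem y′ i
      memY x x′ y y′ h m with h (inj₂ m)
      ... | inj₂ m′ = m′
      ... | inj₁ m′ with X∩Y (mem⊆ (proj₁ x′) m′) (mem⊆ y m)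
      ... | refl = root y′
      edgeX : ∀ x x′ y y′ → (∀ {i j} → edge (join x y) i j → edge (join x′ y′) i j) →
              ∀ {i j} → edge (proj₁ x) i j → edge (proj₁ x′) i j
      edgeX x x′ y y′ h e with h (inj₁ e)
      ... | inj₁ e′ = e′
      ... | inj₂ e′ = let g , xi , xj = edge⊆ (proj₁ x) e
                          _ , yi , yj = edge⊆ y′ e′
                      in ⊥-elim (noCommonEdge (proj₁ x) y′ xi xj yi yj g)
      edgeY : ∀ x x′ y y′ → (∀ {i j} → edge (join x y) i j → edge (join x′ y′) i j) →
              ∀ {i j} → edge y i j → edge y′ i j
      edgeY x x′ y y′ h e with h (inj₂ e)
      ... | inj₂ e′ = e′
      ... | inj₁ e′ = let g , yi , yj = edge⊆ y e
                          _ , xi , xj = edge⊆ (proj₁ x′) e′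
                      in ⊥-elim (noCommonEdge (proj₁ x′) y xi xj yi yj g)

    -- Each of the `D` subgraphs through `c` is extended by `M` nontrivial subgraphs of `Y`; the
    -- subgraph consisting of `c` alone accounts for the `suc`. The extensions differ from the old
    -- `N` because they contain a vertex of `Y` other than `c`.
    glue : ∀ {N D M} → FamilyThrough X v c N D → Family Y c (suc M) → Family W v (N + D * M)
    glue {N} {D} {M} (through xs d N≤ xc d′ D≤) (family ys dy M≤) with nontrivials ys dy
    ... | zs , dz , l , _ = family (old ++ new) (AllPairs.++⁺ old! new! (All.map⁺ (All.universal old#new xs))) (begin
        N + D * M                          ≤⟨ +-mono-≤ N≤ (*-mono-≤ D≤ (s≤s⁻¹ (≤-trans M≤ l))) ⟩
        length xs + length xc * length zs  ≡⟨ cong₂ _+_ (length-map (embed X⊆W) xs)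
                                                (length-cartesianProductWith join′ xc zs) ⟨
        length old + length new            ≡⟨ length-++ old ⟨
        length (old ++ new)                ∎)
      where
      open ≤-Reasoning
      join′ : Through X v c → Σ (ConnSub Y c) Nontrivial → ConnSub W v
      join′ x (y , _) = join x y
      old new : List (ConnSub W v)
      old = map (embed X⊆W) xs
      new = cartesianProductWith join′ xc zs
      ≐-setoid : ∀ {A : Set₁} {X r} → (A → ConnSub X r) → Setoid _ _
      ≐-setoid {A} g = record { Carrier = A ; _≈_ = λ a b → g a ≐ g b
        ; isEquivalence = record { refl = ≐-refl ; sym = ≐-sym ; trans = ≐-trans } }
      old! : Distinct old
      old! = AllPairs.map⁺ (AllPairs.map (λ x≉y (mk≐ a b e g) → x≉y (mk≐ a b e g)) d)
      new! : Distinct new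
      new! = Uniqueₛ.cartesianProductWith⁺ (≐-setoid proj₁) (≐-setoid proj₁) (≐-setoid id)
        join′ join-injective d′ dz
      old#new : ∀ x → All (λ z → ¬ embed X⊆W x ≐ z) new
      old#new x = All.cartesianProductWith⁺ (setoid _) (setoid _) join′ xc zs
        λ {w} {z} _ _ eq → let i , i≢c , mi = proj₂ z in i≢c (X∩Y (mem⊆ x (mem← eq (inj₂ mi))) (mem⊆ (proj₁ z) mi))

-- Families of connected subgraphs from an ordering

tri : ℕ → List (ℕ × ℕ)
tri zero    = []
tri (suc p) = map (_, p) (upTo p) ++ tri p

-- The binomial coefficient C(p, 2).
triN : ℕ → ℕ
triN zero    = 0
triN (suc p) = p + triN p

length-tri : ∀ p → length (tri p) ≡ triN p
length-tri zero    = refl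
length-tri (suc p) = trans (length-++ (map (_, p) (upTo p)))
  (cong₂ _+_ (trans (length-map (_, p) (upTo p)) (length-upTo p)) (length-tri p))

upTo-< : ∀ m → All (_< m) (upTo m)
upTo-< m = All.applyUpTo⁺₁ id m id

tri-bounds : ∀ p → All (λ (i , j) → i < j × j < p) (tri p)
tri-bounds zero    = []
tri-bounds (suc p) = All.++⁺
  (All.map⁺ (All.map (λ i<p → i<p , ≤-refl) (upTo-< p)))
  (All.map (λ (i<j , j<p) → i<j , m≤n⇒m≤1+n j<p) (tri-bounds p))

tri-unique : ∀ p → Unique (tri p)
tri-unique zero    = []
tri-unique (suc p) = Unique.++⁺ (Unique.map⁺ (λ { refl → refl }) (Unique.upTo⁺ p)) (tri-unique p)
  λ (∈row , ∈tri) → case Mem.∈-map⁻ (_, p) ∈row of λ { (_ , _ , refl) →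
    <-irrefl refl (proj₂ (All.lookup (tri-bounds p) ∈tri)) }

tri-complete : ∀ {p i j} → i < j → j < p → (i , j) ∈ tri p
tri-complete {suc p} {i} {j} i<j (s≤s j≤p) with m≤n⇒m<n∨m≡n j≤p
... | inj₁ j<p  = Mem.∈-++⁺ʳ (map (_, p) (upTo p)) (tri-complete i<j j<p)
... | inj₂ refl = Mem.∈-++⁺ˡ (Mem.∈-map⁺ (_, j) (Mem.∈-upTo⁺ i<j))

module _ {a} {I : Set} {V : I → Set} {A : Set a} (g : ∀ {i} → V i → A) where
  length-reduce : ∀ {is} (vs : All V is) → length (All.reduce g vs) ≡ length is
  length-reduce []       = refl
  length-reduce (v ∷ vs) = cong suc (length-reduce vs)

  All-reduce : ∀ {p is} {P : A → Set p} → (∀ {i} (v : V i) → P (g v)) → (vs : All V is) → All P (All.reduce g vs)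
  All-reduce h []       = []
  All-reduce h (v ∷ vs) = h v ∷ All-reduce h vs

  distinct-reduce : ∀ {_~_ : A → A → Set} → (∀ {i j} (v : V i) (w : V j) → g v ~ g w → i ≡ j) →
                    ∀ {is} (vs : All V is) → Unique is → AllPairs (λ x y → ¬ x ~ y) (All.reduce g vs)
  distinct-reduce {_~_} inj []       []       = []
  distinct-reduce {_~_} inj {i ∷ is} (v ∷ vs) (i∉ ∷ u) = rest vs i∉ ∷ distinct-reduce inj vs u
    where
    rest : ∀ {js} (ws : All V js) → All (i ≢_) js → All (λ y → ¬ g v ~ y) (All.reduce g ws)
    rest []       []         = []
    rest (w ∷ ws) (i≢j ∷ ps) = (i≢j ∘ inj v w) ∷ rest ws ps

module FromOrdering {n : ℕ} (G : Graph n) (G-sym : ∀ i j → G i j ≡ G j i) where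
 open Subgraphs G
 open Connectivity G G-sym
 module _ {W : VS n} {r : Fin n} {a : ℕ} (o : Ordering (λ _ → false) W r a) where
  open Ordering o

  pos-vtx-at : ∀ {w k} → W w ≡ true → pos w ≡ k → w ≡ vtx k
  pos-vtx-at Ww refl = sym (vtx-pos Ww)

  lower : ∀ {w k} → W w ≡ true → pos w ≡ suc k → ∃ λ u → G u w ≡ true × W u ≡ true × pos u ≤ k
  lower Ww eq with low Ww eq
  ... | u , e , inj₂ (Wu , u≤) = u , e , Wu , u≤

  module Build (Wr : W r ≡ true) where
    vtx-0 : vtx 0 ≡ r
    vtx-0 = trans (cong vtx (sym pos-r)) (vtx-pos Wr)

    -- Membership depends on positions only. Two subgraphs given by patterns can therefore be told
    -- apart by evaluating the patterns at the position of a suitable `vtx k`.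
    record Pattern : Set₁ where
      field
        P  : ℕ → Set
        P? : ∀ k → Dec (P k)
        Q  : ℕ → ℕ → Set
        Q? : ∀ k l → Dec (Q k l)
        Q⊆ : ∀ {k l} → Q k l → P k × P l
        Q-sym : ∀ {k l} → Q k l → Q l k
        P0 : P 0
    open Pattern

    E : (ℕ → ℕ → Set) → Fin n → Fin n → Set
    E Q u w = G u w ≡ true × W u ≡ true × W w ≡ true × Q (pos u) (pos w)

    Walks : Pattern → Set
    Walks p = ∀ {w} → W w ≡ true → P p (pos w) → Star (E (Q p)) r w

    realise : (p : Pattern) → Walks p → ConnSub W r
    realise p walks = record
      { mem = λ w → W w ≡ true × P p (pos w)
      ; mem? = λ w → (W w Bool.≟ true) ×-dec P? p (pos w)
      ; edge = E (Q p)
      ; edge? = λ u w → (G u w Bool.≟ true) ×-dec (W u Bool.≟ true) ×-dec (W w Bool.≟ true) ×-dec Q? p (pos u) (pos w)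
      ; mem⊆ = proj₁
      ; edge⊆ = λ (e , Wu , Ww , q) → let pu , pw = Q⊆ p q in e , (Wu , pu) , (Ww , pw)
      ; edge-sym = λ (e , Wu , Ww , q) → flip-edge e , Ww , Wu , Q-sym p q
      ; root = Wr , subst (P p) (sym pos-r) (P0 p)
      ; walk = λ (Ww , pw) → walks Ww pw
      }

    module _ {p p′ : Pattern} {walks : Walks p} {walks′ : Walks p′} (eq : realise p walks ≐ realise p′ walks′) where
      transfer : ∀ {k} → k ≤ a → P p k → P p′ k
      transfer {k} k≤a pk =
        subst (P p′) (pos-vtx k≤a) (proj₂ (mem→ eq (vtx∈ k≤a , subst (P p) (sym (pos-vtx k≤a)) pk)))

      transferE : ∀ {u w} → G u w ≡ true → W u ≡ true → W w ≡ true → Q p (pos u) (pos w) → Q p′ (pos u) (pos w)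
      transferE e Wu Ww q = proj₂ (proj₂ (proj₂ (edge→ eq (e , Wu , Ww , q))))

    -- Passing to a low neighbour decreases the position, so the walk ends at `r` and never exceeds
    -- `i`. The bound `m` on the position is what decreases in the recursion.
    lowWalk : ∀ (Q : ℕ → ℕ → Set) {i} → (∀ {k l} → k ≤ i → l ≤ i → Q k l) →
              ∀ m {w} → W w ≡ true → pos w ≤ m → m ≤ i → Star (E Q) r w
    lowWalk Q q m {w} Ww ≤m m≤i with pos w in eq
    ... | zero = subst (Star _ r) (trans (sym vtx-0) (sym (pos-vtx-at Ww eq))) ε
    lowWalk Q q (suc m) {w} Ww (s≤s k≤m) m≤i | suc k with lower Ww eq
    ... | u , e , Wu , u≤k = lowWalk Q q m Wu (≤-trans u≤k k≤m) (≤-trans (n≤1+n m) m≤i) ◅◅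
      ((e , Wu , Ww , q (≤-trans u≤k (≤-trans k≤m (≤-trans (n≤1+n m) m≤i)))
                        (≤-trans (≤-reflexive eq) (≤-trans (s≤s k≤m) m≤i))) ◅ ε)

    -- Passing to a high neighbour either reaches `r` or increases the position, which never exceeds
    -- `a`; `m` bounds the number of steps left.
    highWalk : ∀ (Q : ℕ → ℕ → Set) {j} → (∀ {k l} → k ≡ 0 ⊎ j < k → l ≡ 0 ⊎ j < l → Q k l) →
               ∀ m {w} → W w ≡ true → pos w ≡ 0 ⊎ (j < pos w × a < m + pos w) → Star (E Q) r w
    highWalk Q q m {w} Ww hi with pos w in eq
    ... | zero = subst (Star _ r) (trans (sym vtx-0) (sym (pos-vtx-at Ww eq))) ε
    highWalk Q q zero {w} Ww (inj₂ (j< , a<)) | suc k =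
      ⊥-elim (<-irrefl refl (≤-trans a< (≤-trans (≤-reflexive (sym eq)) (pos≤ Ww))))
    highWalk Q q (suc m) {w} Ww (inj₂ (j< , a<)) | suc k with high Ww eq
    ... | u , e , Wu , p = highWalk Q q m Wu (bound p) ◅◅ ((e , Wu , Ww , q (hi-u p) (inj₂ (subst (_ <_) (sym eq) j<))) ◅ ε)
      where
      hi-u : pos u ≡ 0 ⊎ suc k < pos u → pos u ≡ 0 ⊎ _ < pos u
      hi-u (inj₁ z)  = inj₁ z
      hi-u (inj₂ k<) = inj₂ (<-trans j< k<)
      bound : pos u ≡ 0 ⊎ suc k < pos u → pos u ≡ 0 ⊎ (_ < pos u × a < m + pos u)
      bound (inj₁ z)  = inj₁ z
      bound (inj₂ k<) = inj₂ (<-trans j< k< ,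
        ≤-trans a< (≤-trans (≤-reflexive (sym (+-suc m (suc k)))) (+-monoʳ-≤ m k<)))

    highWalk′ : ∀ (Q : ℕ → ℕ → Set) {j} → (∀ {k l} → k ≡ 0 ⊎ j < k → l ≡ 0 ⊎ j < l → Q k l) →
                ∀ {w} → W w ≡ true → j < pos w → Star (E Q) r w
    highWalk′ Q q {w} Ww j< = highWalk Q q (suc a) Ww (inj₂ (j< , m≤m+n (suc a) (pos w)))

    -- The parts at positions ≤ i and > j are each connected to r, so the edges between them can be dropped;
    -- for i = j this leaves a spanning subgraph.
    segment : ℕ → ℕ → Pattern
    segment i j = record
      { P = λ k → k ≤ i ⊎ j < k
      ; P? = λ k → (k ≤? i) ⊎-dec (j <? k)
      ; Q = λ k l → (k ≤ i × l ≤ i) ⊎ ((k ≡ 0 ⊎ j < k) × (l ≡ 0 ⊎ j < l))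
      ; Q? = λ k l → ((k ≤? i) ×-dec (l ≤? i)) ⊎-dec (((k ≟ 0) ⊎-dec (j <? k)) ×-dec ((l ≟ 0) ⊎-dec (j <? l)))
      ; Q⊆ = λ where
          (inj₁ (p , q)) → inj₁ p , inj₁ q
          (inj₂ (p , q)) → zero-or p , zero-or q
      ; Q-sym = λ where
          (inj₁ (p , q)) → inj₁ (q , p)
          (inj₂ (p , q)) → inj₂ (q , p)
      ; P0 = inj₁ z≤n
      }
      where
      zero-or : ∀ {k} → k ≡ 0 ⊎ j < k → k ≤ i ⊎ j < k
      zero-or (inj₁ refl) = inj₁ z≤n
      zero-or (inj₂ p)    = inj₂ p

    seg-walks : ∀ i j → Walks (segment i j)
    seg-walks i j Ww (inj₁ ≤i) = lowWalk (Q (segment i j)) (λ p q → inj₁ (p , q)) i Ww ≤i ≤-refl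
    seg-walks i j Ww (inj₂ j<) = highWalk′ (Q (segment i j)) (λ p q → inj₂ (p , q)) Ww j<

    seg : ℕ → ℕ → ConnSub W r
    seg i j = realise (segment i j) (seg-walks i j)

    hole : ℕ → ℕ → ℕ → Pattern
    hole s t e = record
      { P = λ k → k ≤ s ⊎ k ≡ t ⊎ e < k
      ; P? = dec
      ; Q = λ k l → (k ≤ s ⊎ k ≡ t ⊎ e < k) × (l ≤ s ⊎ l ≡ t ⊎ e < l)
      ; Q? = λ k l → dec k ×-dec dec l
      ; Q⊆ = id
      ; Q-sym = λ (p , q) → q , p
      ; P0 = inj₁ z≤n
      }
      where
      dec = λ k → (k ≤? s) ⊎-dec (k ≟ t) ⊎-dec (e <? k)

    -- The anchor is the neighbour that keeps vtx t connected although its neighbours in the ordering are left out.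
    record Hole (s t e : ℕ) : Set where
      field
        s<t : suc s < t
        t<e : t < e
        e≤a : e ≤ a
        anchor : ∃ λ u → G u (vtx t) ≡ true × W u ≡ true × (pos u ≤ s ⊎ e < pos u)
    open Hole

    hole-walks : ∀ {s t e} → Hole s t e → Walks (hole s t e)
    hole-walks {s} {t} {e} h = walks
      where
      low-w : ∀ {w} → W w ≡ true → pos w ≤ s → Star (E (Q (hole s t e))) r w
      low-w Ww ≤s = lowWalk (Q (hole s t e)) (λ p q → inj₁ p , inj₁ q) s Ww ≤s ≤-refl
      out : ∀ {k} → k ≡ 0 ⊎ e < k → k ≤ s ⊎ k ≡ t ⊎ e < k
      out (inj₁ refl) = inj₁ z≤n
      out (inj₂ p)    = inj₂ (inj₂ p)
      high-w : ∀ {w} → W w ≡ true → e < pos w → Star (E (Q (hole s t e))) r w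
      high-w Ww e< = highWalk′ (Q (hole s t e)) (λ p q → out p , out q) Ww e<
      walks : Walks (hole s t e)
      walks Ww (inj₁ ≤s) = low-w Ww ≤s
      walks Ww (inj₂ (inj₂ e<)) = high-w Ww e<
      walks {w} Ww (inj₂ (inj₁ ≡t)) with anchor h | pos-vtx-at Ww ≡t
      ... | u , g , Wu , inj₁ ≤s | refl = low-w Wu ≤s ◅◅ ((g , Wu , Ww , inj₁ ≤s , inj₂ (inj₁ ≡t)) ◅ ε)
      ... | u , g , Wu , inj₂ e< | refl = high-w Wu e< ◅◅ ((g , Wu , Ww , inj₂ (inj₂ e<) , inj₂ (inj₁ ≡t)) ◅ ε)

    holeSub : ∀ {s t e} → Hole s t e → ConnSub W r
    holeSub {s} {t} {e} h = realise (hole s t e) (hole-walks h)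

    seg-missing : ∀ {i j k} → i < k → k ≤ j → ¬ P (segment i j) k
    seg-missing i<k k≤j (inj₁ k≤i) = <-irrefl refl (≤-trans i<k k≤i)
    seg-missing i<k k≤j (inj₂ j<k) = <-irrefl refl (≤-trans j<k k≤j)

    seg-missing⁻ : ∀ {i j k} → ¬ P (segment i j) k → i < k × k ≤ j
    seg-missing⁻ ¬p = ≰⇒> (¬p ∘ inj₁) , ≮⇒≥ (¬p ∘ inj₂)

    transferS : ∀ {i j i′ j′} → seg i j ≐ seg i′ j′ → ∀ {k} → k ≤ a → P (segment i j) k → P (segment i′ j′) k
    transferS {i} {j} {i′} {j′} eq = transfer {segment i j} {segment i′ j′} {seg-walks i j} {seg-walks i′ j′} eq

    Strict : ℕ × ℕ → Set
    Strict (i , j) = i < j × j ≤ a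

    -- The missing positions are i + 1, ..., j. This interval is nonempty, so it determines both of
    -- its ends.
    seg-injective : ∀ {i j i′ j′} → Strict (i , j) → Strict (i′ , j′) → seg i j ≐ seg i′ j′ → (i , j) ≡ (i′ , j′)
    seg-injective {i} {j} {i′} {j′} s s′ eq =
      cong₂ _,_ (≤-antisym (i≤ s′ s (≐-sym eq)) (i≤ s s′ eq)) (≤-antisym (j≤ s s′ eq) (j≤ s′ s (≐-sym eq)))
      where
      i≤ : ∀ {i j i′ j′} → Strict (i , j) → Strict (i′ , j′) → seg i j ≐ seg i′ j′ → i′ ≤ i
      i≤ (i<j , j≤a) _ eq = s≤s⁻¹ (proj₁ (seg-missing⁻
        (seg-missing ≤-refl i<j ∘ transferS (≐-sym eq) (≤-trans i<j j≤a))))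
      j≤ : ∀ {i j i′ j′} → Strict (i , j) → Strict (i′ , j′) → seg i j ≐ seg i′ j′ → j ≤ j′
      j≤ (i<j , j≤a) _ eq = proj₂ (seg-missing⁻
        (seg-missing i<j ≤-refl ∘ transferS (≐-sym eq) j≤a))

    Spanning : ConnSub W r → Set
    Spanning x = ∀ {w} → W w ≡ true → mem x w

    strict-≉-spanning : ∀ {i j x} → Strict (i , j) → Spanning x → ¬ seg i j ≐ x
    strict-≉-spanning {i} {j} {x} (i<j , j≤a) sp eq = seg-missing ≤-refl i<j
      (subst (P (segment i j)) (pos-vtx i<a) (proj₂ (mem← eq (sp (vtx∈ i<a)))))
      where i<a = ≤-trans i<j j≤a

    diag-spanning : ∀ i → Spanning (seg i i)
    diag-spanning i {w} Ww = Ww , ≤-<-connex (pos w) i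

    -- Positions `suc s` and `e` are missing while `t` between them is present, but the missing
    -- positions of a segment form an interval.
    hole-≉-seg : ∀ {s t e i j} (h : Hole s t e) → ¬ holeSub h ≐ seg i j
    hole-≉-seg {s} {t} {e} {i} {j} h eq =
      seg-missing (<-trans (proj₁ left) (s<t h)) (≤-trans (<⇒≤ (t<e h)) (proj₂ right))
        (transfer {hole s t e} {segment i j} {hole-walks h} {seg-walks i j} eq t≤a (inj₂ (inj₁ refl)))
      where
      t≤a = ≤-trans (<⇒≤ (t<e h)) (e≤a h)
      back : ∀ {k} → k ≤ a → P (segment i j) k → P (hole s t e) k
      back = transfer {segment i j} {hole s t e} {seg-walks i j} {hole-walks h} (≐-sym eq)
      left : i < suc s × suc s ≤ j
      left = seg-missing⁻ λ p → case back (≤-trans (<⇒≤ (s<t h)) t≤a) p of λ where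
        (inj₁ q) → <-irrefl refl q
        (inj₂ (inj₁ q)) → <-irrefl q (s<t h)
        (inj₂ (inj₂ q)) → <-asym (<-trans (s<t h) (t<e h)) q
      right : i < e × e ≤ j
      right = seg-missing⁻ λ p → case back (e≤a h) p of λ where
        (inj₁ q) → <-irrefl refl (≤-trans (<-trans (s<t h) (t<e h)) (≤-trans q (n≤1+n s)))
        (inj₂ (inj₁ q)) → <-irrefl (sym q) (t<e h)
        (inj₂ (inj₂ q)) → <-irrefl refl q

    hole-injective : ∀ {s t e s′ t′ e′} (h : Hole s t e) (h′ : Hole s′ t′ e′) → holeSub h ≐ holeSub h′ →
                     (s , t , e) ≡ (s′ , t′ , e′)
    hole-injective {s} {t} {e} {s′} {t′} {e′} h h′ eq =
      cong₂ _,_ s≡ (cong₂ _,_ t≡ (≤-antisym (e≤ h′ h (≐-sym eq)) (e≤ h h′ eq)))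
      where
      tr : ∀ {s t e s′ t′ e′} (h : Hole s t e) (h′ : Hole s′ t′ e′) → holeSub h ≐ holeSub h′ →
           ∀ {k} → k ≤ a → P (hole s t e) k → P (hole s′ t′ e′) k
      tr {s} {t} {e} {s′} {t′} {e′} h h′ eq = transfer {hole s t e} {hole s′ t′ e′} {hole-walks h} {hole-walks h′} eq
      s≤ : ∀ {s t e s′ t′ e′} (h : Hole s t e) (h′ : Hole s′ t′ e′) → holeSub h ≐ holeSub h′ → s ≤ s′
      s≤ {s} {s′ = s′} h h′ eq = ≮⇒≥ λ s′<s → case tr h h′ eq (≤-trans s′<s (≤-trans (n≤1+n s)
             (≤-trans (<⇒≤ (s<t h)) (≤-trans (<⇒≤ (t<e h)) (e≤a h))))) (inj₁ s′<s) of λ where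
        (inj₁ q) → <-irrefl refl q
        (inj₂ (inj₁ q)) → <-irrefl q (s<t h′)
        (inj₂ (inj₂ q)) → <-asym (<-trans (s<t h′) (t<e h′)) q
      e≤ : ∀ {s t e s′ t′ e′} (h : Hole s t e) (h′ : Hole s′ t′ e′) → holeSub h ≐ holeSub h′ → e′ ≤ e
      e≤ {s′ = s′} h h′ eq = ≮⇒≥ λ e<e′ → case tr h h′ eq (e≤a h′) (inj₂ (inj₂ e<e′)) of λ where
        (inj₁ q) → <-irrefl refl (≤-trans (<-trans (s<t h′) (t<e h′)) (≤-trans q (n≤1+n s′)))
        (inj₂ (inj₁ q)) → <-irrefl (sym q) (t<e h′)
        (inj₂ (inj₂ q)) → <-irrefl refl q
      s≡ : s ≡ s′
      s≡ = ≤-antisym (s≤ h h′ eq) (s≤ h′ h (≐-sym eq))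
      t≡ : t ≡ t′
      t≡ with tr h h′ eq (≤-trans (<⇒≤ (t<e h)) (e≤a h)) (inj₂ (inj₁ refl))
      ... | inj₁ q = ⊥-elim (<-irrefl refl (≤-trans (s<t h) (≤-trans q (≤-trans (≤-reflexive (sym s≡)) (n≤1+n s)))))
      ... | inj₂ (inj₁ q) = q
      ... | inj₂ (inj₂ q) = ⊥-elim (<-asym (t<e h) (≤-trans (s≤s (e≤ h′ h (≐-sym eq))) q))

    hole-≉-spanning : ∀ {s t e x} (h : Hole s t e) → Spanning x → ¬ holeSub h ≐ x
    hole-≉-spanning {s} {t} {e} h sp eq with subst (P (hole s t e)) (pos-vtx (e≤a h)) (proj₂ (mem← eq (sp (vtx∈ (e≤a h)))))
    ... | inj₁ q = <-irrefl refl (≤-trans (<-trans (s<t h) (t<e h)) (≤-trans q (n≤1+n s)))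
    ... | inj₂ (inj₁ q) = <-irrefl (sym q) (t<e h)
    ... | inj₂ (inj₂ q) = <-irrefl refl q

module Families {n : ℕ} (G : Graph n) (G-sym : ∀ i j → G i j ≡ G j i) where
 open Subgraphs G
 open Connectivity G G-sym
 module _ {W : VS n} {r : Fin n} {a : ℕ} (o : Ordering (λ _ → false) W r a) (Wr : W r ≡ true) where
  open Ordering o
  open FromOrdering G G-sym
  open Build o Wr

  segOf : ∀ {ij} → Strict ij → ConnSub W r
  segOf {i , j} _ = seg i j

  strict-tri : ∀ p → p ≤ suc a → All Strict (tri p)
  strict-tri p p≤ = All.map (λ (i<j , j<p) → i<j , s≤s⁻¹ (≤-trans j<p p≤)) (tri-bounds p)

  segs : List (ConnSub W r)
  segs = All.reduce segOf (strict-tri (suc a) ≤-refl)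

  segs-distinct : Distinct segs
  segs-distinct = distinct-reduce segOf seg-injective (strict-tri (suc a) ≤-refl) (tri-unique (suc a))

  segs-length : length segs ≡ triN (suc a)
  segs-length = trans (length-reduce segOf (strict-tri (suc a) ≤-refl)) (length-tri (suc a))

  all-segs : {P : ConnSub W r → Set} → (∀ {i j} → Strict (i , j) → P (seg i j)) → All P segs
  all-segs h = All-reduce segOf h (strict-tri (suc a) ≤-refl)

  segFamily : Family W r (suc (triN (suc a)))
  segFamily = family (seg 0 0 ∷ segs)
    (all-segs (λ s eq → strict-≉-spanning s (diag-spanning 0) (≐-sym eq)) ∷ segs-distinct)
    (s≤s (≤-reflexive (sym segs-length)))

  -- If `vtx 1` and `vtx 2` are adjacent, `seg 1 1` is a second spanning subgraph, as it lacks that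
  -- edge. If not, the low neighbour of `vtx 2` must be `r`, so position 2 may be kept while 1 and 3
  -- are left out; this needs a position 3.
  segFamily⁺ : 3 ≤ a → Family W r (2 + triN (suc a))
  segFamily⁺ 3≤a with bool (G (vtx 1) (vtx 2))
  ... | inj₁ g = family (seg 1 1 ∷ seg 0 0 ∷ segs)
    ((diag ∷ all-segs (λ s eq → strict-≉-spanning s (diag-spanning 1) (≐-sym eq))) ∷
      all-segs (λ s eq → strict-≉-spanning s (diag-spanning 0) (≐-sym eq)) ∷ segs-distinct)
    (s≤s (s≤s (≤-reflexive (sym segs-length))))
    where
    1≤a = ≤-trans (s≤s z≤n) 3≤a
    2≤a = ≤-trans (s≤s (s≤s z≤n)) 3≤a
    diag : ¬ seg 1 1 ≐ seg 0 0
    diag eq = contra (subst₂ (Pattern.Q (segment 1 1)) (pos-vtx 1≤a) (pos-vtx 2≤a)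
      (transferE {segment 0 0} {segment 1 1} {seg-walks 0 0} {seg-walks 1 1} (≐-sym eq) g (vtx∈ 1≤a) (vtx∈ 2≤a)
        (inj₂ (pos+ 1≤a (s≤s z≤n) , pos+ 2≤a (s≤s z≤n)))))
      where
      pos+ : ∀ {k} → k ≤ a → 0 < k → pos (vtx k) ≡ 0 ⊎ 0 < pos (vtx k)
      pos+ k≤a 0<k = inj₂ (subst (0 <_) (sym (pos-vtx k≤a)) 0<k)
      contra : ¬ Pattern.Q (segment 1 1) 1 2
      contra (inj₁ (_ , s≤s ()))
      contra (inj₂ (inj₂ (s≤s ()) , _))
  ... | inj₂ ¬g = family (holeSub h ∷ seg 0 0 ∷ segs)
    ((hole-≉-spanning h (diag-spanning 0) ∷ all-segs (λ _ → hole-≉-seg h)) ∷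
      all-segs (λ s eq → strict-≉-spanning s (diag-spanning 0) (≐-sym eq)) ∷ segs-distinct)
    (s≤s (s≤s (≤-reflexive (sym segs-length))))
    where
    2≤a = ≤-trans (s≤s (s≤s z≤n)) 3≤a
    anchor : ∃ λ u → G u (vtx 2) ≡ true × W u ≡ true × (pos u ≤ 0 ⊎ 3 < pos u)
    anchor with lower o (vtx∈ 2≤a) (pos-vtx 2≤a)
    ... | u , e , Wu , u≤1 with m≤n⇒m<n∨m≡n u≤1
    ... | inj₁ (s≤s u≤0) = u , e , Wu , inj₁ u≤0
    ... | inj₂ u≡1 = true≢false (subst (λ z → G z (vtx 2) ≡ true) (pos-vtx-at o Wu u≡1) e) ¬g
    h : Hole 0 2 3
    h = record { s<t = ≤-refl ; t<e = ≤-refl ; e≤a = 3≤a ; anchor = anchor }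

  module _ {c : Fin n} (Wc : W c ≡ true) where
    private
      p = pos c
      q = suc a ∸ p

      p≤ : p ≤ suc a
      p≤ = m≤n⇒m≤1+n (pos≤ Wc)

      Around : ℕ × ℕ → Set
      Around (i , j) = Strict (i , j) × (j < p ⊎ p ≤ i)

      shift : ℕ × ℕ → ℕ × ℕ
      shift (i , j) = p + i , p + j

      indices : List (ℕ × ℕ)
      indices = tri p ++ map shift (tri q)

      around : All Around indices
      around = All.++⁺
        (All.map (λ (i<j , j<p) → (i<j , ≤-trans (<⇒≤ j<p) (pos≤ Wc)) , inj₁ j<p) (tri-bounds p))
        (All.map⁺ (All.map (λ {(i , j)} (i<j , j<q) → (+-monoʳ-< p i<j ,
             s≤s⁻¹ (≤-trans (+-monoʳ-< p j<q) (≤-reflexive (m+[n∸m]≡n p≤)))) , inj₂ (m≤m+n p i)) (tri-bounds q)))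

      unique : Unique indices
      unique = Unique.++⁺ (tri-unique p)
        (Unique.map⁺ (λ {x} {y} eq → cong₂ _,_ (+-cancelˡ-≡ p (proj₁ x) (proj₁ y) (cong proj₁ eq))
                                               (+-cancelˡ-≡ p (proj₂ x) (proj₂ y) (cong proj₂ eq))) (tri-unique q))
        λ (∈l , ∈r) → case Mem.∈-map⁻ shift ∈r of λ { ((i , j) , _ , refl) →
          <-irrefl refl (≤-trans (proj₂ (All.lookup (tri-bounds p) ∈l)) (m≤m+n p j)) }

      throughOf : ∀ {ij} → Around ij → Through W r c
      throughOf {i , j} (_ , inj₁ j<p) = seg i j , Wc , inj₂ j<p
      throughOf {i , j} (_ , inj₂ p≤i) = seg i j , Wc , inj₁ p≤i

      proj-throughOf : ∀ {ij} (v : Around ij) → proj₁ (throughOf v) ≡ seg (proj₁ ij) (proj₂ ij)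
      proj-throughOf (_ , inj₁ _) = refl
      proj-throughOf (_ , inj₂ _) = refl

    -- A proper segment misses `c` exactly when i < p ≤ j. So both indices are below `p` or both are
    -- among the `q` numbers from `p` to `a`; the spanning `seg 0 0` is counted by the `suc`.
    throughFamily : ∀ {N} → Family W r N → FamilyThrough W r c N (suc (triN p + triN q))
    throughFamily (family xs d N≤) = through xs d N≤
      ((seg 0 0 , diag-spanning 0 Wc) ∷ All.reduce throughOf around)
      (All-reduce throughOf (λ v eq → strict-≉-spanning (proj₁ v) (diag-spanning 0)
          (≐-sym (subst (seg 0 0 ≐_) (proj-throughOf v) eq))) around ∷
        distinct-reduce throughOf (λ v w eq → seg-injective (proj₁ v) (proj₁ w)
          (subst₂ _≐_ (proj-throughOf v) (proj-throughOf w) eq)) around unique)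
      (s≤s (≤-reflexive (begin
        triN p + triN q                          ≡⟨ cong₂ _+_ (length-tri p) (length-tri q) ⟨
        length (tri p) + length (tri q)          ≡⟨ cong (length (tri p) +_) (length-map shift (tri q)) ⟨
        length (tri p) + length (map shift (tri q)) ≡⟨ length-++ (tri p) ⟨
        length indices                           ≡⟨ length-reduce throughOf around ⟨
        length (All.reduce throughOf around)     ∎)))
      where open ≡-Reasoning

-- Gaps in the ordering, Hamiltonian cycles and chords

module CycleFamilies {n : ℕ} (G : Graph n) (G-sym : ∀ i j → G i j ≡ G j i) where
 open Subgraphs G
 open Connectivity G G-sym
 module _ {W : VS n} {r : Fin n} {a : ℕ} (o : Ordering (λ _ → false) W r a) (Wr : W r ≡ true) where
  open Ordering o
  open FromOrdering G G-sym
  open Build o Wr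
  open Families G G-sym

  module Gap (conn : Connected (W ∖ r) (vtx a)) {g : ℕ} (g< : 2 + g ≤ a)
             (gap : G (vtx (suc g)) (vtx (2 + g)) ≡ false) where
    private
      b = a ∸ (2 + g)

      1+g≤a : suc g ≤ a
      1+g≤a = ≤-trans (n≤1+n (suc g)) g<

      diag : ∀ {i} → i < a → ConnSub W r
      diag {i} _ = seg i i

      -- Otherwise vtx (i+1), …, vtx j would have no neighbour in W ∖ r outside this interval.
      diag-< : ∀ {i j} → i < j → j < a → ¬ seg i i ≐ seg j j
      diag-< {i} {j} i<j j<a eq = separate (conn T {vtx j} Tvj T⊆ ¬Ta)
        where
        T : VS n
        T w = W w ∧ does (i <? pos w) ∧ does (pos w ≤? j)
        T⁻ : ∀ {w} → T w ≡ true → W w ≡ true × i < pos w × pos w ≤ j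
        T⁻ {w} p = let Ww , q = ∧⁻ {W w} p ; q₁ , q₂ = ∧⁻ {does (i <? pos w)} q in
          Ww , does⁻ (i <? pos w) q₁ , does⁻ (pos w ≤? j) q₂
        T⁺ : ∀ {w} → W w ≡ true → i < pos w → pos w ≤ j → T w ≡ true
        T⁺ {w} Ww p q = ∧⁺ Ww (∧⁺ (does⁺ (i <? pos w) p) (does⁺ (pos w ≤? j) q))
        j≤a = <⇒≤ j<a
        Tvj : T (vtx j) ≡ true
        Tvj = T⁺ (vtx∈ j≤a) (subst (i <_) (sym (pos-vtx j≤a)) i<j) (≤-reflexive (pos-vtx j≤a))
        T⊆ : ∀ {x} → T x ≡ true → (W ∖ r) x ≡ true
        T⊆ p = let Wx , i<x , _ = T⁻ p in ∖⁺ {S = W} Wx λ { refl → case subst (i <_) pos-r i<x of λ () }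
        ¬Ta : T (vtx a) ≡ false
        ¬Ta = ¬true⇒false λ p → <-irrefl refl (≤-trans j<a
          (subst (_≤ j) (pos-vtx ≤-refl) (proj₂ (proj₂ (T⁻ p)))))
        tr : ∀ {u w} → G u w ≡ true → W u ≡ true → W w ≡ true →
             Pattern.Q (segment i i) (pos u) (pos w) → Pattern.Q (segment j j) (pos u) (pos w)
        tr = transferE {segment i i} {segment j j} {seg-walks i i} {seg-walks j j} eq
        tr′ : ∀ {u w} → G u w ≡ true → W u ≡ true → W w ≡ true →
             Pattern.Q (segment j j) (pos u) (pos w) → Pattern.Q (segment i i) (pos u) (pos w)
        tr′ = transferE {segment j j} {segment i i} {seg-walks j j} {seg-walks i i} (≐-sym eq)
        separate : Leaves (W ∖ r) T → ⊥
        separate (u , w , Tu , W∖r-w , ¬Tw , e) with T⁻ Tu | ∖⁻ {S = W} W∖r-w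
        ... | Wu , i<u , u≤j | Ww , w≢r with pos w ≤? i
        ... | yes w≤i with tr′ e Wu Ww (inj₁ (u≤j , ≤-trans w≤i (<⇒≤ i<j)))
        ... | inj₁ (u≤i , _) = <-irrefl refl (≤-trans i<u u≤i)
        ... | inj₂ (_ , inj₁ w≡0) = w≢r (trans (pos-vtx-at o Ww w≡0) vtx-0)
        ... | inj₂ (_ , inj₂ i<w) = <-irrefl refl (≤-trans i<w w≤i)
        separate (u , w , Tu , W∖r-w , ¬Tw , e) | Wu , i<u , u≤j | Ww , w≢r | no w≰i
          with tr e Wu Ww (inj₂ (inj₂ i<u , inj₂ (≰⇒> w≰i)))
        ... | inj₁ (_ , w≤j) = true≢false (T⁺ Ww (≰⇒> w≰i) w≤j) ¬Tw
        ... | inj₂ (inj₁ u≡0 , _) = case subst (i <_) u≡0 i<u of λ ()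
        ... | inj₂ (inj₂ j<u , _) = <-irrefl refl (≤-trans j<u u≤j)

      diag-injective : ∀ {i j} (v : i < a) (w : j < a) → diag v ≐ diag w → i ≡ j
      diag-injective {i} {j} v w eq with <-cmp i j
      ... | tri< i<j _ _ = ⊥-elim (diag-< i<j w eq)
      ... | tri≈ _ i≡j _ = i≡j
      ... | tri> _ _ j<i = ⊥-elim (diag-< j<i v (≐-sym eq))

      ValidHole : ℕ × ℕ × ℕ → Set
      ValidHole (s , t , e) = Hole s t e

      holeOf : ∀ {ste} → ValidHole ste → ConnSub W r
      holeOf = holeSub

      -- The two vertices at the gap are not adjacent. So the upper one has a low neighbour at a
      -- position at most `g` and may be kept without the lower one; likewise the lower one has a
      -- high neighbour that is `r` or lies beyond `2 + g`. The omitted stretch on the far side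
      -- varies in length: `b` choices above the gap, `g` below it.
      above : ℕ → ℕ × ℕ × ℕ
      above d = g , 2 + g , 3 + g + d

      below : ℕ → ℕ × ℕ × ℕ
      below s = s , 1 + g , 2 + g

      aboveHole : ∀ {d} → d < b → ValidHole (above d)
      aboveHole {d} d<b = record { s<t = ≤-refl ; t<e = s≤s (m≤m+n (2 + g) d)
        ; e≤a = ≤-trans (≤-reflexive (sym (+-suc (2 + g) d))) (≤-trans (+-monoʳ-≤ (2 + g) d<b) (≤-reflexive (m+[n∸m]≡n g<)))
        ; anchor = anchor }
        where
        anchor : ∃ λ u → G u (vtx (2 + g)) ≡ true × W u ≡ true × (pos u ≤ g ⊎ 3 + g + d < pos u)
        anchor with lower o (vtx∈ g<) (pos-vtx g<)
        ... | u , e , Wu , u≤ with m≤n⇒m<n∨m≡n u≤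
        ... | inj₁ (s≤s u≤g) = u , e , Wu , inj₁ u≤g
        ... | inj₂ u≡ = true≢false (subst (λ z → G z (vtx (2 + g)) ≡ true) (pos-vtx-at o Wu u≡) e) gap

      belowHole : ∀ {s} → s < g → ValidHole (below s)
      belowHole {s} s<g = record { s<t = s≤s s<g ; t<e = ≤-refl ; e≤a = g< ; anchor = anchor }
        where
        anchor : ∃ λ u → G u (vtx (1 + g)) ≡ true × W u ≡ true × (pos u ≤ s ⊎ 2 + g < pos u)
        anchor with high (vtx∈ 1+g≤a) (pos-vtx 1+g≤a)
        ... | u , e , Wu , inj₁ u≡0 = u , e , Wu , inj₁ (≤-trans (≤-reflexive u≡0) z≤n)
        ... | u , e , Wu , inj₂ g<u with m≤n⇒m<n∨m≡n g<u
        ... | inj₁ u> = u , e , Wu , inj₂ u>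
        ... | inj₂ u≡ = true≢false (subst (λ z → G z (vtx (1 + g)) ≡ true) (pos-vtx-at o Wu (sym u≡)) e)
                          (trans (G-sym _ _) gap)

      holeIndices : List (ℕ × ℕ × ℕ)
      holeIndices = map above (upTo b) ++ map below (upTo g)

      holes-valid : All ValidHole holeIndices
      holes-valid = All.++⁺ (All.map⁺ (All.map aboveHole (upTo-< b))) (All.map⁺ (All.map belowHole (upTo-< g)))

      holes-unique : Unique holeIndices
      holes-unique = Unique.++⁺
        (Unique.map⁺ (λ {x} {y} eq → +-cancelˡ-≡ (3 + g) x y (cong (proj₂ ∘ proj₂) eq)) (Unique.upTo⁺ b))
        (Unique.map⁺ (cong proj₁) (Unique.upTo⁺ g))
        λ (∈l , ∈r) → case Mem.∈-map⁻ above ∈l , Mem.∈-map⁻ below ∈r of λ where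
          ((_ , _ , eq) , (_ , _ , eq′)) → 1+n≢n (cong (proj₁ ∘ proj₂) (trans (sym eq) eq′))

      holes diags : List (ConnSub W r)
      holes = All.reduce holeOf holes-valid
      diags = All.reduce diag (upTo-< a)

    -- The summands are the b + g = a - 2 holes, the spanning segments `seg i i` for i < a, which
    -- `conn` keeps apart, and the C(a+1, 2) proper segments.
    gapFamily : Family W r (a ∸ 2 + (a + triN (suc a)))
    gapFamily = family (holes ++ diags ++ segs o Wr)
      (AllPairs.++⁺ (distinct-reduce holeOf hole-injective holes-valid holes-unique)
        (AllPairs.++⁺ (distinct-reduce diag diag-injective (upTo-< a) (Unique.upTo⁺ a)) (segs-distinct o Wr)
          (All-reduce diag (λ _ → all-segs o Wr (λ s eq → strict-≉-spanning s (diag-spanning _) (≐-sym eq))) (upTo-< a)))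
        (All-reduce holeOf (λ h → All.++⁺ (All-reduce diag (λ _ → hole-≉-seg h) (upTo-< a))
                                           (all-segs o Wr (λ _ → hole-≉-seg h))) holes-valid))
      (≤-reflexive (sym (begin
        length (holes ++ diags ++ segs o Wr)               ≡⟨ length-++ holes ⟩
        length holes + length (diags ++ segs o Wr)         ≡⟨ cong₂ _+_ holes-length (length-++ diags) ⟩
        a ∸ 2 + (length diags + length (segs o Wr))        ≡⟨ cong (a ∸ 2 +_) (cong₂ _+_
             (trans (length-reduce diag (upTo-< a)) (length-upTo a)) (segs-length o Wr)) ⟩
        a ∸ 2 + (a + triN (suc a))                         ∎)))
      where
      open ≡-Reasoning
      holes-length : length holes ≡ a ∸ 2
      holes-length = begin
        length holes                                              ≡⟨ length-reduce holeOf holes-valid ⟩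
        length (map above (upTo b) ++ map below (upTo g))         ≡⟨ length-++ (map above (upTo b)) ⟩
        length (map above (upTo b)) + length (map below (upTo g)) ≡⟨ cong₂ _+_ (length-map above (upTo b)) (length-map below (upTo g)) ⟩
        length (upTo b) + length (upTo g)                         ≡⟨ cong₂ _+_ (length-upTo b) (length-upTo g) ⟩
        b + g                                                     ≡⟨ cong (_+ g) (∸-+-assoc a 2 g) ⟨
        a ∸ 2 ∸ g + g                                             ≡⟨ m∸n+n≡m (s≤s⁻¹ (s≤s⁻¹ (≤-trans g< (≤-reflexive (sym (m+[n∸m]≡n (≤-trans (s≤s (s≤s z≤n)) g<))))))) ⟩
        a ∸ 2                                                     ∎

  module Hamiltonian (2≤a : 2 ≤ a) (path : ∀ {k} → k < a → G (vtx k) (vtx (suc k)) ≡ true)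
                     (closing : G (vtx a) (vtx 0) ≡ true) where

    Forward : ℕ → ℕ → ℕ → Set
    Forward t k l = (l ≡ suc k × k ≢ t) ⊎ (k ≡ a × l ≡ 0 × a ≢ t)

    Forward? : ∀ t k l → Dec (Forward t k l)
    Forward? t k l = ((l ≟ suc k) ×-dec ¬? (k ≟ t)) ⊎-dec ((k ≟ a) ×-dec (l ≟ 0) ×-dec ¬? (a ≟ t))

    -- The cycle vtx 0, …, vtx a with the edge leaving vtx t removed (nothing is removed when a < t).
    cycle : ℕ → Pattern
    cycle t = record
      { P = λ _ → ⊤ ; P? = λ _ → yes tt
      ; Q = λ k l → Forward t k l ⊎ Forward t l k
      ; Q? = λ k l → Forward? t k l ⊎-dec Forward? t l k
      ; Q⊆ = λ _ → tt , tt
      ; Q-sym = λ { (inj₁ p) → inj₂ p ; (inj₂ p) → inj₁ p }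
      ; P0 = tt }

    -- Positions up to `t` are reached upwards from `vtx 0`, those beyond `t` downwards after the
    -- closing edge; neither route uses the edge leaving `vtx t`.
    cycle-walks : ∀ t → Walks (cycle t)
    cycle-walks t {w} Ww _ = subst (Star _ r) (vtx-pos Ww) (to (pos w) (pos≤ Ww))
      where
      Q = Pattern.Q (cycle t)
      edge-at : ∀ {k l} → k ≤ a → l ≤ a → G (vtx k) (vtx l) ≡ true → Q k l → E Q (vtx k) (vtx l)
      edge-at k≤a l≤a e q = e , vtx∈ k≤a , vtx∈ l≤a , subst₂ Q (sym (pos-vtx k≤a)) (sym (pos-vtx l≤a)) q
      start : Star (E Q) r (vtx 0)
      start = subst (Star _ r) (sym vtx-0) ε
      up : ∀ k → k ≤ a → k ≤ t → Star (E Q) r (vtx k)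
      up zero    _   _   = start
      up (suc k) k<a k<t = up k (<⇒≤ k<a) (<⇒≤ k<t) ◅◅
        (edge-at (<⇒≤ k<a) k<a (path k<a) (inj₁ (inj₁ (refl , <⇒≢ k<t))) ◅ ε)
      down : ∀ m k → m + k ≡ a → t < k → Star (E Q) r (vtx k)
      down zero    k refl t<k = start ◅◅ (edge-at z≤n ≤-refl (flip-edge closing) (inj₂ (inj₂ (refl , refl , >⇒≢ t<k))) ◅ ε)
      down (suc m) k refl t<k = down m (suc k) (+-suc m k) (m≤n⇒m≤1+n t<k) ◅◅
        (edge-at k<a (<⇒≤ k<a) (flip-edge (path k<a)) (inj₂ (inj₁ (refl , >⇒≢ t<k))) ◅ ε)
        where k<a = s≤s (m≤n+m k m)
      to : ∀ k → k ≤ a → Star (E Q) r (vtx k)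
      to k k≤a with ≤-<-connex k t
      ... | inj₁ k≤t = up k k≤a k≤t
      ... | inj₂ t<k = down (a ∸ k) k (m∸n+n≡m k≤a) t<k

    ham : ∀ {t} → t < 2 + a → ConnSub W r
    ham {t} _ = realise (cycle t) (cycle-walks t)

    ham-spanning : ∀ {t} (v : t < 2 + a) → Spanning (ham v)
    ham-spanning v Ww = Ww , tt

    -- The edge leaving `vtx t` is in the second subgraph but not in the first. With `2 ≤ a` the
    -- cycle has at least three vertices, so this edge does not come back as another arc in the
    -- opposite direction.
    ham-≤ : ∀ {t t′} (v : t < 2 + a) (v′ : t′ < 2 + a) → ham v ≐ ham v′ → ¬ t < t′
    ham-≤ {t} {t′} v v′ eq t<t′ with m≤n⇒m<n∨m≡n (s≤s⁻¹ (≤-trans t<t′ (s≤s⁻¹ v′)))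
    ... | inj₁ t<a = absent (subst₂ (Pattern.Q (cycle t)) (pos-vtx (<⇒≤ t<a)) (pos-vtx t<a)
            (transferE {cycle t′} {cycle t} {cycle-walks t′} {cycle-walks t} (≐-sym eq) (path t<a) (vtx∈ (<⇒≤ t<a)) (vtx∈ t<a)
              (subst₂ (Pattern.Q (cycle t′)) (sym (pos-vtx (<⇒≤ t<a))) (sym (pos-vtx t<a)) (inj₁ (inj₁ (refl , <⇒≢ t<t′))))))
      where
      absent : ¬ Pattern.Q (cycle t) t (suc t)
      absent (inj₁ (inj₁ (_ , t≢t))) = t≢t refl
      absent (inj₂ (inj₁ (eq , _))) = <-irrefl eq (s≤s (n≤1+n t))
      absent (inj₂ (inj₂ (1+t≡a , refl , _))) = <-irrefl 1+t≡a 2≤a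
    ... | inj₂ refl = absent (subst₂ (Pattern.Q (cycle t)) (pos-vtx ≤-refl) (pos-vtx z≤n)
            (transferE {cycle t′} {cycle t} {cycle-walks t′} {cycle-walks t} (≐-sym eq) closing (vtx∈ ≤-refl) (vtx∈ z≤n)
              (subst₂ (Pattern.Q (cycle t′)) (sym (pos-vtx ≤-refl)) (sym (pos-vtx z≤n)) (inj₁ (inj₂ (refl , refl , <⇒≢ t<t′))))))
      where
      absent : ¬ Pattern.Q (cycle a) a 0
      absent (inj₁ (inj₂ (_ , _ , a≢a))) = a≢a refl
      absent (inj₂ (inj₁ (a≡1 , _))) = <-irrefl (sym a≡1) 2≤a
      absent (inj₂ (inj₂ (_ , _ , a≢a))) = a≢a refl

    ham-injective : ∀ {t t′} (v : t < 2 + a) (v′ : t′ < 2 + a) → ham v ≐ ham v′ → t ≡ t′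
    ham-injective {t} {t′} v v′ eq = ≤-antisym (≮⇒≥ (ham-≤ v′ v (≐-sym eq))) (≮⇒≥ (ham-≤ v v′ eq))

    Consecutive : ℕ → ℕ → Set
    Consecutive k l = l ≡ suc k ⊎ (k ≡ a × l ≡ 0)

    -- The a + 1 Hamiltonian paths and the cycle itself give `2 + a` spanning subgraphs. The chord
    -- makes `seg 0 0`, which has all edges inside `W`, differ from each of them.
    chordFamily : ∀ {u w} → W u ≡ true → W w ≡ true → G u w ≡ true →
      ¬ Consecutive (pos u) (pos w) → ¬ Consecutive (pos w) (pos u) → Family W r (3 + a + triN (suc a))
    chordFamily {u} {w} Wu Ww e ¬uw ¬wu = family (seg 0 0 ∷ hams ++ segs o Wr)
      (All.++⁺ (All-reduce ham full-≉ (upTo-< (2 + a))) (all-segs o Wr (λ s eq → strict-≉-spanning s (diag-spanning 0) (≐-sym eq))) ∷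
        AllPairs.++⁺ (distinct-reduce ham ham-injective (upTo-< (2 + a)) (Unique.upTo⁺ (2 + a))) (segs-distinct o Wr)
          (All-reduce ham (λ v → all-segs o Wr (λ s eq → strict-≉-spanning s (ham-spanning v) (≐-sym eq))) (upTo-< (2 + a))))
      (s≤s (≤-reflexive (sym (trans (length-++ hams) (cong₂ _+_
        (trans (length-reduce ham (upTo-< (2 + a))) (length-upTo (2 + a))) (segs-length o Wr))))))
      where
      hams : List (ConnSub W r)
      hams = All.reduce ham (upTo-< (2 + a))
      full-≉ : ∀ {t} (v : t < 2 + a) → ¬ seg 0 0 ≐ ham v
      full-≉ {t} v eq with transferE {segment 0 0} {cycle t} {seg-walks 0 0} {cycle-walks t} eq e Wu Ww
                             (inj₂ (zero-or-pos (pos u) , zero-or-pos (pos w)))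
        where
        zero-or-pos : ∀ k → k ≡ 0 ⊎ 0 < k
        zero-or-pos zero    = inj₁ refl
        zero-or-pos (suc k) = inj₂ (s≤s z≤n)
      ... | inj₁ (inj₁ (p , _)) = ¬uw (inj₁ p)
      ... | inj₁ (inj₂ (p , q , _)) = ¬uw (inj₂ (p , q))
      ... | inj₂ (inj₁ (p , _)) = ¬wu (inj₁ p)
      ... | inj₂ (inj₂ (p , q , _)) = ¬wu (inj₂ (p , q))

  record IsCycle : Set where
    field
      path    : ∀ {k} → k < a → G (vtx k) (vtx (suc k)) ≡ true
      closing : G (vtx a) (vtx 0) ≡ true
      only    : ∀ {u w} → W u ≡ true → W w ≡ true → G u w ≡ true →
                (pos w ≡ suc (pos u) ⊎ (pos u ≡ a × pos w ≡ 0)) ⊎ (pos u ≡ suc (pos w) ⊎ (pos w ≡ a × pos u ≡ 0))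

  -- In a cycle on a + 1 vertices each vertex lies in 2 + a + C(a+1, 2) connected subgraphs; the
  -- family has one more. In the presence of a gap, the a - 2 holes replace the missing Hamiltonian
  -- cycle, and `5 ≤ a` makes them at least 3.
  cycle-or-many : 5 ≤ a → Connected (W ∖ r) (vtx a) → IsCycle ⊎ Family W r (3 + a + triN (suc a))
  cycle-or-many 5≤a conn with anyUpTo? (λ g → G (vtx (suc g)) (vtx (2 + g)) Bool.≟ false) (a ∸ 1)
  ... | yes (g , g< , gap) = inj₂ (Family-weaken enough (Gap.gapFamily conn
          (≤-trans (s≤s g<) (≤-reflexive (m+[n∸m]≡n (≤-trans (s≤s z≤n) 5≤a)))) gap))
    where
    enough : 3 + a + triN (suc a) ≤ a ∸ 2 + (a + triN (suc a))
    enough = ≤-trans (≤-reflexive (+-assoc 3 a (triN (suc a)))) (+-monoˡ-≤ (a + triN (suc a)) (∸-monoˡ-≤ 2 5≤a))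
  ... | no noGap = decide
    where
    1≤a = ≤-trans (s≤s z≤n) 5≤a
    path : ∀ {k} → k < a → G (vtx k) (vtx (suc k)) ≡ true
    -- The two cycle edges at `r` always exist: the low neighbour of `vtx 1` and the high neighbour
    -- of `vtx a` can only be `r`. So gaps are searched only between the positions 1, ..., a.
    path {zero} 0<a with lower o (vtx∈ 0<a) (pos-vtx 0<a)
    ... | u , e , Wu , u≤0 = subst (λ z → G z (vtx 1) ≡ true) (pos-vtx-at o Wu (n≤0⇒n≡0 u≤0)) e
    path {suc k} k<a with bool (G (vtx (suc k)) (vtx (2 + k)))
    ... | inj₁ e = e
    ... | inj₂ ¬e = ⊥-elim (noGap (k , ∸-monoˡ-≤ 1 k<a , ¬e))
    closing : G (vtx a) (vtx 0) ≡ true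
    closing with high (vtx∈ ≤-refl) (trans (pos-vtx ≤-refl) (sym (m+[n∸m]≡n 1≤a)))
    ... | u , e , Wu , inj₁ u≡0 = flip-edge (subst (λ z → G z (vtx a) ≡ true) (pos-vtx-at o Wu u≡0) e)
    ... | u , e , Wu , inj₂ a<u = ⊥-elim (<-irrefl refl
            (≤-trans (subst (_< pos u) (m+[n∸m]≡n 1≤a) a<u) (pos≤ Wu)))
    open Hamiltonian (≤-trans (s≤s (s≤s z≤n)) 5≤a) path closing
    Consecutive? : ∀ k l → Dec (Consecutive k l)
    Consecutive? k l = (l ≟ suc k) ⊎-dec ((k ≟ a) ×-dec (l ≟ 0))
    decide : IsCycle ⊎ Family W r (3 + a + triN (suc a))
    decide with Fin.any? (λ u → Fin.any? λ w → (W u Bool.≟ true) ×-dec (W w Bool.≟ true) ×-dec (G u w Bool.≟ true) ×-dec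
                    ¬? (Consecutive? (pos u) (pos w)) ×-dec ¬? (Consecutive? (pos w) (pos u)))
    ... | yes (u , w , Wu , Ww , e , ¬uw , ¬wu) = inj₂ (chordFamily Wu Ww e ¬uw ¬wu)
    ... | no none = inj₁ (record { path = path ; closing = closing ; only = only })
      where
      only : ∀ {u w} → W u ≡ true → W w ≡ true → G u w ≡ true → Consecutive (pos u) (pos w) ⊎ Consecutive (pos w) (pos u)
      only {u} {w} Wu Ww e with Consecutive? (pos u) (pos w) | Consecutive? (pos w) (pos u)
      ... | yes p | _     = inj₁ p
      ... | no _  | yes p = inj₂ p
      ... | no p  | no q  = ⊥-elim (none (u , w , Wu , Ww , e , p , q))

-- Numerical estimates

triN-+ : ∀ m k → triN (m + k) ≡ triN m + triN k + m * k
triN-+ zero    k = sym (+-identityʳ (triN k))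
triN-+ (suc m) k = begin
  m + k + triN (m + k)                   ≡⟨ cong (m + k +_) (triN-+ m k) ⟩
  m + k + (triN m + triN k + m * k)      ≡⟨ rearrange m k (triN m) (triN k) ⟩
  m + triN m + triN k + (k + m * k)      ∎
  where
  open ≡-Reasoning
  rearrange : ∀ m k s t → m + k + (s + t + m * k) ≡ m + s + t + (k + m * k)
  rearrange = solve-∀

-- Equality holds at p = 1 and p = 2.
triN-pred : ∀ p → p ≤ suc (triN p)
triN-pred zero          = z≤n
triN-pred (suc zero)    = s≤s z≤n
triN-pred (suc (suc p)) = s≤s (s≤s (m≤m+n p _))

-- The steeper linear bound, with equality at p = 2 and p = 3; it serves the tight case of
-- `block-bound⁺`.
triN-double : ∀ p → 2 * p ≤ 3 + triN p
triN-double 0 = z≤n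
triN-double 1 = s≤s (s≤s z≤n)
triN-double 2 = ≤-refl
triN-double (suc (suc (suc p))) = ≤-trans (m≤m+n _ (p + triN p)) (≤-reflexive (expand p (triN p)))
  where
  expand : ∀ p s → 2 * (3 + p) + (p + s) ≡ 3 + (2 + p + (1 + p + (p + s)))
  expand = solve-∀

triN-≥3 : ∀ {x} → 3 ≤ x → x ≤ triN x
triN-≥3 (s≤s (s≤s (s≤s {n = p} z≤n))) = ≤-trans (m≤m+n _ (p + (p + triN p))) (≤-reflexive (expand p (triN p)))
  where
  expand : ∀ p s → 3 + p + (p + (p + s)) ≡ 2 + p + (1 + p + (p + s))
  expand = solve-∀

triN-≥4 : ∀ {y} → 4 ≤ y → 2 + y ≤ triN y
triN-≥4 (s≤s {n = y} 3≤y) = begin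
  3 + y       ≡⟨ +-comm 3 y ⟩
  y + 3       ≤⟨ +-monoʳ-≤ y (≤-trans 3≤y (triN-≥3 3≤y)) ⟩
  y + triN y  ∎
  where open ≤-Reasoning

private
  large-summand : ∀ {x y} → 5 ≤ x + y → 3 ≤ x ⊎ 3 ≤ y
  large-summand {x} {y} h with 3 ≤? x | 3 ≤? y
  ... | yes p | _     = inj₁ p
  ... | no _  | yes q = inj₂ q
  ... | no p  | no q  = ⊥-elim (<-irrefl refl (≤-trans h (+-mono-≤ (s≤s⁻¹ (≰⇒> p)) (s≤s⁻¹ (≰⇒> q)))))

  product-expand : ∀ x y s t → suc (x + s) + suc (x + s) * (y + t) ≡ 1 + (x * t + s * y) + s * t + (x + y + (s + t + x * y))
  product-expand = solve-∀

  triN-suc-+ : ∀ x y → triN (suc (x + y)) ≡ x + y + (triN x + triN y + x * y)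
  triN-suc-+ x y = cong (x + y +_) (triN-+ x y)

-- The right side is (1 + C(x+1, 2)) (1 + C(y+1, 2)). It exceeds C(x+y+1, 2) by 1 + x C(y, 2) + y
-- C(x, 2) + C(x, 2) C(y, 2), and one of x, y is at least 3.
product-bound : ∀ {x y} → 1 ≤ x → 1 ≤ y → 6 ≤ x + y →
  3 + triN (suc (x + y)) ≤ suc (triN (suc x)) + suc (triN (suc x)) * triN (suc y)
product-bound {x} {y} 1≤x 1≤y 6≤ = begin
  3 + triN (suc (x + y))                                 ≡⟨ cong (3 +_) (triN-suc-+ x y) ⟩
  3 + (x + y + (triN x + triN y + x * y))                ≤⟨ +-monoˡ-≤ _ (s≤s two) ⟩
  1 + (x * triN y + triN x * y) + (x + y + (triN x + triN y + x * y))
                                                         ≤⟨ +-monoˡ-≤ (x + y + (triN x + triN y + x * y)) (m≤m+n (1 + (x * triN y + triN x * y)) (triN x * triN y)) ⟩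
  1 + (x * triN y + triN x * y) + triN x * triN y + (x + y + (triN x + triN y + x * y))
                                                         ≡⟨ product-expand x y (triN x) (triN y) ⟨
  suc (triN (suc x)) + suc (triN (suc x)) * triN (suc y) ∎
  where
  open ≤-Reasoning
  two : 2 ≤ x * triN y + triN x * y
  two with large-summand {x} {y} (≤-trans (n≤1+n 5) 6≤)
  ... | inj₁ 3≤x = ≤-trans (s≤s (s≤s z≤n)) (≤-trans (*-mono-≤ (≤-trans 3≤x (triN-≥3 3≤x)) 1≤y) (m≤n+m (triN x * y) (x * triN y)))
  ... | inj₂ 3≤y = ≤-trans (s≤s (s≤s z≤n)) (≤-trans (*-mono-≤ 1≤x (≤-trans 3≤y (triN-≥3 3≤y))) (m≤m+n (x * triN y) (triN x * y)))

-- The left side is one more than the count at a vertex of a cycle on x + y + 1 vertices. By the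
-- expansion used for `product-bound` it remains to see that x C(y, 2) + y C(x, 2) is at least 2 + x
-- + y.
product-bound₂ : ∀ {x y} → 2 ≤ x → 2 ≤ y → 5 ≤ x + y →
  3 + (x + y) + triN (suc (x + y)) ≤ suc (triN (suc x)) + suc (triN (suc x)) * triN (suc y)
product-bound₂ {x} {y} 2≤x 2≤y 5≤ = begin
  3 + (x + y) + triN (suc (x + y))                       ≡⟨ cong (3 + (x + y) +_) (triN-suc-+ x y) ⟩
  3 + (x + y) + (x + y + (triN x + triN y + x * y))      ≤⟨ +-monoˡ-≤ _ (s≤s enough) ⟩
  1 + (x * triN y + triN x * y) + (x + y + (triN x + triN y + x * y))
                                                         ≤⟨ +-monoˡ-≤ (x + y + (triN x + triN y + x * y)) (m≤m+n (1 + (x * triN y + triN x * y)) (triN x * triN y)) ⟩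
  1 + (x * triN y + triN x * y) + triN x * triN y + (x + y + (triN x + triN y + x * y))
                                                         ≡⟨ product-expand x y (triN x) (triN y) ⟨
  suc (triN (suc x)) + suc (triN (suc x)) * triN (suc y) ∎
  where
  open ≤-Reasoning
  ≥1 : ∀ {z} → 2 ≤ z → 1 ≤ triN z
  ≥1 2≤z = s≤s⁻¹ (≤-trans 2≤z (triN-pred _))
  half : ∀ {u w} → 2 ≤ u → 3 ≤ w → 2 + u ≤ u * triN w
  half {u} {w} 2≤u 3≤w = begin
    2 + u          ≤⟨ +-monoˡ-≤ u 2≤u ⟩
    u + u          ≡⟨ trans (cong (u +_) (sym (+-identityʳ u))) (*-comm 2 u) ⟩
    u * 2          ≤⟨ *-monoʳ-≤ u (≤-trans (n≤1+n 2) (≤-trans 3≤w (triN-≥3 3≤w))) ⟩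
    u * triN w     ∎
  enough : 2 + (x + y) ≤ x * triN y + triN x * y
  enough with large-summand {x} {y} 5≤
  ... | inj₂ 3≤y = ≤-trans (≤-reflexive (sym (+-assoc 2 x y)))
        (+-mono-≤ (half 2≤x 3≤y) (≤-trans (≤-reflexive (sym (*-identityˡ y))) (*-monoˡ-≤ y (≥1 2≤x))))
  ... | inj₁ 3≤x = ≤-trans (≤-reflexive (comm x y))
        (+-mono-≤ (≤-trans (≤-reflexive (sym (*-identityʳ x))) (*-monoʳ-≤ x (≥1 2≤y)))
                  (≤-trans (half 2≤y 3≤x) (≤-reflexive (*-comm y (triN x)))))
    where
    comm : ∀ x y → 2 + (x + y) ≡ x + (2 + y)
    comm = solve-∀

-- One part is a single edge and contributes the factor 2. The summand 2 in the other factor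
-- includes the extra subgraph of `segFamily⁺`: without it y = 4 gives 22 against 23.
product-bound₁ : ∀ {y} → 4 ≤ y → 3 + (1 + y) + triN (2 + y) ≤ 2 * (2 + triN (suc y))
product-bound₁ {y} 4≤y = begin
  3 + (1 + y) + (1 + y + (y + triN y))     ≡⟨ left y (triN y) ⟩
  2 * y + triN y + 3 + (2 + y)             ≤⟨ +-monoʳ-≤ (2 * y + triN y + 3) (triN-≥4 4≤y) ⟩
  2 * y + triN y + 3 + triN y              ≤⟨ m≤m+n _ 1 ⟩
  2 * y + triN y + 3 + triN y + 1          ≡⟨ right y (triN y) ⟩
  2 * (2 + (y + triN y))                   ∎
  where
  open ≤-Reasoning
  left : ∀ y t → 3 + (1 + y) + (1 + y + (y + t)) ≡ 2 * y + t + 3 + (2 + y)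
  left = solve-∀
  right : ∀ y t → 2 * y + t + 3 + t + 1 ≡ 2 * (2 + (y + t))
  right = solve-∀

module _ {p q k : ℕ} where
  private
    m = p + q
    E = triN p + triN q

    m≤2+E : m ≤ 2 + E
    m≤2+E = ≤-trans (+-mono-≤ (triN-pred p) (triN-pred q)) (≤-reflexive (cong suc (+-suc (triN p) (triN q))))

    2m≤6+E : 2 * m ≤ 6 + E
    2m≤6+E = ≤-trans (≤-reflexive (*-distribˡ-+ 2 p q))
      (≤-trans (+-mono-≤ (triN-double p) (triN-double q)) (≤-reflexive (shuffle (triN p) (triN q))))
      where
      shuffle : ∀ s t → 3 + s + (3 + t) ≡ 6 + (s + t)
      shuffle = solve-∀

    -- Expanding C(m+k, 2) as C(m, 2) + C(k, 2) + mk cancels the quadratic terms in m and k. Here δ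
    -- counts the extra subgraph of the part that contains `v`.
    collect : ∀ δ → 2 + m * k ≤ δ + (k + E * (k + triN k)) →
      3 + triN (m + k) ≤ suc δ + triN m + suc E * triN (suc k)
    collect δ h = begin
      3 + triN (m + k)                                     ≡⟨ cong (3 +_) (triN-+ m k) ⟩
      3 + (triN m + triN k + m * k)                        ≡⟨ left (triN m) (triN k) (m * k) ⟩
      1 + triN m + triN k + (2 + m * k)                    ≤⟨ +-monoʳ-≤ (1 + triN m + triN k) h ⟩
      1 + triN m + triN k + (δ + (k + E * (k + triN k)))   ≡⟨ right δ (triN m) k (triN k) E ⟩
      suc δ + triN m + suc E * (k + triN k)                ∎
      where
      open ≤-Reasoning
      left : ∀ s t u → 3 + (s + t + u) ≡ 1 + s + t + (2 + u)
      left = solve-∀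
      right : ∀ δ s k t e → 1 + s + t + (δ + (k + e * (k + t))) ≡ suc δ + s + suc e * (k + t)
      right = solve-∀

  -- Since m ≤ 2 + E, the product mk is at most 2k + Ek. What is left, 2 + k ≤ E C(k, 2), follows
  -- from E ≥ 1 as soon as k ≥ 4.
  block-bound : 3 ≤ m → 4 ≤ k → 3 + triN (m + k) ≤ 1 + triN m + suc E * triN (suc k)
  block-bound 3≤m 4≤k = collect 0 (begin
    2 + m * k                ≤⟨ +-monoʳ-≤ 2 (*-monoˡ-≤ k m≤2+E) ⟩
    2 + (2 + E) * k          ≡⟨ left k E ⟩
    k + E * k + (2 + k)      ≤⟨ +-monoʳ-≤ (k + E * k) (≤-trans (triN-≥4 4≤k) (≤-trans (≤-reflexive (sym (*-identityˡ (triN k)))) (*-monoˡ-≤ (triN k) 1≤E))) ⟩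
    k + E * k + E * triN k   ≡⟨ right k E (triN k) ⟩
    k + E * (k + triN k)     ∎)
    where
    open ≤-Reasoning
    1≤E : 1 ≤ E
    1≤E = s≤s⁻¹ (s≤s⁻¹ (≤-trans 3≤m m≤2+E))
    left : ∀ k e → 2 + (2 + e) * k ≡ k + e * k + (2 + k)
    left = solve-∀
    right : ∀ k e t → k + e * k + e * t ≡ k + e * (k + t)
    right = solve-∀

  -- For small k the factor C(k, 2) is too weak, and the extra subgraph fills the deficit. For p = q
  -- = 3 and k = 1 both sides equal 24.
  block-bound⁺ : 1 ≤ k → k ≤ 3 → 7 ≤ m + k → 3 + triN (m + k) ≤ 2 + triN m + suc E * triN (suc k)
  block-bound⁺ 1≤k k≤3 7≤ = collect 1 (small k 1≤k k≤3 7≤)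
    where
    open ≤-Reasoning
    small : ∀ k → 1 ≤ k → k ≤ 3 → 7 ≤ m + k → 2 + m * k ≤ 1 + (k + E * (k + triN k))
    -- With `m + 4` added to both sides, the estimates `6 ≤ m` and `2 * m ≤ 6 + E` apply to separate
    -- summands. The other two cases combine a lower bound on `m` with `m ≤ 2 + E` in the same way.
    small 1 _ _ 7≤ = +-cancelˡ-≤ (m + 4) _ _ (begin
      m + 4 + (2 + m * 1)      ≡⟨ left m ⟩
      6 + 2 * m                ≤⟨ +-monoʳ-≤ 6 2m≤6+E ⟩
      6 + (6 + E)              ≤⟨ +-monoˡ-≤ (6 + E) (s≤s⁻¹ (≤-trans 7≤ (≤-reflexive (+-comm m 1)))) ⟩
      m + (6 + E)              ≡⟨ right m E ⟩
      m + 4 + (1 + (1 + E * 1)) ∎)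
      where
      left : ∀ m → m + 4 + (2 + m * 1) ≡ 6 + 2 * m
      left = solve-∀
      right : ∀ m e → m + (6 + e) ≡ m + 4 + (1 + (1 + e * 1))
      right = solve-∀
    small 2 _ _ 7≤ = +-cancelˡ-≤ (m + 3) _ _ (begin
      m + 3 + (2 + m * 2)      ≡⟨ left m ⟩
      5 + 3 * m                ≤⟨ +-mono-≤ (+-cancelʳ-≤ 2 5 m 7≤) (*-monoʳ-≤ 3 m≤2+E) ⟩
      m + 3 * (2 + E)          ≡⟨ right m E ⟩
      m + 3 + (1 + (2 + E * 3)) ∎)
      where
      left : ∀ m → m + 3 + (2 + m * 2) ≡ 5 + 3 * m
      left = solve-∀
      right : ∀ m e → m + 3 * (2 + e) ≡ m + 3 + (1 + (2 + e * 3))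
      right = solve-∀
    small 3 _ _ 7≤ = +-cancelˡ-≤ (3 * m + 8) _ _ (begin
      3 * m + 8 + (2 + m * 3)  ≡⟨ left m ⟩
      10 + 6 * m               ≤⟨ +-mono-≤ (≤-trans (m≤m+n 10 2) (*-monoʳ-≤ 3 (+-cancelʳ-≤ 3 4 m 7≤))) (*-monoʳ-≤ 6 m≤2+E) ⟩
      3 * m + 6 * (2 + E)      ≡⟨ right m E ⟩
      3 * m + 8 + (1 + (3 + E * 6)) ∎)
      where
      left : ∀ m → 3 * m + 8 + (2 + m * 3) ≡ 10 + 6 * m
      left = solve-∀
      right : ∀ m e → 3 * m + 6 * (2 + e) ≡ 3 * m + 8 + (1 + (3 + e * 6))
      right = solve-∀
    small (suc (suc (suc (suc _)))) _ (s≤s (s≤s (s≤s ()))) _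

-- The graph L

cycᵇ : ℕ → ℕ → ℕ → Bool
cycᵇ N x y = not (N ≤ᵇ x) ∧ not (N ≤ᵇ y) ∧ ((suc x ≡ᵇ y) ∨ ((x ≡ᵇ 0) ∧ (y ≡ᵇ (N ∸ 1))))

pendᵇ : ℕ → ℕ → ℕ → Bool
pendᵇ N x y = (x ≡ᵇ N) ∧ (y ≡ᵇ 0)

body : ℕ → ℕ → ℕ → Bool
body N x y = (cycᵇ N x y ∨ cycᵇ N y x) ∨ pendᵇ N x y ∨ pendᵇ N y x

-- L is defined with a local comparison of naturals. Its name is not accessible, so the Boolean terms
-- in which it occurs are named by metavariables that L-step determines.
mutual
  row : ∀ n (i j : Fin n) (w N z : ℕ) (p q r : Bool) → Bool
  row = _
  col : ∀ n (i j : Fin n) (w N y : ℕ) (p q r : Bool) → Bool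
  col = _
  mid : ∀ n (i j : Fin n) (w w′ N y z : ℕ) (p q r s : Bool) → Bool
  mid = _

  L-eq : ∀ n (i j : Fin n) → Bool
  L-eq n i j with n ∸ 1 | toℕ i | toℕ j
  ... | suc N | zero  | suc z = row n i j (suc z) N z (0 ≡ᵇ z) (suc z ≡ᵇ N) (z ≡ᵇ N)
  ... | suc N | suc y | zero  = col n i j (suc y) N y (0 ≡ᵇ y) (suc y ≡ᵇ N) (y ≡ᵇ N)
  ... | suc N | suc y | suc z = mid n i j (suc y) (suc z) N y z (suc y ≡ᵇ z) (suc z ≡ᵇ y) (y ≡ᵇ N) (z ≡ᵇ N)
  ... | N | y | z = body N y z

  L-step : ∀ n (i j : Fin n) → L n i j ≡ L-eq n i j
  L-step n i j with n ∸ 1 | toℕ i | toℕ j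
  ... | zero  | _     | _     = refl
  ... | suc N | zero  | zero  = refl
  ... | suc N | zero  | suc z with suc z
  ... | w with w ≡ᵇ N | 0 ≡ᵇ z | z ≡ᵇ N
  ... | q | p | r = refl
  L-step n i j | suc N | suc y | zero with suc y
  ... | w with w ≡ᵇ N | 0 ≡ᵇ y | y ≡ᵇ N
  ... | q | p | r = refl
  L-step n i j | suc N | suc y | suc z with suc y | suc z
  ... | w | w′ with w ≡ᵇ z | w′ ≡ᵇ y | y ≡ᵇ N | z ≡ᵇ N
  ... | p | q | r | s = refl

-- The local comparison carries the argument of `lt` as a parameter. It appears here as `w` and
-- stays fixed while `N` and `z` decrease, which makes the induction possible.
row-eq : ∀ n (i j : Fin n) w N z p q r →
  row n i j w N z p q r ≡ (not (N ≤ᵇ z) ∧ (p ∨ q) ∨ not (N ≤ᵇ z) ∧ false) ∨ (r ∧ true)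
row-eq n i j w zero    z       p q r = refl
row-eq n i j w (suc N) zero    p q r = refl
row-eq n i j w (suc zero) (suc z) p q r = refl
row-eq n i j w (suc (suc N)) (suc z) p q r = row-eq n i j w (suc N) z p q r

col-eq : ∀ n (i j : Fin n) w N y p q r →
  col n i j w N y p q r ≡ (not (N ≤ᵇ y) ∧ false ∨ not (N ≤ᵇ y) ∧ (p ∨ q)) ∨ (r ∧ true ∨ false)
col-eq n i j w zero    z       p q r = refl
col-eq n i j w (suc N) zero    p q r = refl
col-eq n i j w (suc zero) (suc z) p q r = refl
col-eq n i j w (suc (suc N)) (suc z) p q r = col-eq n i j w (suc N) z p q r

mid-eq : ∀ n (i j : Fin n) w w′ N y z p q r s →
  mid n i j w w′ N y z p q r s ≡
  (not (N ≤ᵇ y) ∧ not (N ≤ᵇ z) ∧ (p ∨ false) ∨ not (N ≤ᵇ z) ∧ not (N ≤ᵇ y) ∧ (q ∨ false))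
    ∨ (r ∧ false ∨ s ∧ false)
mid-eq n i j w w′ zero          y       z       p q r s = refl
mid-eq n i j w w′ (suc N)       zero    zero    p q r s = refl
mid-eq n i j w w′ (suc zero)    zero    (suc z) p q r s = refl
mid-eq n i j w w′ (suc (suc N)) zero    (suc z) p q r s = mid-eq n i j w w′ (suc N) zero z p q r s
mid-eq n i j w w′ (suc zero)    (suc y) zero    p q r s = refl
mid-eq n i j w w′ (suc (suc N)) (suc y) zero    p q r s = mid-eq n i j w w′ (suc N) y zero p q r s
mid-eq n i j w w′ (suc zero)    (suc y) (suc z) p q r s = refl
mid-eq n i j w w′ (suc (suc N)) (suc y) (suc z) p q r s = mid-eq n i j w w′ (suc N) y z p q r s

L-body : ∀ n (i j : Fin n) → L n i j ≡ body (n ∸ 1) (toℕ i) (toℕ j)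
L-body n i j = trans (L-step n i j) eq
  where
  eq : L-eq n i j ≡ body (n ∸ 1) (toℕ i) (toℕ j)
  eq with n ∸ 1 | toℕ i | toℕ j
  ... | zero  | _     | _     = refl
  ... | suc zero | zero  | zero  = refl
  ... | suc (suc N) | zero  | zero  = refl
  ... | suc zero | zero  | suc z = row-eq n i j (suc z) 0 z (0 ≡ᵇ z) (suc z ≡ᵇ 0) (z ≡ᵇ 0)
  ... | suc N@(suc _) | zero  | suc z = row-eq n i j (suc z) N z (0 ≡ᵇ z) (suc z ≡ᵇ N) (z ≡ᵇ N)
  ... | suc zero | suc y | zero  = col-eq n i j (suc y) 0 y (0 ≡ᵇ y) (suc y ≡ᵇ 0) (y ≡ᵇ 0)
  ... | suc N@(suc _) | suc y | zero  = col-eq n i j (suc y) N y (0 ≡ᵇ y) (suc y ≡ᵇ N) (y ≡ᵇ N)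
  ... | suc zero | suc y | suc z = mid-eq n i j (suc y) (suc z) 0 y z (suc y ≡ᵇ z) (suc z ≡ᵇ y) (y ≡ᵇ 0) (z ≡ᵇ 0)
  ... | suc N@(suc _) | suc y | suc z = mid-eq n i j (suc y) (suc z) N y z (suc y ≡ᵇ z) (suc z ≡ᵇ y) (y ≡ᵇ N) (z ≡ᵇ N)

≤ᵇ⁻ : ∀ {m k} → (m ≤ᵇ k) ≡ true → m ≤ k
≤ᵇ⁻ {m} {k} eq = ≤ᵇ⇒≤ m k (Bool.T-≡ .Function.Equivalence.from eq)

≤ᵇ⁺ : ∀ {m k} → m ≤ k → (m ≤ᵇ k) ≡ true
≤ᵇ⁺ p = Bool.T-≡ .Function.Equivalence.to (≤⇒≤ᵇ p)

≡ᵇ⁻ : ∀ m k → (m ≡ᵇ k) ≡ true → m ≡ k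
≡ᵇ⁻ m k eq = ≡ᵇ⇒≡ m k (Bool.T-≡ .Function.Equivalence.from eq)

≡ᵇ⁺ : ∀ {m k} → m ≡ k → (m ≡ᵇ k) ≡ true
≡ᵇ⁺ {m} {k} p = Bool.T-≡ .Function.Equivalence.to (≡⇒≡ᵇ m k p)

-- Every edge of L joins k to next k for a unique k: next runs through the cycle 0, …, a, and the pendant
-- vertex a + 1 is sent to 0.
module Tadpole (a : ℕ) (2≤a : 2 ≤ a) where

  next : ℕ → ℕ
  next k with k <? a
  ... | yes _ = suc k
  ... | no _  = 0

  next-< : ∀ {k} → k < a → next k ≡ suc k
  next-< {k} k<a with k <? a
  ... | yes _ = refl
  ... | no ¬p = ⊥-elim (¬p k<a)

  next-≥ : ∀ {k} → a ≤ k → next k ≡ 0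
  next-≥ {k} a≤k with k <? a
  ... | yes p = ⊥-elim (<-irrefl refl (≤-trans p a≤k))
  ... | no _  = refl

  next≤a : ∀ k → next k ≤ a
  next≤a k with k <? a
  ... | yes p = p
  ... | no _  = z≤n

  private
    N : ℕ
    N = suc (suc a)

    0<a : 0 < a
    0<a = ≤-trans (s≤s z≤n) 2≤a

    cycᵇ⁻ : ∀ x y → cycᵇ (suc a) x y ≡ true → (x < a × y ≡ suc x) ⊎ (x ≡ 0 × y ≡ a)
    cycᵇ⁻ x y p with ∧⁻ {not (suc a ≤ᵇ x)} p
    ... | _ , p′ with ∧⁻ {not (suc a ≤ᵇ y)} p′
    ... | y≤ , p″ with ∨⁻ {suc x ≡ᵇ y} p″
    ... | inj₂ q = inj₂ (≡ᵇ⁻ x 0 (proj₁ (∧⁻ q)) , ≡ᵇ⁻ y a (proj₂ (∧⁻ {x ≡ᵇ 0} q)))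
    ... | inj₁ q with ≡ᵇ⁻ (suc x) y q
    ... | refl = inj₁ (≰⇒> (λ a≤x → true≢false (≤ᵇ⁺ {suc a} {suc x} (s≤s a≤x)) (not⁻ y≤)) , refl)

    small : ∀ {x} → x ≤ a → not (suc a ≤ᵇ x) ≡ true
    small {x} x≤a = not⁺ (¬true⇒false λ p → <-irrefl refl (≤-trans (≤ᵇ⁻ {suc a} {x} p) x≤a))

    pendᵇ⁻ : ∀ x y → pendᵇ (suc a) x y ≡ true → x ≡ suc a × y ≡ 0
    pendᵇ⁻ x y p = ≡ᵇ⁻ x (suc a) (proj₁ (∧⁻ p)) , ≡ᵇ⁻ y 0 (proj₂ (∧⁻ {x ≡ᵇ suc a} p))

  Adjacent : ℕ → ℕ → Set
  Adjacent k l = l ≡ next k ⊎ k ≡ next l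

  body⁻ : ∀ x y → body (suc a) x y ≡ true → Adjacent x y
  body⁻ x y eq with ∨⁻ {cycᵇ (suc a) x y ∨ cycᵇ (suc a) y x} eq
  ... | inj₂ p with ∨⁻ {pendᵇ (suc a) x y} p
  ... | inj₁ q with pendᵇ⁻ x y q
  ... | refl , refl = inj₁ (sym (next-≥ (n≤1+n a)))
  body⁻ x y eq | inj₂ p | inj₂ q with pendᵇ⁻ y x q
  ... | refl , refl = inj₂ (sym (next-≥ (n≤1+n a)))
  body⁻ x y eq | inj₁ p with ∨⁻ {cycᵇ (suc a) x y} p
  ... | inj₁ q with cycᵇ⁻ x y q
  ... | inj₁ (x<a , refl) = inj₁ (sym (next-< x<a))
  ... | inj₂ (refl , refl) = inj₂ (sym (next-≥ ≤-refl))
  body⁻ x y eq | inj₁ p | inj₂ q with cycᵇ⁻ y x q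
  ... | inj₁ (y<a , refl) = inj₂ (sym (next-< y<a))
  ... | inj₂ (refl , refl) = inj₁ (sym (next-≥ ≤-refl))

  body⁺ : ∀ x → x ≤ suc a → body (suc a) x (next x) ≡ true
  body⁺ x x≤ with x <? a
  ... | yes x<a = ∨⁺ˡ {cycᵇ (suc a) x (suc x) ∨ cycᵇ (suc a) (suc x) x} (∨⁺ˡ {cycᵇ (suc a) x (suc x)}
        (∧⁺ (small (<⇒≤ x<a)) (∧⁺ (small x<a) (∨⁺ˡ {suc x ≡ᵇ suc x} (≡ᵇ⁺ {suc x} refl)))))
  ... | no x≮a with m≤n⇒m<n∨m≡n x≤
  ... | inj₂ refl = ∨⁺ʳ {cycᵇ (suc a) x 0 ∨ cycᵇ (suc a) 0 x} (∨⁺ˡ {pendᵇ (suc a) x 0} (∧⁺ (≡ᵇ⁺ {x} refl) refl))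
  ... | inj₁ (s≤s x≤a) with ≤-antisym x≤a (≮⇒≥ x≮a)
  ... | refl = ∨⁺ˡ {cycᵇ (suc a) x 0 ∨ cycᵇ (suc a) 0 x} (∨⁺ʳ {cycᵇ (suc a) x 0}
        (∧⁺ (small {0} z≤n) (∧⁺ (small ≤-refl) (∨⁺ʳ {1 ≡ᵇ x} (≡ᵇ⁺ {x} refl)))))

  body-sym : ∀ x y → body (suc a) x y ≡ true → body (suc a) y x ≡ true
  body-sym x y p = trans (cong₂ _∨_ (Bool.∨-comm (cycᵇ (suc a) y x) _) (Bool.∨-comm (pendᵇ (suc a) y x) _)) p

  toℕ≤ : (i : Fin N) → toℕ i ≤ suc a
  toℕ≤ i = s≤s⁻¹ (Fin.toℕ<n i)

  L⁻ : ∀ {i j : Fin N} → L N i j ≡ true → Adjacent (toℕ i) (toℕ j)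
  L⁻ {i} {j} e = body⁻ (toℕ i) (toℕ j) (trans (sym (L-body N i j)) e)

  L⁺ : ∀ {i j : Fin N} → Adjacent (toℕ i) (toℕ j) → L N i j ≡ true
  L⁺ {i} {j} (inj₁ eq) = trans (L-body N i j)
    (subst (λ y → body (suc a) (toℕ i) y ≡ true) (sym eq) (body⁺ (toℕ i) (toℕ≤ i)))
  L⁺ {i} {j} (inj₂ eq) = trans (L-body N i j) (body-sym (toℕ j) (toℕ i)
    (subst (λ x → body (suc a) (toℕ j) x ≡ true) (sym eq) (body⁺ (toℕ j) (toℕ≤ j))))

  swap : ∀ {k l} → Adjacent k l → Adjacent l k
  swap (inj₁ p) = inj₂ p
  swap (inj₂ p) = inj₁ p

  next-irr : ∀ k → k ≢ next k
  next-irr k eq with k <? a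
  next-irr k () | yes _
  next-irr .0 refl | no 0≮a = 0≮a 0<a

  L-simple : IsSimple (L N)
  L-simple = (λ i j → ⇔⇒≡ (L⁺ {j} {i} ∘ swap ∘ L⁻ {i} {j}) (L⁺ {i} {j} ∘ swap ∘ L⁻ {j} {i})) ,
    λ i → ¬true⇒false λ e → case L⁻ {i} {i} e of λ where
      (inj₁ p) → next-irr _ p
      (inj₂ p) → next-irr _ p

  at : ℕ → Fin N
  at k = fromℕ< (s≤s (m⊓n≤n k (suc a)))

  toℕ-at : ∀ {k} → k ≤ suc a → toℕ (at k) ≡ k
  toℕ-at {k} k≤ = trans (Fin.toℕ-fromℕ< (s≤s (m⊓n≤n k (suc a)))) (m≤n⇒m⊓n≡m k≤)

  at-toℕ : ∀ {i k} → toℕ i ≡ k → at k ≡ i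
  at-toℕ {i} refl = Fin.toℕ-injective (toℕ-at (toℕ≤ i))

  L-next : ∀ {k} → k ≤ suc a → L N (at k) (at (next k)) ≡ true
  L-next {k} k≤ = L⁺ {at k} {at (next k)} (inj₁ (trans (toℕ-at (m≤n⇒m≤1+n (next≤a k))) (cong next (sym (toℕ-at k≤)))))

  module Walks (H : Graph N) (H-sym : ∀ i j → Adj H i j → Adj H j i) where
    upWalk : ∀ m → m ≤ a → (∀ {k} → k < m → Adj H (at k) (at (next k))) → Star (Adj H) (at 0) (at m)
    upWalk zero    _   _ = ε
    upWalk (suc m) m<a h = upWalk m (<⇒≤ m<a) (λ k< → h (m≤n⇒m≤1+n k<)) ◅◅
      (subst (λ z → Adj H (at m) (at z)) (next-< m<a) (h ≤-refl) ◅ ε)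

    downWalk : ∀ d k → d + k ≡ a → (∀ {l} → k ≤ l → l ≤ a → Adj H (at l) (at (next l))) → Star (Adj H) (at 0) (at k)
    downWalk zero    k refl h = H-sym (at k) (at 0) (subst (λ z → Adj H (at k) (at z)) (next-≥ ≤-refl) (h ≤-refl ≤-refl)) ◅ ε
    downWalk (suc d) k refl h = downWalk d (suc k) (+-suc d k) (λ k<l → h (<⇒≤ k<l)) ◅◅
      (H-sym (at k) (at (suc k)) (subst (λ z → Adj H (at k) (at z)) (next-< k<a) (h ≤-refl (<⇒≤ k<a))) ◅ ε)
      where k<a = s≤s (m≤n+m k d)

  L-connected : IsConnected (L N)
  L-connected = connectedB-rooted {S = λ _ → true} {L N} (λ {i} {j} → L-sym i j) (at 0) λ i _ → subst (Star _ (at 0)) (at-toℕ refl) (to (toℕ i) (toℕ≤ i))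
    where
    L-sym : ∀ i j → Adj (L N) i j → Adj (L N) j i
    L-sym i j e = trans (proj₁ L-simple j i) e
    open Walks (L N) L-sym
    to : ∀ k → k ≤ suc a → Star (Adj (L N)) (at 0) (at k)
    to k k≤ with m≤n⇒m<n∨m≡n k≤
    ... | inj₁ (s≤s k≤a) = upWalk k k≤a λ l<k → L-next (≤-trans (<⇒≤ l<k) k≤)
    ... | inj₂ refl = L-sym (at k) (at 0) (subst (λ z → Adj (L N) (at k) (at z)) (next-≥ (n≤1+n a)) (L-next ≤-refl)) ◅ ε

  private
    present : (w i : Fin N) → Bool
    present w i = not (i ==F w)

    present⁺ : ∀ {w k} → k ≤ suc a → k ≢ toℕ w → present w (at k) ≡ true
    present⁺ {w} {k} k≤ k≢w = not⁺ (≢⇒==F {i = at k} {w} λ eq → k≢w (trans (sym (toℕ-at k≤)) (cong toℕ eq)))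

  -- Vertices of the cycle before `w` are reached from 0 upwards, those after `w` downwards over the
  -- closing edge, and the pendant vertex by its own edge.
  noCut-L : ∀ w → toℕ w ≢ 0 → isCutB (L N) w ≡ false
  noCut-L w w≢0 = cong not (connectedB-rooted {S = present w} {H} (λ {i} {j} → del-sym i j) (at 0)
      λ i i≢w → subst (Star _ (at 0)) (at-toℕ refl) (to (toℕ i) (toℕ≤ i) λ eq → ==F⇒≢ (not⁻ i≢w) (Fin.toℕ-injective eq)))
    where
    q = toℕ w
    H : Graph N
    H = delete (L N) w
    del-sym : ∀ i j → Adj H i j → Adj H j i
    del-sym i j e = let e′ , p = ∧⁻ {L N i j} e ; pi , pj = ∧⁻ {not (i ==F w)} p in
      ∧⁺ (trans (proj₁ L-simple j i) e′) (∧⁺ pj pi)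
    open Walks H del-sym
    arc : ∀ {k} → k ≤ suc a → k ≢ q → next k ≢ q → Adj H (at k) (at (next k))
    arc {k} k≤ k≢ nk≢ = ∧⁺ (L-next k≤) (∧⁺ (present⁺ {w} k≤ k≢) (present⁺ {w} (m≤n⇒m≤1+n (next≤a k)) nk≢))
    to : ∀ k → k ≤ suc a → k ≢ q → Star (Adj H) (at 0) (at k)
    to k k≤ k≢q with m≤n⇒m<n∨m≡n k≤
    ... | inj₂ refl = del-sym (at k) (at 0) (subst (λ z → Adj H (at k) (at z)) (next-≥ (n≤1+n a))
            (arc ≤-refl k≢q (λ eq → w≢0 (trans (sym eq) (next-≥ (n≤1+n a)))))) ◅ ε
    ... | inj₁ (s≤s k≤a) with <-cmp k q
    ... | tri≈ _ k≡q _ = ⊥-elim (k≢q k≡q)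
    ... | tri< k<q _ _ = upWalk k k≤a λ {l} l<k → arc (≤-trans (<⇒≤ l<k) k≤) (<⇒≢ (<-trans l<k k<q))
            (λ eq → <-irrefl (trans (sym (next-< (≤-trans l<k k≤a))) eq) (≤-trans (s≤s l<k) k<q))
    ... | tri> _ _ q<k = downWalk (a ∸ k) k (m∸n+n≡m k≤a) λ {l} k≤l l≤a → arc (m≤n⇒m≤1+n l≤a) (>⇒≢ (≤-trans q<k k≤l))
            (away (≤-trans q<k k≤l))
      where
      away : ∀ {l} → q < l → next l ≢ q
      away {l} q<l eq with l <? a
      ... | yes _ = <-irrefl (sym eq) (m≤n⇒m≤1+n q<l)
      ... | no _  = w≢0 (sym eq)

  -- Without vertex 0 the pendant vertex has no neighbour left, so no walk takes it to vertex 1.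
  cut-L : ∀ w → toℕ w ≡ 0 → isCutB (L N) w ≡ true
  cut-L w w≡0 = not⁺ (¬true⇒false λ conn → stuck (connectedB⁻ {S = present w} {delete (L N) w} conn
      (present⁺ {w} {suc a} ≤-refl (λ eq → case trans eq w≡0 of λ ()))
      (present⁺ {w} {1} (s≤s z≤n) (λ eq → case trans eq w≡0 of λ ()))))
    where
    stuck : ¬ Star (Adj (delete (L N) w)) (at (suc a)) (at 1)
    stuck walk = <-irrefl (sym (suc-injective (trans (sym (Star-preserves (λ i → toℕ i ≡ suc a) step (toℕ-at ≤-refl) walk))
                   (toℕ-at {1} (s≤s z≤n))))) 0<a
      where
      step : ∀ {i j} → toℕ i ≡ suc a → Adj (delete (L N) w) i j → toℕ j ≡ suc a
      step {i} {j} eq e with ∧⁻ {L N i j} e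
      ... | e′ , p with L⁻ {i} {j} e′
      ... | inj₁ j≡ = ⊥-elim (==F⇒≢ {i = j} {w} (not⁻ (proj₂ (∧⁻ {not (i ==F w)} p)))
              (Fin.toℕ-injective (trans (trans j≡ (trans (cong next eq) (next-≥ (n≤1+n a)))) (sym w≡0))))
      ... | inj₂ i≡ = ⊥-elim (<-irrefl refl (≤-trans (≤-reflexive (trans (sym eq) i≡)) (next≤a (toℕ j))))

  L-InC : InC N 1 (L N)
  L-InC = L-simple , L-connected , countB-one (isCutB (L N)) zero (Data.List.tabulate suc) (cut-L zero refl)
    (All.tabulate⁺ {P = λ w → isCutB (L N) w ≡ false} {f = suc} (λ i → noCut-L (suc i) (λ ())))
    where
    countB-none : ∀ {A : Set} (p : A → Bool) xs → All (λ x → p x ≡ false) xs → countB p xs ≡ 0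
    countB-none p [] [] = refl
    countB-none p (x ∷ xs) (px ∷ pxs) rewrite px = countB-none p xs pxs
    countB-one : ∀ {A : Set} (p : A → Bool) x xs → p x ≡ true → All (λ x → p x ≡ false) xs → countB p (x ∷ xs) ≡ 1
    countB-one p x xs px pxs rewrite px = cong suc (countB-none p xs pxs)

-- The connected subgraphs of the tadpole at its pendant vertex

module _ {h : ℕ → Bool} where
  firstFalse : ∀ m → (∀ {k} → k < m → h k ≡ true) ⊎ ∃ λ i → i < m × h i ≡ false × (∀ {k} → k < i → h k ≡ true)
  firstFalse zero = inj₁ λ ()
  firstFalse (suc m) with firstFalse m
  ... | inj₂ (i , i<m , p) = inj₂ (i , m≤n⇒m≤1+n i<m , p)
  ... | inj₁ all with bool (h m)
  ... | inj₂ ¬hm = inj₂ (m , ≤-refl , ¬hm , all)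
  ... | inj₁ hm = inj₁ λ k<1+m → case m≤n⇒m<n∨m≡n (s≤s⁻¹ k<1+m) of λ where
    (inj₁ k<m) → all k<m
    (inj₂ refl) → hm

  lastFalse : ∀ m {i} → i < m → h i ≡ false →
              ∃ λ j → i ≤ j × j < m × h j ≡ false × (∀ {k} → j < k → k < m → h k ≡ true)
  lastFalse (suc m) {i} i<1+m ¬hi with bool (h m)
  ... | inj₂ ¬hm = m , s≤s⁻¹ i<1+m , ≤-refl , ¬hm , λ m<k k<1+m → ⊥-elim (<-irrefl refl (≤-trans m<k (s≤s⁻¹ k<1+m)))
  ... | inj₁ hm with m≤n⇒m<n∨m≡n (s≤s⁻¹ i<1+m)
  ... | inj₂ refl = true≢false hm ¬hi
  ... | inj₁ i<m with lastFalse m i<m ¬hi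
  ... | j , i≤j , j<m , ¬hj , after = j , i≤j , m≤n⇒m≤1+n j<m , ¬hj , λ j<k k<1+m →
    case m≤n⇒m<n∨m≡n (s≤s⁻¹ k<1+m) of λ where
      (inj₁ k<m) → after j<k k<m
      (inj₂ refl) → hm

module TadpoleCount (a : ℕ) (2≤a : 2 ≤ a) where
  open Tadpole a 2≤a

  private
    N : ℕ
    N = suc (suc a)

    Code : Set
    Code = Vec Bool N × Vec (Vec Bool N) N

    -- Removing the arcs k → next k with i ≤ k < j, and the vertices this disconnects from vertex 0.
    vertexIn : ℕ × ℕ → ℕ → Set
    vertexIn (i , j) k = k ≤ i ⊎ j ≤ k

    arcIn : ℕ × ℕ → ℕ → Set
    arcIn (i , j) k = k < i ⊎ j ≤ k

    edgeIn : ℕ × ℕ → ℕ → ℕ → Set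
    edgeIn ij k l = (l ≡ next k × arcIn ij k) ⊎ (k ≡ next l × arcIn ij l)

    edgeIn? : ∀ ij k l → Dec (edgeIn ij k l)
    edgeIn? (i , j) k l = ((l ≟ next k) ×-dec ((k <? i) ⊎-dec (j ≤? k))) ⊎-dec ((k ≟ next l) ×-dec ((l <? i) ⊎-dec (j ≤? l)))

    encode : ℕ × ℕ → Code
    encode ij@(i , j) =
      tabulate (λ x → does ((toℕ x ≤? i) ⊎-dec (j ≤? toℕ x))) ,
      tabulate (λ x → tabulate λ y → does (edgeIn? ij (toℕ x) (toℕ y)))

    single : Code
    single = tabulate (λ x → does (toℕ x ≟ suc a)) , tabulate (λ _ → tabulate λ _ → false)

    -- The pendant vertex alone, the whole of `L`, and one code for each pair i < j < N. A pair (i,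
    -- i + 1) removes one edge of the cycle and no vertex; a longer interval also removes the
    -- vertices strictly between its ends.
    codes : List Code
    codes = single ∷ encode (0 , 0) ∷ map encode (tri N)

    Code-ext : (S : Vec Bool N) (M : Vec (Vec Bool N) N) {p : Fin N → Bool} {q : Fin N → Fin N → Bool} →
      (∀ i → lookup S i ≡ p i) → (∀ i j → lookup (lookup M i) j ≡ q i j) →
      (S , M) ≡ (tabulate p , tabulate (λ i → tabulate (q i)))
    Code-ext S M hS hM = cong₂ _,_
      (trans (sym (Vec.tabulate∘lookup S)) (Vec.tabulate-cong hS))
      (trans (sym (Vec.tabulate∘lookup M)) (Vec.tabulate-cong λ i →
        trans (sym (Vec.tabulate∘lookup (lookup M i))) (Vec.tabulate-cong (hM i))))

  module _ (v : Fin N) (v≡ : toℕ v ≡ suc a) (S : Vec Bool N) (M : Vec (Vec Bool N) N)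
           (valid : isConnSubgraphAt (L N) v (S , M) ≡ true) where
    private
      H : Graph N
      H i j = lookup (lookup M i) j

      facts = isConnSubgraphAt⁻ (L N) v S M valid
      v∈S = proj₁ facts

      H-sym : ∀ {i j} → H i j ≡ true → H j i ≡ true
      H-sym = proj₁ (proj₂ facts)

      H⊆ : ∀ {i j} → H i j ≡ true → L N i j ≡ true × lookup S i ≡ true × lookup S j ≡ true
      H⊆ = proj₁ (proj₂ (proj₂ facts))

      S⊆ : (T : Fin N → Set) → T v → (∀ {i j} → T i → H i j ≡ true → T j) → ∀ {i} → lookup S i ≡ true → T i
      S⊆ T Tv step i∈S = Star-preserves T step Tv (proj₂ (proj₂ (proj₂ facts)) i∈S)

      at-end : at (suc a) ≡ v
      at-end = at-toℕ v≡

      arc : ℕ → Bool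
      arc k = H (at k) (at (next k))

      H-arc : ∀ {i j} → toℕ j ≡ next (toℕ i) → H i j ≡ arc (toℕ i)
      H-arc {i} {j} eq = cong₂ H (sym (at-toℕ {i} refl)) (sym (at-toℕ {j} eq))

      H-arc′ : ∀ {i j} → toℕ i ≡ next (toℕ j) → H i j ≡ arc (toℕ j)
      H-arc′ {i} {j} eq = trans (⇔⇒≡ H-sym H-sym) (H-arc {j} {i} eq)

      isolated : lookup S (at 0) ≡ false → (S , M) ∈ codes
      isolated 0∉S = here (Code-ext S M
          (λ i → ⇔⇒≡ (λ i∈S → does⁺ (toℕ i ≟ suc a) (only i∈S))
                      (λ p → subst (λ z → lookup S z ≡ true) (trans (sym at-end) (at-toℕ (does⁻ (toℕ i ≟ suc a) p))) v∈S))
          (λ i j → ¬true⇒false λ e → let _ , i∈S , j∈S = H⊆ {i} {j} e in noLoop i j (only i∈S) (only j∈S) e))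
        where
        noLoop : ∀ i j → toℕ i ≡ suc a → toℕ j ≡ suc a → ¬ (H i j ≡ true)
        noLoop i j i≡ j≡ e with L⁻ {i} {j} (proj₁ (H⊆ {i} {j} e))
        ... | inj₁ p = <-irrefl refl (≤-trans (≤-reflexive (trans (sym j≡) p)) (next≤a (toℕ i)))
        ... | inj₂ p = <-irrefl refl (≤-trans (≤-reflexive (trans (sym i≡) p)) (next≤a (toℕ j)))
        only : ∀ {i} → lookup S i ≡ true → toℕ i ≡ suc a
        only = S⊆ (λ i → toℕ i ≡ suc a) v≡ step
          where
          step : ∀ {i j} → toℕ i ≡ suc a → H i j ≡ true → toℕ j ≡ suc a
          step {i} {j} i≡ e with L⁻ {i} {j} (proj₁ (H⊆ {i} {j} e))
          ... | inj₁ p = true≢false (proj₂ (proj₂ (H⊆ {i} {j} e)))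
                  (subst (λ z → lookup S z ≡ false) (at-toℕ (trans p (trans (cong next i≡) (next-≥ (n≤1+n a))))) 0∉S)
          ... | inj₂ p = ⊥-elim (<-irrefl refl (≤-trans (≤-reflexive (trans (sym i≡) p)) (next≤a (toℕ j))))

      module _ (0∈S : lookup S (at 0) ≡ true) where
        arc-end : arc (suc a) ≡ true
        arc-end with bool (arc (suc a))
        ... | inj₁ p = p
        ... | inj₂ ¬p = case trans (sym (toℕ-at {0} z≤n)) (S⊆ (λ i → toℕ i ≡ suc a) v≡ step 0∈S) of λ ()
          where
          step : ∀ {i j} → toℕ i ≡ suc a → H i j ≡ true → toℕ j ≡ suc a
          step {i} {j} i≡ e with L⁻ {i} {j} (proj₁ (H⊆ {i} {j} e))
          ... | inj₁ p = true≢false (trans (cong arc (sym i≡)) (trans (sym (H-arc {i} {j} p)) e)) ¬p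
          ... | inj₂ p = ⊥-elim (<-irrefl refl (≤-trans (≤-reflexive (trans (sym i≡) p)) (next≤a (toℕ j))))

        arc⇒∈ : ∀ {k} → arc k ≡ true → lookup S (at k) ≡ true × lookup S (at (next k)) ≡ true
        arc⇒∈ {k} e = proj₂ (H⊆ {at k} {at (next k)} e)

        encoded : ∀ i j → (∀ {k} → k ≤ suc a → lookup S (at k) ≡ true → vertexIn (i , j) k) →
          (∀ {k} → k ≤ suc a → vertexIn (i , j) k → lookup S (at k) ≡ true) →
          (∀ {k} → k ≤ suc a → arc k ≡ true → arcIn (i , j) k) →
          (∀ {k} → k ≤ suc a → arcIn (i , j) k → arc k ≡ true) → (S , M) ≡ encode (i , j)
        encoded i j S→ S← A→ A← = Code-ext S M
          (λ x → ⇔⇒≡ (λ p → does⁺ (vertexIn? x) (S→ (toℕ≤ x) (subst (λ z → lookup S z ≡ true) (sym (at-toℕ refl)) p)))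
                      (λ p → subst (λ z → lookup S z ≡ true) (at-toℕ refl) (S← (toℕ≤ x) (does⁻ (vertexIn? x) p))))
          (λ x y → ⇔⇒≡ (λ e → does⁺ (edgeIn? (i , j) (toℕ x) (toℕ y)) (edge→ x y e))
                        (λ p → edge← x y (does⁻ (edgeIn? (i , j) (toℕ x) (toℕ y)) p)))
          where
          vertexIn? : (x : Fin N) → Dec (vertexIn (i , j) (toℕ x))
          vertexIn? x = (toℕ x ≤? i) ⊎-dec (j ≤? toℕ x)
          edge→ : ∀ x y → H x y ≡ true → edgeIn (i , j) (toℕ x) (toℕ y)
          edge→ x y e with L⁻ {x} {y} (proj₁ (H⊆ {x} {y} e))
          ... | inj₁ p = inj₁ (p , A→ (toℕ≤ x) (trans (sym (H-arc {x} {y} p)) e))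
          ... | inj₂ p = inj₂ (p , A→ (toℕ≤ y) (trans (sym (H-arc′ {x} {y} p)) e))
          edge← : ∀ x y → edgeIn (i , j) (toℕ x) (toℕ y) → H x y ≡ true
          edge← x y (inj₁ (p , q)) = trans (H-arc {x} {y} p) (A← (toℕ≤ x) q)
          edge← x y (inj₂ (p , q)) = trans (H-arc′ {x} {y} p) (A← (toℕ≤ y) q)

        whole : (∀ {k} → k < suc a → arc k ≡ true) → (S , M) ≡ encode (0 , 0)
        whole allArcs = encoded 0 0 (λ _ _ → inj₂ z≤n) (λ k≤ _ → proj₁ (arc⇒∈ (every k≤))) (λ _ _ → inj₂ z≤n) (λ k≤ _ → every k≤)
          where
          every : ∀ {k} → k ≤ suc a → arc k ≡ true
          every k≤ with m≤n⇒m<n∨m≡n k≤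
          ... | inj₁ k< = allArcs k<
          ... | inj₂ refl = arc-end

        -- Here `i` and `j` are the first and the last missing arc of the cycle. Without them the
        -- vertices i + 1, ..., j are cut off, because the set `T` of the others is closed under the
        -- edges of `H`; so no arc between `i` and `j` survives. The interval of `encode` is
        -- half-open, whence `suc j`.
        partial : ∀ {i j} → i ≤ j → j < suc a → arc i ≡ false → arc j ≡ false →
          (∀ {k} → k < i → arc k ≡ true) → (∀ {k} → j < k → k < suc a → arc k ≡ true) → (S , M) ≡ encode (i , suc j)
        partial {i} {j} i≤j j<1+a ¬i ¬j before after = encoded i (suc j) inside inside⁻ arcs→ arcs←
          where
          T : ℕ → Set
          T = vertexIn (i , suc j)
          i≤a = ≤-trans i≤j (s≤s⁻¹ j<1+a)
          arcs← : ∀ {k} → k ≤ suc a → arcIn (i , suc j) k → arc k ≡ true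
          arcs← k≤ (inj₁ k<i) = before k<i
          arcs← k≤ (inj₂ j<k) with m≤n⇒m<n∨m≡n k≤
          ... | inj₁ k< = after j<k k<
          ... | inj₂ refl = arc-end
          ≢i : ∀ {k} → arc k ≡ true → k ≢ i
          ≢i e refl = true≢false e ¬i
          ≢j : ∀ {k} → arc k ≡ true → k ≢ j
          ≢j e refl = true≢false e ¬j
          forward : ∀ {k} → T k → arc k ≡ true → T (next k)
          forward {k} t e = case k <? a of λ where
              (no k≮a) → subst T (sym (next-≥ (≮⇒≥ k≮a))) (inj₁ z≤n)
              (yes k<a) → subst T (sym (next-< k<a)) (step t)
            where
            step : T k → T (suc k)
            step (inj₁ k≤i) = inj₁ (≤∧≢⇒< k≤i (≢i e))
            step (inj₂ j<k) = inj₂ (m≤n⇒m≤1+n j<k)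
          backward : ∀ {k} → k ≤ suc a → T (next k) → arc k ≡ true → T k
          backward {k} k≤ t e = case k <? a of λ where
              (no k≮a) → inj₂ (≤∧≢⇒< (≤-trans (s≤s⁻¹ j<1+a) (≮⇒≥ k≮a)) (≢j e ∘ sym))
              (yes k<a) → step (subst T (next-< k<a) t)
            where
            step : T (suc k) → T k
            step (inj₁ k<i) = inj₁ (<⇒≤ k<i)
            step (inj₂ j≤k) = inj₂ (≤∧≢⇒< (s≤s⁻¹ j≤k) (≢j e ∘ sym))
          closed : ∀ {x y} → T (toℕ x) → H x y ≡ true → T (toℕ y)
          closed {x} {y} t e with L⁻ {x} {y} (proj₁ (H⊆ {x} {y} e))
          ... | inj₁ p = subst T (sym p) (forward t (trans (sym (H-arc {x} {y} p)) e))
          ... | inj₂ p = backward (toℕ≤ y) (subst T p t) (trans (sym (H-arc′ {x} {y} p)) e)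
          inside : ∀ {k} → k ≤ suc a → lookup S (at k) ≡ true → T k
          inside k≤ k∈S = subst T (toℕ-at k≤) (S⊆ (T ∘ toℕ) (inj₂ (subst (suc j ≤_) (sym v≡) j<1+a)) closed k∈S)
          inside⁻ : ∀ {k} → k ≤ suc a → T k → lookup S (at k) ≡ true
          inside⁻ {zero} _ _ = 0∈S
          inside⁻ {suc k} k≤ (inj₁ k<i) = subst (λ z → lookup S (at z) ≡ true) (next-< (≤-trans k<i i≤a)) (proj₂ (arc⇒∈ (before k<i)))
          inside⁻ {suc k} k≤ (inj₂ j<k) = proj₁ (arc⇒∈ (arcs← k≤ (inj₂ j<k)))
          arcs→ : ∀ {k} → k ≤ suc a → arc k ≡ true → arcIn (i , suc j) k
          arcs→ k≤ e with inside k≤ (proj₁ (arc⇒∈ e))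
          ... | inj₁ k≤i = inj₁ (≤∧≢⇒< k≤i (≢i e))
          ... | inj₂ j<k = inj₂ j<k

    code∈codes : (S , M) ∈ codes
    code∈codes with bool (lookup S (at 0))
    ... | inj₂ 0∉S = isolated 0∉S
    ... | inj₁ 0∈S with firstFalse {arc} (suc a)
    ... | inj₁ allArcs = there (here (whole 0∈S allArcs))
    ... | inj₂ (i , i< , ¬i , before) with lastFalse {arc} (suc a) i< ¬i
    ... | j , i≤j , j< , ¬j , after = there (there
      (subst (_∈ map encode (tri N)) (sym (partial 0∈S i≤j j< ¬i ¬j before after))
        (Mem.∈-map⁺ encode (tri-complete (s≤s i≤j) (s≤s j<)))))

  -- For an upper bound it suffices that every valid candidate occurs in `codes`, which has 2 + C(N,
  -- 2) entries.
  f-L≤ : ∀ v → toℕ v ≡ suc a → f (L N) v ≤ 2 + triN N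
  f-L≤ v v≡ = ≤-trans
    (countB≤length (isConnSubgraphAt (L N) v) (candidates-unique N) (λ {(S , M)} ok → code∈codes v v≡ S M ok))
    (s≤s (s≤s (≤-reflexive (trans (length-map encode (tri N)) (length-tri N)))))

-- Splitting at the cut vertex

countB-zero⁻ : ∀ {A : Set} (p : A → Bool) xs → countB p xs ≡ 0 → ∀ {w} → w ∈ xs → p w ≡ false
countB-zero⁻ p (x ∷ xs) eq w∈ with p x in px
countB-zero⁻ p (x ∷ xs) eq (here refl) | false = px
countB-zero⁻ p (x ∷ xs) eq (there w∈)  | false = countB-zero⁻ p xs eq w∈

countB-one⁻ : ∀ {A : Set} (p : A → Bool) xs → countB p xs ≡ 1 →
  ∃ λ c → p c ≡ true × (∀ {w} → w ∈ xs → w ≢ c → p w ≡ false)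
countB-one⁻ p (x ∷ xs) eq with p x in px
... | true = x , px , λ where
  (here w≡x) w≢x → ⊥-elim (w≢x w≡x)
  (there w∈) _   → countB-zero⁻ p xs (suc-injective eq) w∈
... | false with countB-one⁻ p xs eq
... | c , pc , others = c , pc , λ where
  (here refl) _  → px
  (there w∈) w≢c → others w∈ w≢c

module SplitAt {n : ℕ} (G : Graph n) (G-sym : ∀ i j → G i j ≡ G j i) where
  open Connectivity G G-sym

  ordering : ∀ {S r a} → Connected S r → NoCutBut S r → S r ≡ true → size S ≡ suc a → Ordering (λ _ → false) S r a
  ordering {S} {r} {a} conn noCut Sr eq = Greedy.order S r noCut a (λ _ → false) S inj₂ id Sr conn eq

  module Parts {W : VS n} {c s : Fin n} (Wc : W c ≡ true) (conn : Connected W c) (noCut : NoCutBut W c)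
           (Ws : W s ≡ true) (s≢c : s ≢ c) where

    inner left right : VS n
    inner = component (W ∖ c) s
    left i = inner i ∨ (i ==F c)
    right i = W i ∧ not (inner i)

    inner⊆ : ∀ {i} → inner i ≡ true → W i ≡ true × i ≢ c
    inner⊆ {i} p = ∖⁻ {S = W} {c} {i} (component⊆ {W ∖ c} {s} {i} p)

    s∈inner : inner s ≡ true
    s∈inner = component-root {W ∖ c} (∖⁺ {S = W} Ws s≢c)

    inner-closed : ∀ {i j} → inner i ≡ true → W j ≡ true → j ≢ c → G i j ≡ true → inner j ≡ true
    inner-closed p Wj j≢c e = component-closed {W ∖ c} p (∖⁺ {S = W} Wj j≢c) e

    c∉inner : inner c ≡ false
    c∉inner = ¬true⇒false λ p → proj₂ (inner⊆ p) refl

    left⁻ : ∀ {i} → left i ≡ true → inner i ≡ true ⊎ i ≡ c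
    left⁻ {i} p with ∨⁻ {inner i} p
    ... | inj₁ q = inj₁ q
    ... | inj₂ q = inj₂ (==F⇒≡ {i = i} {c} q)

    inner⊆left : ∀ {i} → inner i ≡ true → left i ≡ true
    inner⊆left p = ∨⁺ˡ p

    c∈left : left c ≡ true
    c∈left = ∨⁺ʳ {inner c} (==F-refl c)

    left⊆ : ∀ {i} → left i ≡ true → W i ≡ true
    left⊆ p with left⁻ p
    ... | inj₁ q    = proj₁ (inner⊆ q)
    ... | inj₂ refl = Wc

    right⁻ : ∀ {i} → right i ≡ true → W i ≡ true × inner i ≡ false
    right⁻ {i} p = proj₁ (∧⁻ p) , not⁻ (proj₂ (∧⁻ {W i} p))

    right⁺ : ∀ {i} → W i ≡ true → inner i ≡ false → right i ≡ true
    right⁺ Wi ¬p = ∧⁺ Wi (not⁺ ¬p)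

    c∈right : right c ≡ true
    c∈right = right⁺ Wc c∉inner

    left∩right : ∀ {i} → left i ≡ true → right i ≡ true → i ≡ c
    left∩right p q with left⁻ p
    ... | inj₁ p′  = true≢false p′ (proj₂ (right⁻ q))
    ... | inj₂ i≡c = i≡c

    left-attach : ∀ {x y} → left x ≡ true → x ≢ c → W y ≡ true → G x y ≡ true → left y ≡ true
    left-attach {x} {y} p x≢c Wy e with left⁻ p | y Fin.≟ c
    ... | inj₂ x≡c | _        = ⊥-elim (x≢c x≡c)
    ... | inj₁ _   | yes refl = c∈left
    ... | inj₁ q   | no y≢c   = inner⊆left (inner-closed q Wy y≢c e)

    right-attach : ∀ {x y} → right x ≡ true → x ≢ c → W y ≡ true → G x y ≡ true → right y ≡ true
    right-attach p x≢c Wy e = right⁺ Wy (¬true⇒false λ q →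
      true≢false (inner-closed q (proj₁ (right⁻ p)) x≢c (flip-edge e)) (proj₂ (right⁻ p)))

    module _ {S : VS n} (S⊆ : ∀ {i} → S i ≡ true → W i ≡ true)
             (attach : ∀ {x y} → S x ≡ true → x ≢ c → W y ≡ true → G x y ≡ true → S y ≡ true) where
      part-connected : Connected S c
      part-connected = restrict {S} {W} S⊆ attach conn

      part-noCut : NoCutBut S c
      part-noCut {b} Sb b≢c = restrict {S ∖ b} {W ∖ b}
        (λ p → let Sx , x≢b = ∖⁻ {S = S} p in ∖⁺ {S = W} (S⊆ Sx) x≢b)
        (λ p x≢c q e → let Sx , _ = ∖⁻ {S = S} p ; Wy , y≢b = ∖⁻ {S = W} q in ∖⁺ {S = S} (attach Sx x≢c Wy e) y≢b)
        (noCut (S⊆ Sb) b≢c)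

    size-left : size left ≡ suc (size inner)
    size-left = trans (size-⊎ left inner (_==F c) (λ _ → refl)
        (λ i p → ≢⇒==F {i = i} {c} (proj₂ (inner⊆ p))))
      (trans (cong (size inner +_) (size-singleton c)) (+-comm (size inner) 1))

    size-right : size W ≡ size inner + size right
    size-right = size-⊎ W inner right
      (λ i → ⇔⇒≡ (λ Wi → case bool (inner i) of λ where
                      (inj₁ p) → ∨⁺ˡ p
                      (inj₂ ¬p) → ∨⁺ʳ {inner i} (right⁺ Wi ¬p))
                  (λ p → case ∨⁻ {inner i} p of λ where
                      (inj₁ q) → proj₁ (inner⊆ q)
                      (inj₂ q) → proj₁ (right⁻ q)))
      (λ i p → ¬true⇒false λ q → true≢false p (proj₂ (right⁻ q)))

    orderLeft : ∀ {a} → size inner ≡ a → Ordering (λ _ → false) left c a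
    orderLeft eq = ordering (part-connected left⊆ left-attach) (part-noCut left⊆ left-attach) c∈left
      (trans size-left (cong suc eq))

    orderRight : ∀ {a} → size right ≡ suc a → Ordering (λ _ → false) right c a
    orderRight eq = ordering (part-connected (proj₁ ∘ right⁻) right-attach)
      (part-noCut (proj₁ ∘ right⁻) right-attach) c∈right eq

    -- With `s` as the root, `c` must not be a cut vertex of `left` either. Deleting it leaves
    -- `inner`, which is connected as a component; for all other vertices the root is merely moved
    -- from `c` to `s`.
    orderLeftFrom-s : ∀ {a} → size inner ≡ a → Ordering (λ _ → false) left s a
    orderLeftFrom-s eq = ordering (change-root {left} (inner⊆left s∈inner) (part-connected left⊆ left-attach)) noCut′
      (inner⊆left s∈inner) (trans size-left (cong suc eq))
      where
      noCut′ : NoCutBut left s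
      noCut′ {b} Lb b≢s with b Fin.≟ c
      ... | no b≢c = change-root {left ∖ b} (∖⁺ {S = left} (inner⊆left s∈inner) (b≢s ∘ sym))
              (part-noCut left⊆ left-attach Lb b≢c)
      ... | yes refl = restrict {left ∖ b} {inner}
              (λ p → case left⁻ (proj₁ (∖⁻ {S = left} p)) of λ where
                (inj₁ q) → q
                (inj₂ x≡c) → ⊥-elim (proj₂ (∖⁻ {S = left} p) x≡c))
              (λ _ _ q _ → ∖⁺ {S = left} (inner⊆left q) (proj₂ (inner⊆ q)))
              (component-connected {W ∖ b} {s})

    inner-all? : (∀ {i} → W i ≡ true → i ≢ c → inner i ≡ true) ⊎ (∃ λ y → right y ≡ true × y ≢ c)
    inner-all? with search {p = λ i → right i ∧ not (i ==F c)}
    ... | inj₁ (y , p) = inj₂ (y , ∖⁻ {S = right} p)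
    ... | inj₂ none = inj₁ λ {i} Wi i≢c → case bool (inner i) of λ where
      (inj₁ p) → p
      (inj₂ ¬p) → true≢false (∖⁺ {S = right} (right⁺ Wi ¬p) i≢c) (none i)

    inner-Star : ∀ {i} → inner i ≡ true → Star (Adj (induced G (W ∖ c))) s i
    inner-Star p = component-Star {W ∖ c} {s} p

  size-pos : ∀ {S : VS n} {i} → S i ≡ true → ∃ λ a → size S ≡ suc a
  size-pos {S} {i} p = size (S ∖ i) , size-∖ S i p

  size-two : ∀ {S : VS n} {i j a} → S i ≡ true → S j ≡ true → j ≢ i → size S ≡ suc a → 1 ≤ a
  size-two {S} {i} {j} Si Sj j≢i eq =
    ≤-trans (size-∈ (S ∖ i) j (∖⁺ {S = S} Sj j≢i)) (≤-reflexive (suc-injective (trans (sym (size-∖ S i Si)) eq)))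

module SplitFamily {n : ℕ} (G : Graph n) (G-sym : ∀ i j → G i j ≡ G j i) (irr : ∀ i → G i i ≡ false) where
  open Connectivity G G-sym
  open Subgraphs G
  open Combine G irr
  open SplitAt G G-sym
  open Families G G-sym

  module _ {W : VS n} {c s : Fin n} (Wc : W c ≡ true) (conn : Connected W c) (noCut : NoCutBut W c)
           (Ws : W s ≡ true) (s≢c : s ≢ c) where
    open Parts Wc conn noCut Ws s≢c

    joined : ∀ {N M} → Family left c N → Family right c (suc M) → Family W c (N + N * M)
    joined F F′ = glue left⊆ (proj₁ ∘ right⁻) left∩right (Family⇒FamilyThrough F) F′

    -- `x₁` and `x₂` count the vertices besides `c` on the two sides. If one of them is 1, the other
    -- is at least 4 and contributes the extra subgraph of `segFamily⁺`.
    splitFamily : ∀ {k} → 5 ≤ k → size W ≡ suc k → (∃ λ z → right z ≡ true × z ≢ c) →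
                  Family W c (3 + k + triN (suc k))
    splitFamily {k} 5≤k sizeW (z , Rz , z≢c) = build (size inner) (size-pos c∈right) refl
      where
      build : ∀ x₁ → (∃ λ x₂ → size right ≡ suc x₂) → size inner ≡ x₁ → Family W c (3 + k + triN (suc k))
      build x₁ (x₂ , size₂) size₁ = cases (m≤n⇒m<n∨m≡n 1≤x₁) (m≤n⇒m<n∨m≡n 1≤x₂)
        where
        o₁ : Ordering (λ _ → false) left c x₁
        o₁ = orderLeft size₁
        o₂ : Ordering (λ _ → false) right c x₂
        o₂ = orderRight size₂
        1≤x₁ : 1 ≤ x₁
        1≤x₁ = subst (1 ≤_) size₁ (size-∈ inner s s∈inner)
        1≤x₂ : 1 ≤ x₂
        1≤x₂ = size-two c∈right Rz z≢c size₂
        k≡ : x₁ + x₂ ≡ k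
        k≡ = suc-injective (sym (trans (sym sizeW) (trans size-right (trans (cong₂ _+_ size₁ size₂) (+-suc x₁ x₂)))))
        Goal : ℕ → Set₁
        Goal m = Family W c (3 + m + triN (suc m))
        both : 2 ≤ x₁ → 2 ≤ x₂ → Goal (x₁ + x₂)
        both 2≤x₁ 2≤x₂ = Family-weaken (product-bound₂ 2≤x₁ 2≤x₂ (subst (5 ≤_) (sym k≡) 5≤k))
          (joined (segFamily o₁ c∈left) (segFamily o₂ c∈right))
        leftSmall : 1 ≡ x₁ → 4 ≤ x₂ → Goal (1 + x₂)
        leftSmall 1≡x₁ 4≤x₂ = Family-weaken
          (≤-trans (product-bound₁ 4≤x₂) (≤-reflexive (*-suc 2 (1 + triN (suc x₂)))))
          (joined (subst (λ x → Family left c (suc (triN (suc x)))) (sym 1≡x₁) (segFamily o₁ c∈left))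
                  (segFamily⁺ o₂ c∈right (<⇒≤ 4≤x₂)))
        rightSmall : 1 ≡ x₂ → 4 ≤ x₁ → Goal (1 + x₁)
        rightSmall 1≡x₂ 4≤x₁ = Family-weaken
          (≤-trans (product-bound₁ 4≤x₁) (≤-reflexive (double (2 + triN (suc x₁)))))
          (joined (segFamily⁺ o₁ c∈left (<⇒≤ 4≤x₁))
                  (subst (λ x → Family right c (suc (triN (suc x)))) (sym 1≡x₂) (segFamily o₂ c∈right)))
          where
          double : ∀ z → 2 * z ≡ z + z * 1
          double = solve-∀
        cases : 1 < x₁ ⊎ 1 ≡ x₁ → 1 < x₂ ⊎ 1 ≡ x₂ → Goal k
        cases (inj₁ 2≤x₁) (inj₁ 2≤x₂) = subst Goal k≡ (both 2≤x₁ 2≤x₂)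
        cases (inj₂ 1≡x₁) _ = subst Goal k≡′ (leftSmall 1≡x₁ (s≤s⁻¹ (subst (5 ≤_) (sym k≡′) 5≤k)))
          where
          k≡′ : 1 + x₂ ≡ k
          k≡′ = trans (cong (_+ x₂) 1≡x₁) k≡
        cases (inj₁ _) (inj₂ 1≡x₂) = subst Goal k≡′ (rightSmall 1≡x₂ (s≤s⁻¹ (subst (5 ≤_) (sym k≡′) 5≤k)))
          where
          k≡′ : 1 + x₁ ≡ k
          k≡′ = trans (+-comm 1 x₁) (trans (cong (x₁ +_) 1≡x₂) k≡)

-- The position of v relative to the cut vertex

module _ {n : ℕ} (G : Graph n) (G-sym : ∀ i j → G i j ≡ G j i) where
  open Connectivity G G-sym
  open CycleFamilies G G-sym

  record PendantCycle (k : ℕ) (v : Fin n) : Set where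
    field
      {Y}   : VS n
      {c}   : Fin n
      Yc    : Y c ≡ true
      order : Ordering (λ _ → false) Y c k
      isCycle : IsCycle order Yc
      Y⇒≢v  : ∀ {i} → Y i ≡ true → i ≢ v
      ≢v⇒Y  : ∀ {i} → i ≢ v → Y i ≡ true
      v–c   : G v c ≡ true
      only-c : ∀ {j} → G v j ≡ true → j ≡ c

module Extremal {n : ℕ} (k : ℕ) (n≡ : n ≡ 2 + k) (5≤k : 5 ≤ k) (G : Graph n) (inC : InC n 1 G) (v : Fin n) where
  private
    G-sym = proj₁ (proj₁ inC)
    irr = proj₂ (proj₁ inC)

    everything : VS n
    everything _ = true

    oneCut = countB-one⁻ (isCutB G) (allFin n) (proj₂ (proj₂ inC))

    c : Fin n
    c = proj₁ oneCut

  open Connectivity G G-sym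
  open Subgraphs G
  open Combine G irr
  open SplitAt G G-sym
  open Families G G-sym
  open CycleFamilies G G-sym
  open SplitFamily G G-sym irr

  private
    connected : Connected everything c
    connected = Star⇒Connected {everything} λ {i} _ → Star.map (λ e → ∧⁺ e refl)
      (connectedB⁻ {S = everything} {G} (proj₁ (proj₂ inC)) {c} {i} refl refl)

    noCut : NoCutBut everything c
    noCut {b} _ b≢c = Star⇒Connected {everything ∖ b} λ {i} p →
      connectedB⁻ {S = everything ∖ b} {delete G b}
        (not-injective (proj₂ (proj₂ oneCut) (Mem.∈-allFin b) b≢c)) (∖⁺ {S = everything} refl (b≢c ∘ sym)) p
      where
      not-injective : ∀ {x} → not x ≡ false → x ≡ true
      not-injective {true} _ = refl

    7≤n : 7 ≤ n
    7≤n = ≤-trans (s≤s (s≤s 5≤k)) (≤-reflexive (sym n≡))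

    size-everything : size everything ≡ n
    size-everything = size-full everything (λ _ → refl)

    module At (s : Fin n) (s≢c : s ≢ c) where
      open Parts {everything} {c} {s} refl connected noCut refl s≢c public
      P X Y : VS n
      P = inner
      X = left
      Y = right

      -- Otherwise the component of `s` would be all of G - c, and `c` would not be a cut vertex.
      rest : ∃ λ y → Y y ≡ true × y ≢ c
      rest with inner-all?
      ... | inj₂ r = r
      ... | inj₁ all = true≢false (connectedB-rooted {S = everything ∖ c} {delete G c} del-sym s
              (λ i p → inner-Star  (all refl (proj₂ (∖⁻ {S = everything} p)))))
              (not⁻ (proj₁ (proj₂ oneCut)))
        where
        del-sym : ∀ {i j} → Adj (delete G c) i j → Adj (delete G c) j i
        del-sym {i} {j} e = let e′ , p = ∧⁻ {G i j} e ; pi , pj = ∧⁻ {not (i ==F c)} p in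
          ∧⁺ (flip-edge e′) (∧⁺ pj pi)

      sizeY : ∃ λ y → size Y ≡ suc y
      sizeY = size-pos (c∈right)

      y = proj₁ sizeY

      1≤y : 1 ≤ y
      1≤y = size-two (c∈right) (proj₁ (proj₂ rest)) (proj₂ (proj₂ rest)) (proj₂ sizeY)

      sizes : n ≡ size P + suc y
      sizes = trans (sym size-everything) (trans (size-right) (cong (size P +_) (proj₂ sizeY)))

      sizes′ : n ≡ suc (size P + y)
      sizes′ = trans sizes (+-suc (size P) y)

      1≤P : 1 ≤ size P
      1≤P = size-∈ P s (s∈inner)

      familyY : Family Y c (suc (triN (suc y)))
      familyY = segFamily (orderRight  (proj₂ sizeY)) (c∈right)

      X∩Y : ∀ {i} → X i ≡ true → Y i ≡ true → i ≡ c
      X∩Y = left∩right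

    -- One more than the upper bound for the pendant vertex of `L`, so minimality excludes it.
    Large : Set
    Large = 3 + triN n ≤ f G v

    atCut : v ≡ c → Large
    atCut v≡c = subst (λ z → 3 + triN n ≤ f G z) (sym v≡c)
        (subst (λ m → 3 + triN m ≤ f G c) (sym sizes′) (≤-trans
          (product-bound 1≤P 1≤y (s≤s⁻¹ (≤-trans 7≤n (≤-reflexive sizes′))))
          (Family⇒≤f (glue {W = everything} (λ _ → refl) (λ _ → refl) X∩Y (Family⇒FamilyThrough familyX) familyY))))
      where
      other : ∃ λ s → s ≢ c
      other with search {p = everything ∖ c}
      ... | inj₁ (s , p) = s , proj₂ (∖⁻ {S = everything} p)
      ... | inj₂ none = case trans (sym n≡) (trans (sym size-everything) (trans (size-∖ everything c refl) (cong suc (size-∅ _ none)))) of λ ()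
      s≢c = proj₂ other
      open At (proj₁ other) s≢c
      familyX : Family X c (suc (triN (suc (size P))))
      familyX = segFamily (orderLeft  refl) (c∈left)

    module OffCut (v≢c : v ≢ c) where
      open At v v≢c
      a = size P

      v∈X : X v ≡ true
      v∈X = inner⊆left  (s∈inner)

      c∈X : X c ≡ true
      c∈X = c∈left

      order : Ordering (λ _ → false) X v a
      order = orderLeftFrom-s  refl

      p q : ℕ
      p = Ordering.pos order c
      q = suc a ∸ p

      p+q : p + q ≡ suc a
      p+q = m+[n∸m]≡n (m≤n⇒m≤1+n (Ordering.pos≤ order c∈X))

      combined : ∀ {N M} → Family X v N → Family Y c (suc M) → N + suc (triN p + triN q) * M ≤ f G v
      combined F F′ = Family⇒≤f (glue {W = everything} (λ _ → refl) (λ _ → refl) X∩Y (throughFamily order v∈X c∈X F) F′)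

      -- The number of vertices of `Y` besides `c` decides. If it is at most 3, then 7 ≤ n forces
      -- `3 ≤ a`, and `X` supplies the extra subgraph that `block-bound⁺` asks for.
      block : 2 ≤ a → Large
      block 2≤a with 4 ≤? y
      ... | yes 4≤y = subst (λ m → 3 + triN m ≤ f G v) (sym sizes′)
              (≤-trans (subst (λ m → 3 + triN (m + y) ≤ 1 + triN m + suc (triN p + triN q) * triN (suc y)) p+q
                         (block-bound {p} {q} {y} (subst (3 ≤_) (sym p+q) (s≤s 2≤a)) 4≤y))
                       (combined (segFamily order v∈X) familyY))
      ... | no 4≰y = subst (λ m → 3 + triN m ≤ f G v) (sym sizes′)
              (≤-trans (subst (λ m → 3 + triN (m + y) ≤ 2 + triN m + suc (triN p + triN q) * triN (suc y)) p+q
                         (block-bound⁺ {p} {q} {y} 1≤y y≤3 (subst (λ m → 7 ≤ m + y) (sym p+q) 7≤)))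
                       (combined (segFamily⁺ order v∈X 3≤a) familyY))
        where
        y≤3 = s≤s⁻¹ (≰⇒> 4≰y)
        7≤ : 7 ≤ suc a + y
        7≤ = ≤-trans 7≤n (≤-reflexive sizes′)
        3≤a : 3 ≤ a
        3≤a = +-cancelʳ-≤ 3 3 a (≤-trans (s≤s⁻¹ 7≤) (+-monoʳ-≤ a y≤3))

      module Pendant (a≡1 : a ≡ 1) where
        sizeY≡ : size Y ≡ suc k
        sizeY≡ = trans (proj₂ sizeY) (suc-injective (sym (trans (sym n≡) (trans sizes (cong (_+ suc y) a≡1)))))

        c∈Y : Y c ≡ true
        c∈Y = c∈right

        orderY : Ordering (λ _ → false) Y c k
        orderY = orderRight  sizeY≡

        open Ordering orderY

        -- The last vertex of the ordering. It selects the component of Y - c to be examined and is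
        -- also the root at which `cycle-or-many` expects Y - c to be connected.
        tip : Fin n
        tip = vtx k

        Ytip : Y tip ≡ true
        Ytip = vtx∈ ≤-refl

        tip≢c : tip ≢ c
        tip≢c eq = <-irrefl (sym (trans (sym (pos-vtx ≤-refl)) (trans (cong pos eq) pos-r))) (≤-trans (s≤s z≤n) 5≤k)

        -- `X` contributes the vertex `v` alone and the edge from `v` to `c`, and the latter extends
        -- to every nontrivial member. The given number 3 + k + C(k+1, 2) equals 2 + C(n, 2), and
        -- the single vertex `v` adds one.
        many⇒Large : Family Y c (3 + k + triN (suc k)) → Large
        many⇒Large F = ≤-trans (≤-reflexive (trans (cong (λ m → 3 + triN m) n≡) (arrange k (triN (suc k)))))
          (≤-trans (+-monoʳ-≤ 2 (m≤m+n (2 + k + triN (suc k)) ((triN p + triN q) * (2 + k + triN (suc k)))))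
            (combined (subst (λ m → Family X v (suc (triN (suc m)))) a≡1 (segFamily order v∈X)) F))
          where
          arrange : ∀ k t → 3 + (suc k + t) ≡ 2 + (2 + k + t)
          arrange = solve-∀

        connY : Connected Y c
        connY = part-connected  (proj₁ ∘ right⁻)
          (right-attach)

        noCutY : NoCutBut Y c
        noCutY = part-noCut  (proj₁ ∘ right⁻)
          (right-attach)

        module Z = Parts {Y} {c} {tip} c∈Y connY noCutY Ytip tip≢c

        cycle-or-large : IsCycle orderY c∈Y ⊎ Large
        cycle-or-large = [ whole , inj₂ ∘ many⇒Large ∘ splitFamily c∈Y connY noCutY Ytip tip≢c 5≤k sizeY≡ ]′ Z.inner-all?
          where
          whole : (∀ {i} → Y i ≡ true → i ≢ c → Z.inner i ≡ true) → IsCycle orderY c∈Y ⊎ Large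
          whole all = [ inj₁ , inj₂ ∘ many⇒Large ]′ (cycle-or-many orderY c∈Y 5≤k (Star⇒Connected {Y ∖ c} λ p →
            Z.inner-Star (all (proj₁ (∖⁻ {S = Y} p)) (proj₂ (∖⁻ {S = Y} p)))))

        P≡v : ∀ {i} → P i ≡ true → i ≡ v
        P≡v {i} Pi = decidable-stable (i Fin.≟ v) λ i≢v →
          <-irrefl refl (≤-trans (size-two s∈inner Pi i≢v a≡1) z≤n)

        pendantCycle : IsCycle orderY c∈Y → PendantCycle G G-sym k v
        pendantCycle cyc = record
          { Yc = c∈Y ; order = orderY ; isCycle = cyc
          ; Y⇒≢v = λ { Yi refl → true≢false s∈inner (proj₂ (right⁻ Yi)) }
          ; ≢v⇒Y = λ i≢v → right⁺ refl (¬true⇒false (i≢v ∘ P≡v))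
          ; v–c = neighbour (connected (_==F v) {v} (==F-refl v) (λ _ → refl) (≢⇒==F (v≢c ∘ sym)))
          ; only-c = only-c
          }
          where
          only-c : ∀ {j} → G v j ≡ true → j ≡ c
          only-c {j} e = decidable-stable (j Fin.≟ c) λ j≢c →
            true≢false (subst (λ z → G v z ≡ true) (P≡v (inner-closed s∈inner refl j≢c e)) e) (irr v)
          neighbour : Leaves everything (_==F v) → G v c ≡ true
          neighbour (x , w , x≡v , _ , _ , e) = subst (λ z → G v z ≡ true) (only-c e′) e′
            where
            e′ : G v w ≡ true
            e′ = subst (λ z → G z w ≡ true) (==F⇒≡ {i = x} {v} x≡v) e

      pendant : a ≡ 1 → PendantCycle G G-sym k v ⊎ Large
      pendant a≡1 = map₁ (Pendant.pendantCycle a≡1) (Pendant.cycle-or-large a≡1)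

      offCut : PendantCycle G G-sym k v ⊎ Large
      offCut = [ inj₂ ∘ block , pendant ∘ sym ]′ (m≤n⇒m<n∨m≡n 1≤P)

  pendantCycle-or-large : PendantCycle G G-sym k v ⊎ 3 + triN n ≤ f G v
  pendantCycle-or-large = decide (v Fin.≟ c)
    where
    decide : Dec (v ≡ c) → PendantCycle G G-sym k v ⊎ Large
    decide (yes v≡c) = inj₂ (atCut v≡c)
    decide (no v≢c)  = OffCut.offCut v≢c

-- The isomorphism with the tadpole

module PendantCycleIso {k : ℕ} (2≤k : 2 ≤ k) (G : Graph (2 + k)) (G-sym : ∀ i j → G i j ≡ G j i)
                       {v : Fin (2 + k)} (pc : PendantCycle G G-sym k v) where
  open Connectivity G G-sym
  open CycleFamilies G G-sym
  open PendantCycle pc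
  open Ordering order
  open IsCycle isCycle
  open Tadpole k 2≤k

  private
    N : ℕ
    N = 2 + k

    rank : Fin N → ℕ
    rank i with i Fin.≟ v
    ... | yes _ = suc k
    ... | no _  = pos i

    rank-v : rank v ≡ suc k
    rank-v with v Fin.≟ v
    ... | yes _ = refl
    ... | no ¬p = ⊥-elim (¬p refl)

    rank-Y : ∀ {i} → i ≢ v → rank i ≡ pos i
    rank-Y {i} i≢v with i Fin.≟ v
    ... | yes p = ⊥-elim (i≢v p)
    ... | no _  = refl

    rank≤ : ∀ i → rank i ≤ suc k
    rank≤ i with i Fin.≟ v
    ... | yes _  = ≤-refl
    ... | no i≢v = m≤n⇒m≤1+n (pos≤ (≢v⇒Y i≢v))

    unrank : ℕ → Fin N
    unrank m with m ≤? k
    ... | yes _ = vtx m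
    ... | no _  = v

    unrank-≤ : ∀ {m} → m ≤ k → unrank m ≡ vtx m
    unrank-≤ {m} m≤k with m ≤? k
    ... | yes _ = refl
    ... | no ¬p = ⊥-elim (¬p m≤k)

    unrank-end : unrank (suc k) ≡ v
    unrank-end with suc k ≤? k
    ... | yes p = ⊥-elim (<-irrefl refl p)
    ... | no _  = refl

    unrank-rank : ∀ i → unrank (rank i) ≡ i
    unrank-rank i with i Fin.≟ v
    ... | yes refl = unrank-end
    ... | no i≢v   = trans (unrank-≤ (pos≤ (≢v⇒Y i≢v))) (vtx-pos (≢v⇒Y i≢v))

    rank-unrank : ∀ {m} → m ≤ suc k → rank (unrank m) ≡ m
    rank-unrank {m} m≤ with m ≤? k
    ... | yes m≤k = trans (rank-Y (Y⇒≢v (vtx∈ m≤k))) (pos-vtx m≤k)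
    ... | no m≰k  = trans rank-v (≤-antisym (≰⇒> m≰k) m≤)

    vtx-zero : vtx 0 ≡ c
    vtx-zero = trans (cong vtx (sym pos-r)) (vtx-pos Yc)

    rank-c : rank c ≡ next (rank v)
    rank-c = trans (rank-Y (Y⇒≢v Yc)) (trans pos-r (trans (sym (next-≥ (n≤1+n k))) (cong next (sym rank-v))))

    consecutive⇒next : ∀ {i j} → i ≢ v → j ≢ v → pos j ≡ suc (pos i) ⊎ (pos i ≡ k × pos j ≡ 0) → rank j ≡ next (rank i)
    consecutive⇒next i≢v j≢v (inj₁ eq) = trans (rank-Y j≢v) (trans eq (trans
      (sym (next-< (≤-trans (≤-reflexive (sym eq)) (pos≤ (≢v⇒Y j≢v))))) (cong next (sym (rank-Y i≢v)))))
    consecutive⇒next i≢v j≢v (inj₂ (i≡k , j≡0)) = trans (rank-Y j≢v) (trans j≡0 (trans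
      (sym (next-≥ (≤-reflexive (sym i≡k)))) (cong next (sym (rank-Y i≢v)))))

    edge⇒Adjacent : ∀ {i j} → G i j ≡ true → Adjacent (rank i) (rank j)
    edge⇒Adjacent {i} {j} e = decide (i Fin.≟ v) (j Fin.≟ v)
      where
      decide : Dec (i ≡ v) → Dec (j ≡ v) → Adjacent (rank i) (rank j)
      decide (yes refl) _ = inj₁ (trans (cong rank (only-c e)) rank-c)
      decide (no _) (yes refl) = inj₂ (trans (cong rank (only-c (flip-edge e))) rank-c)
      decide (no i≢v) (no j≢v) with only (≢v⇒Y i≢v) (≢v⇒Y j≢v) e
      ... | inj₁ p = inj₁ (consecutive⇒next i≢v j≢v p)
      ... | inj₂ p = inj₂ (consecutive⇒next j≢v i≢v p)

    next-edge : ∀ x → x ≤ suc k → G (unrank x) (unrank (next x)) ≡ true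
    next-edge x x≤ with <-cmp x k
    ... | tri< x<k _ _ = subst₂ (λ a b → G a b ≡ true) (sym (unrank-≤ (<⇒≤ x<k)))
            (sym (trans (cong unrank (next-< x<k)) (unrank-≤ x<k))) (path x<k)
    ... | tri≈ _ refl _ = subst₂ (λ a b → G a b ≡ true) (sym (unrank-≤ ≤-refl))
            (sym (trans (cong unrank (next-≥ ≤-refl)) (unrank-≤ z≤n))) closing
    ... | tri> _ _ k<x = subst₂ (λ a b → G a b ≡ true) (sym (trans (cong unrank (≤-antisym x≤ k<x)) unrank-end))
            (sym (trans (cong unrank (next-≥ (<⇒≤ k<x))) (trans (unrank-≤ z≤n) vtx-zero))) v–c

    next⇒edge : ∀ {i j} → rank j ≡ next (rank i) → G i j ≡ true
    next⇒edge {i} {j} eq = subst₂ (λ a b → G a b ≡ true) (unrank-rank i)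
      (trans (cong unrank (sym eq)) (unrank-rank j)) (next-edge (rank i) (rank≤ i))

    Adjacent⇒edge : ∀ {i j} → Adjacent (rank i) (rank j) → G i j ≡ true
    Adjacent⇒edge (inj₁ eq) = next⇒edge eq
    Adjacent⇒edge (inj₂ eq) = flip-edge (next⇒edge eq)

    to : Fin N → Fin N
    to i = at (rank i)

    toℕ-to : ∀ i → toℕ (to i) ≡ rank i
    toℕ-to i = toℕ-at (rank≤ i)

    π : Fin N ↔ Fin N
    π = mk↔ₛ′ to (unrank ∘ toℕ)
      (λ i → at-toℕ (sym (rank-unrank (toℕ≤ i))))
      (λ i → trans (cong unrank (toℕ-to i)) (unrank-rank i))

  isomorphism : Σ (Fin N ↔ Fin N) λ π →
    (∀ i j → G i j ≡ L N (Inverse.to π i) (Inverse.to π j)) × toℕ (Inverse.to π v) ≡ N ∸ 1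
  isomorphism = π , (λ i j → ⇔⇒≡
      (λ e → L⁺ {to i} {to j} (subst₂ Adjacent (sym (toℕ-to i)) (sym (toℕ-to j)) (edge⇒Adjacent e)))
      (λ e → Adjacent⇒edge (subst₂ Adjacent (toℕ-to i) (toℕ-to j) (L⁻ {to i} {to j} e)))) ,
    trans (toℕ-to v) rank-v

theorem3p12 : (n : ℕ) → 7 ≤ n → (G₀ : Graph n) (v₀ : Fin n) →
    InC n 1 G₀ →
    (∀ (G : Graph n) (v : Fin n) → InC n 1 G → f G₀ v₀ ≤ f G v) →
    Σ (Fin n ↔ Fin n) (λ π →
    (∀ i j → G₀ i j ≡ L n (Inverse.to π i) (Inverse.to π j)) ×
    toℕ (Inverse.to π v₀) ≡ n ∸ 1)
theorem3p12 (suc (suc k)) (s≤s (s≤s 5≤k)) G₀ v₀ inC@((G-sym , _) , _) minimal =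
  [ PendantCycleIso.isomorphism 2≤k G₀ G-sym , ⊥-elim ∘ tooMany ]′
    (Extremal.pendantCycle-or-large k refl 5≤k G₀ inC v₀)
  where
  2≤k : 2 ≤ k
  2≤k = ≤-trans (s≤s (s≤s z≤n)) 5≤k
  open Tadpole k 2≤k using (at; toℕ-at; L-InC)
  open TadpoleCount k 2≤k using (f-L≤)
  tooMany : ¬ 3 + triN (suc (suc k)) ≤ f G₀ v₀
  tooMany many = <-irrefl refl (≤-trans many (≤-trans
    (minimal (L (suc (suc k))) (at (suc k)) L-InC) (f-L≤ (at (suc k)) (toℕ-at ≤-refl))))
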